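{- Let $q$ be a prime power and let $L$ be a line of $\mathrm{PG}(5,q)$ in the $K$-orbit $o_{12,1}$. Then the hyperplane-orbit distribution $OD_4(L)$ is $\left[q+2,\,q^2+\frac{q-1}{2},\,q^2-\frac{q+1}{2},\,q^3-q^2\right]$ if $q$ is odd, and $\left[q^2+q+1,\,\frac{q^2+q}{2},\,\frac{q^2-q}{2},\,q^3-q^2\right]$ if $q$ is even.
   Context: A point $(y_0,\dots,y_5)$ of $\mathrm{PG}(5,q)$ is identified with the nonzero symmetric matrix $\begin{bmatrix} y_0&y_1&y_2\\ y_1&y_3&y_4\\ y_2&y_4&y_5\end{bmatrix}$ up to scalar. $K\cong\mathrm{PGL}(3,q)$ acts by $M\mapsto AMA^T$, $A\in\mathrm{GL}(3,q)$. The orbit $o_{12,1}$ is the $K$-orbit of the line $\left\{\begin{bmatrix} 0&x&0\\ x&0&y\\ 0&y&0\end{bmatrix}:(x,y)\in\mathrm{PG}(1,q)\right\}$. Hyperplanes correspond to conics of $\mathrm{PG}(2,q)$ (nonzero quadratic forms up to scalar): $\sum_{0\le i\le j\le2}a_{ij}X_iX_j$ corresponds to $a_{00}Y_0+a_{01}Y_1+a_{02}Y_2+a_{11}Y_3+a_{12}Y_4+a_{22}Y_5=0$. $\mathcal H_1,\mathcal H_{2,r},\mathcal H_{2,i},\mathcal H_3$ are the sets of hyperplanes corresponding respectively to double lines (scalar multiples of squares of linear forms), pairs of distinct real lines (products of two non-proportional linear forms over $\mathbb F_q$), pairs of conjugate imaginary lines (scalar multiples of products of two non-proportional linear forms conjugate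 over $\mathbb F_{q^2}$), and non-singular conics (those with $4a_{00}a_{11}a_{22}+a_{01}a_{02}a_{12}-a_{00}a_{12}^2-a_{11}a_{02}^2-a_{22}a_{01}^2\ne0$). $OD_4(L)=[h_1,h_{2,r},h_{2,i},h_3]$ lists the numbers of hyperplanes in $\mathcal H_1,\mathcal H_{2,r},\mathcal H_{2,i},\mathcal H_3$ containing $L$. -}

module Defs where

open import Level using (Level; suc; _⊔_)
open import Algebra.Bundles using (CommutativeRing)
open import Algebra.Morphism.Structures using (module RingMorphisms)
open import Algebra.Definitions.RawMonoid using () renaming (_×_ to multiple)
open import Algebra.Properties.Monoid.Sum using (sum)
open import Data.Fin using (Fin)
open import Data.Fin.Patterns using (0F; 1F; 2F; 3F; 4F; 5F)
open import Data.Nat as ℕ using (ℕ)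
open import Data.Nat.Primality using (Prime)
open import Data.Product using (Σ; ∃; ∃₂; _×_; _,_; proj₁; proj₂)
open import Data.Vec as Vec using (Vec)
open import Data.Vec.Functional using (Vector; []; _∷_)
import Data.Vec.Functional.Relation.Binary.Equality.Setoid as VecEq
open import Function.Bundles using (Inverse)
open import Relation.Binary.Bundles using (Setoid)
import Relation.Binary.Construct.On as On
open import Relation.Binary.PropositionalEquality as ≡ using (_≡_)
open import Relation.Nullary using (¬_)
open import Relation.Unary using (Pred; _∈_; _⊆_; _≐_)

IsPrimePower : ℕ → Set
IsPrimePower q = ∃₂ λ p k → Prime p × 1 ℕ.≤ k × q ≡ p ℕ.^ k

HasSize : ∀ {a ℓ} → Setoid a ℓ → ℕ → Set (a ⊔ ℓ)
HasSize S n = Inverse S (≡.setoid (Fin n))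

record FiniteField (q : ℕ) (c ℓ : Level) : Set (suc (c ⊔ ℓ)) where
  field
    commutativeRing : CommutativeRing c ℓ

  open CommutativeRing commutativeRing public

  field
    1≉0     : ¬ 1# ≈ 0#
    inverse : ∀ x → ¬ x ≈ 0# → ∃ λ y → x * y ≈ 1#
    order   : HasSize setoid q

-- A field of order q², together with an embedding of F into it.
record QuadraticExtension {q c ℓ} (F : FiniteField q c ℓ) (c′ ℓ′ : Level)
         : Set (c ⊔ ℓ ⊔ suc (c′ ⊔ ℓ′)) where
  private module F = FiniteField F
  field
    extension : FiniteField (q ℕ.^ 2) c′ ℓ′

  open FiniteField extension public

  field
    ι   : F.Carrier → Carrier
    hom : RingMorphisms.IsRingHomomorphism F.rawRing rawRing ι

  record Automorphism : Set (c ⊔ c′ ⊔ ℓ′) where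
    field
      σ              : Carrier → Carrier
      isIsomorphism  : RingMorphisms.IsRingIsomorphism rawRing rawRing σ
      fixesBaseField : ∀ x → σ (ι x) ≈ ι x

Proportional : ∀ {q c ℓ} (F : FiniteField q c ℓ) → let open FiniteField F in
               ∀ {n} → Vector Carrier n → Vector Carrier n → Set (c ⊔ ℓ)
Proportional F u v = ∃ λ a → ¬ a ≈ 0# × u ≋ (λ i → a * v i)
  where
  open FiniteField F
  open VecEq setoid using (_≋_)

-- For u = Σᵢ uᵢXᵢ and v = Σᵢ vᵢXᵢ, the coefficients of uv at
-- X₀², X₀X₁, X₀X₂, X₁², X₁X₂, X₂², in this order.
product : ∀ {q c ℓ} (F : FiniteField q c ℓ) → let open FiniteField F in
          Vector Carrier 3 → Vector Carrier 3 → Vector Carrier 6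
product F u v =
    u 0F * v 0F
  ∷ u 0F * v 1F + u 1F * v 0F
  ∷ u 0F * v 2F + u 2F * v 0F
  ∷ u 1F * v 1F
  ∷ u 1F * v 2F + u 2F * v 1F
  ∷ u 2F * v 2F
  ∷ []
  where open FiniteField F

-- Position of the (i , j) entry of a symmetric 3 × 3 matrix in (y₀,…,y₅);
-- also the position of the coefficient of XᵢXⱼ in a quadratic form.
index : Fin 3 → Fin 3 → Fin 6
index 0F 0F = 0F
index 0F 1F = 1F
index 0F 2F = 2F
index 1F 0F = 1F
index 1F 1F = 3F
index 1F 2F = 4F
index 2F 0F = 2F
index 2F 1F = 4F
index 2F 2F = 5F

module _ {q c ℓ} (F : FiniteField q c ℓ) where
  open FiniteField F
  open VecEq setoid using (_≋_)

  infix 4 _∼_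
  _∼_ : ∀ {n} → Vector Carrier n → Vector Carrier n → Set (c ⊔ ℓ)
  _∼_ = Proportional F

  private
    *-nonzero : ∀ {a b} → ¬ a ≈ 0# → ¬ b ≈ 0# → ¬ a * b ≈ 0#
    *-nonzero {a} {b} a≉0 b≉0 ab≈0 with inverse a a≉0
    ... | a⁻¹ , aa⁻¹≈1 = b≉0 (begin
      b              ≈⟨ *-identityˡ b ⟨
      1# * b         ≈⟨ *-congʳ (trans (*-comm a⁻¹ a) aa⁻¹≈1) ⟨
      (a⁻¹ * a) * b  ≈⟨ *-assoc a⁻¹ a b ⟩
      a⁻¹ * (a * b)  ≈⟨ *-congˡ ab≈0 ⟩
      a⁻¹ * 0#       ≈⟨ zeroʳ a⁻¹ ⟩
      0#             ∎)
      where open import Relation.Binary.Reasoning.Setoid setoid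

    ∼-refl : ∀ {n} {u : Vector Carrier n} → u ∼ u
    ∼-refl = 1# , 1≉0 , λ i → sym (*-identityˡ _)

    ∼-sym : ∀ {n} {u v : Vector Carrier n} →
            u ∼ v → v ∼ u
    ∼-sym {u = u} {v} (a , a≉0 , u≋av) with inverse a a≉0
    ... | b , ab≈1 =
        b
      , (λ b≈0 → 1≉0 (trans (sym ab≈1) (trans (*-congˡ b≈0) (zeroʳ a))))
      , λ i → begin
          v i            ≈⟨ *-identityˡ (v i) ⟨
          1# * v i       ≈⟨ *-congʳ (trans (*-comm b a) ab≈1) ⟨
          (b * a) * v i  ≈⟨ *-assoc b a (v i) ⟩
          b * (a * v i)  ≈⟨ *-congˡ (u≋av i) ⟨
          b * u i        ∎
      where open import Relation.Binary.Reasoning.Setoid setoid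

    ∼-trans : ∀ {n} {u v w : Vector Carrier n} →
              u ∼ v → v ∼ w → u ∼ w
    ∼-trans (a , a≉0 , u≋av) (b , b≉0 , v≋bw) =
        a * b
      , *-nonzero a≉0 b≉0
      , λ i → trans (u≋av i) (trans (*-congˡ (v≋bw i)) (sym (*-assoc a b _)))

  -- Homogeneous coordinate vectors of points of PG(5,q); two vectors are the
  -- same point when they are proportional.
  Point : Set (c ⊔ ℓ)
  Point = Σ (Vector Carrier 6) λ y → ¬ (∀ i → y i ≈ 0#)

  -- Coefficient vectors of hyperplanes, equivalently of quadratic forms
  -- (ordered as in `product`).
  Hyperplane : Set (c ⊔ ℓ)
  Hyperplane = Point

  hyperplanes : Setoid (c ⊔ ℓ) (c ⊔ ℓ)
  hyperplanes = record
    { Carrier       = Hyperplane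
    ; _≈_           = λ H H′ → proj₁ H ∼ proj₁ H′
    ; isEquivalence = record
        { refl = ∼-refl ; sym = ∼-sym ; trans = ∼-trans }
    }

  PointSet : Set (suc (c ⊔ ℓ))
  PointSet = Pred Point (c ⊔ ℓ)

  pointsOn : Hyperplane → Pred Point ℓ
  pointsOn (a , _) (y , _) = sum +-monoid (λ i → a i * y i) ≈ 0#

  -- The line joining two distinct points.
  record Line : Set (c ⊔ ℓ) where
    field
      P Q : Point
      P≁Q : ¬ (proj₁ P ∼ proj₁ Q)

    points : PointSet
    points (y , _) =
      ∃₂ λ s t → y ≋ (λ i → s * proj₁ P i + t * proj₁ Q i)

  Matrix₃ : Set c
  Matrix₃ = Fin 3 → Fin 3 → Carrier

  _∙_ : Matrix₃ → Matrix₃ → Matrix₃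
  (A ∙ B) i j = sum +-monoid (λ k → A i k * B k j)

  _ᵀ : Matrix₃ → Matrix₃
  (A ᵀ) i j = A j i

  _≈ᴹ_ : Matrix₃ → Matrix₃ → Set ℓ
  A ≈ᴹ B = ∀ i j → A i j ≈ B i j

  identity : Matrix₃
  identity 0F 0F = 1#
  identity 1F 1F = 1#
  identity 2F 2F = 1#
  identity _  _  = 0#

  record GL₃ : Set (c ⊔ ℓ) where
    field
      A A⁻¹    : Matrix₃
      inverseˡ : (A⁻¹ ∙ A) ≈ᴹ identity
      inverseʳ : (A ∙ A⁻¹) ≈ᴹ identity

  matrix : Vector Carrier 6 → Matrix₃
  matrix y i j = y (index i j)

  -- The image of a set of points under M ↦ AMAᵀ.
  image : GL₃ → PointSet → PointSet
  image g S (y , _) = ∃ λ N → N ∈ S × ∃ λ a → ¬ a ≈ 0# ×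
    (matrix y ≈ᴹ λ i j → a * ((A ∙ matrix (proj₁ N)) ∙ (A ᵀ)) i j)
    where open GL₃ g

  representative₁₂,₁ : PointSet
  representative₁₂,₁ (m , _) = ∃₂ λ x y → ¬ (x ≈ 0# × y ≈ 0#) ×
    m ∼ (0# ∷ x ∷ 0# ∷ 0# ∷ y ∷ 0# ∷ [])

  o₁₂,₁ : Pred Line (c ⊔ ℓ)
  o₁₂,₁ L = ∃ λ g → Line.points L ≐ image g representative₁₂,₁

  ℋ₁ : Pred Hyperplane (c ⊔ ℓ)
  ℋ₁ (f , _) = ∃₂ λ a u → ¬ a ≈ 0# × f ≋ (λ i → a * product F u u i)

  ℋ₂ᵣ : Pred Hyperplane (c ⊔ ℓ)
  ℋ₂ᵣ (f , _) = ∃₂ λ u v → ¬ (u ∼ v) × f ≋ product F u v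

  -- Conjugate linear forms are images of each other under an automorphism
  -- of the extension fixing F.
  ℋ₂ᵢ : ∀ {c′ ℓ′} → QuadraticExtension F c′ ℓ′ →
        Pred Hyperplane (c ⊔ ℓ ⊔ c′ ⊔ ℓ′)
  ℋ₂ᵢ E (f , _) =
    Σ E.Automorphism λ s → let open E.Automorphism s in
    ∃₂ λ (a : Carrier) (u : Vector E.Carrier 3) →
      let ū = λ i → σ (u i) in
      ¬ a ≈ 0# ×
      ¬ Proportional E.extension u ū ×
      (∀ i → E.ι (f i) E.≈ E.ι a E.* product E.extension u ū i)
    where module E = QuadraticExtension E

  ℋ₃ : Pred Hyperplane ℓ
  ℋ₃ (f , _) = ¬
    multiple +-rawMonoid 4 (a 0F 0F * a 1F 1F * a 2F 2F)
      + a 0F 1F * a 0F 2F * a 1F 2F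
      - a 0F 0F * (a 1F 2F * a 1F 2F)
      - a 1F 1F * (a 0F 2F * a 0F 2F)
      - a 2F 2F * (a 0F 1F * a 0F 1F) ≈ 0#
    where
    a : Fin 3 → Fin 3 → Carrier
    a i j = f (index i j)

  -- n hyperplanes of the set 𝒮, counted up to proportionality, contain L.
  CountContaining : ∀ {r} → Line → Pred Hyperplane r → ℕ → Set (c ⊔ ℓ ⊔ r)
  CountContaining L 𝒮 = HasSize (On.setoid hyperplanes
    (proj₁ {B = λ H → H ∈ 𝒮 × Line.points L ⊆ pointsOn H}))

  OD₄≡ : ∀ {c′ ℓ′} → Line → QuadraticExtension F c′ ℓ′ → Vec ℕ 4 →
         Set (c ⊔ ℓ ⊔ c′ ⊔ ℓ′)
  OD₄≡ L E (h₁ Vec.∷ h₂ᵣ Vec.∷ h₂ᵢ Vec.∷ h₃ Vec.∷ Vec.[]) =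
      CountContaining L ℋ₁ h₁
    × CountContaining L ℋ₂ᵣ h₂ᵣ
    × CountContaining L (ℋ₂ᵢ E) h₂ᵢ
    × CountContaining L ℋ₃ h₃

{-# OPTIONS --safe #-}
module Submission where

{- The action of A on points is dual to the substitution f(X) ↦ f(AX), which preserves each of
   the four classes of forms.  Hence only the representative line matters: its hyperplanes
   are the forms aX₀² + bX₀X₂ + cX₂² + dX₁², with discriminant d(4ac − b²).

   Products of two linear forms are counted through their ordered factorizations: exchanging
   the two factors is an involution without fixed points whose orbits are the products.
   If d = 0 these are binary forms, given by two distinct points of PG(1,q), or by a point of
   PG(1,q²) outside PG(1,q) and its conjugate.  If d ≠ 0 the product is, up to a scalar,
   X₁² − D l(X₀,X₂)², with D = 1 for real lines and D = δ² for imaginary ones, where δ spans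
   the elements of the extension whose conjugate is their negative.  The two factors are
   distinct iff 2l ≠ 0, so this family has (q² − 1)/2 members if q is odd and none if q is even. -}

-- The fields are given by their axioms and orders, so the algebra behind the counts is itself
-- obtained by counting. Whether 2 = 0 is decided by involutions without fixed points on `F`, square
-- roots in characteristic 2 come from the injectivity of squaring, and the basis 1, α of the
-- extension comes from the fact that there are just q·q combinations. Conjugation is built on this
-- basis from the second root of the minimal polynomial of α. The definition of imaginary pairs
-- admits every automorphism over F; each of them is shown to be the identity or this conjugation.
--
-- Let b be the number of l(X₀,X₂) with 2l ≠ 0. There are (q² - q) + 2q + b ordered real
-- factorizations and (q² - q) + b imaginary ones, whatever the parity of q, which enters these two
-- counts only through b. A field has no natural choice between l and -l, or between two roots; the
-- halving takes the representative of an orbit from the enumeration of the finite setoid instead.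
-- Since forms are counted up to a scalar, each family of them is normalized by a coefficient 1,
-- which turns proportionality into equality.

open import Defs
open import Level using (Level; _⊔_)
open import Algebra.Bundles using (CommutativeRing; RawRing)
open import Algebra.Morphism.Structures using (module RingMorphisms)
import Algebra.Properties.AbelianGroup
import Algebra.Properties.Ring
import Algebra.Properties.Semiring.Mult.TCOptimised
open import Data.Bool using (true; false)
open import Data.Fin as Fin using (Fin; _↑ˡ_; _↑ʳ_; combine)
open import Data.Fin.Patterns using (0F; 1F; 2F; 3F; 4F; 5F)
open import Data.Fin.Permutation using (↔⇒≡)
import Data.Fin.Properties as Fin
open import Data.Integer as ℤ using (ℤ; +_; -[1+_]; _⊖_)
import Data.Integer.Properties as ℤ
open import Data.Maybe using (nothing)
open import Data.Nat as ℕ using (ℕ)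
open import Data.Nat.Divisibility using (_∣_; divides; _∣0; ∣-refl; ∣m∣n⇒∣m+n; ∣m+n∣m⇒∣n; ∣1⇒≡1)
import Data.Nat.DivMod as ℕ
import Data.Nat.Properties as ℕ
open import Data.Nat.Solver using (module +-*-Solver)
open import Data.Product using (Σ; ∃; ∃₂; _×_; _,_; proj₁; proj₂)
open import Data.Product.Function.NonDependent.Setoid using (_×-inverse_)
open import Data.Product.Relation.Binary.Pointwise.NonDependent using (×-setoid; Pointwise-≡↔≡)
open import Data.Sum as Sum using (_⊎_; inj₁; inj₂)
open import Data.Sum.Function.Setoid using (_⊎-inverse_)
open import Data.Sum.Relation.Binary.Pointwise using (⊎-setoid; inj₁; inj₂) renaming (Pointwise-≡↔≡ to ⊎-Pointwise-≡↔≡)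
open import Data.Vec as Vec using (Vec)
open import Data.Vec.Functional using (Vector)
open import Data.Vec.N-ary using (N-ary; curryⁿ; _$ⁿ_; ∀ⁿ; uncurry-∀ⁿ; left-inverse)
open import Function.Base using (id; _∘_)
open import Function.Bundles using (Equivalence; Inverse)
import Function.Construct.Composition as Compose
import Function.Construct.Identity as Identity
import Function.Construct.Symmetry as Symmetry
open import Relation.Binary.Bundles using (Setoid)
import Relation.Binary.Construct.On as On
open import Relation.Binary.Definitions using (_Respects_; tri<; tri≈; tri>)
open import Relation.Binary.PropositionalEquality as ≡ using (_≡_)
open import Relation.Nullary using (¬_; Dec; yes; no; contradiction)
open import Relation.Nullary.Decidable using (map′; decidable-stable)
open import Relation.Unary using (Pred; Decidable; ∁; _∈_; _⊆_; _≐_)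
open import Tactic.RingSolver.Core.AlmostCommutativeRing using (fromCommutativeRing)
open import Tactic.RingSolver.Core.Expression using (Expr; Κ; Ι; _⊕_; _⊗_; ⊝_; _⊛_; module Eval)
import Tactic.RingSolver.Core.Polynomial.Base
import Tactic.RingSolver.Core.Polynomial.Homomorphism
open import Tactic.RingSolver.Core.Polynomial.Parameters using (RawCoeff; Homomorphism)
import Tactic.RingSolver.Core.Polynomial.Semantics

-- Finite setoids

module FiniteSetoids where
  open import Data.Fin using (zero; suc)
  open import Data.Nat using (zero; suc; _+_; _*_)

  private
    variable
      a b ℓ₁ ℓ₂ p : Level
      m n k : ℕ

  infix 5 _∣ₛ_
  -- Equality disregards the proof of `P`, in the same way as in `CountContaining`.
  _∣ₛ_ : (S : Setoid a ℓ₁) → Pred (Setoid.Carrier S) p → Setoid (a ⊔ p) ℓ₁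
  S ∣ₛ P = On.setoid S (proj₁ {B = P})

  module _ {S : Setoid a ℓ₁} (size : HasSize S n) where
    open Setoid S
    open Inverse size using (to; from; to-cong; strictlyInverseˡ; strictlyInverseʳ)

    to-injective : ∀ {x y} → to x ≡ to y → x ≈ y
    to-injective {x} {y} eq =
      trans (sym (strictlyInverseʳ x)) (trans (Inverse.from-cong size eq) (strictlyInverseʳ y))

    finite-≟ : ∀ x y → Dec (x ≈ y)
    finite-≟ x y = map′ to-injective to-cong (to x Fin.≟ to y)

    finite-any? : {P : Pred Carrier p} → P Respects _≈_ → Decidable P → Dec (∃ P)
    finite-any? resp P? = map′ (λ (i , p) → from i , p)
      (λ (x , p) → to x , resp (sym (strictlyInverseʳ x)) p) (Fin.any? (P? ∘ from))

  size-unique : {A : Setoid a ℓ₁} → HasSize A m → HasSize A n → m ≡ n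
  size-unique s t = ↔⇒≡ (Compose.inverse (Symmetry.inverse s) t)

  module _ {A : Setoid a ℓ₁} {X : Setoid b ℓ₂} where
    private
      module A = Setoid A
      module X = Setoid X

    -- The preimages `ψ` are chosen pointwise and come without a congruence law, which injectivity
    -- of `φ` supplies. This matters because preimages are found below by case distinctions that do
    -- not visibly respect equality.
    sizeByBijection : HasSize A n →
      (φ : A.Carrier → X.Carrier) → (∀ {x y} → x A.≈ y → φ x X.≈ φ y) →
      (∀ {x y} → φ x X.≈ φ y → x A.≈ y) → (∀ x → ∃ λ y → φ y X.≈ x) → HasSize X n
    sizeByBijection size φ cong inj ψ = Compose.inverse (record
      { to        = proj₁ ∘ ψ
      ; from      = φ
      ; to-cong   = λ {x} {y} x≈y → inj (X.trans (proj₂ (ψ x)) (X.trans x≈y (X.sym (proj₂ (ψ y)))))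
      ; from-cong = cong
      ; inverse   = (λ {x} y≈φx → inj (X.trans (proj₂ (ψ _)) y≈φx))
                  , (λ {x} y≈ψx → X.trans (cong y≈ψx) (proj₂ (ψ x)))
      }) size

    size-× : HasSize A m → HasSize X n → HasSize (×-setoid A X) (m * n)
    size-× s t = Compose.inverse (s ×-inverse t)
      (Compose.inverse Pointwise-≡↔≡ (Symmetry.inverse Fin.*↔×))

    size-⊎ : HasSize A m → HasSize X n → HasSize (⊎-setoid A X) (m + n)
    size-⊎ s t = Compose.inverse (s ⊎-inverse t)
      (Compose.inverse (⊎-Pointwise-≡↔≡ _ _) (Symmetry.inverse Fin.+↔⊎))

  private
    Enumeration : Pred (Fin n) p → ℕ → Set p
    Enumeration {n = n} P m = Σ (Fin m → Fin n) λ f →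
      (∀ i → P (f i)) × (∀ {i j} → f i ≡ f j → i ≡ j) × (∀ i → P i → ∃ λ j → f j ≡ i)

    keep : {P : Pred (Fin (suc n)) p} → P zero → Enumeration (P ∘ suc) m → Enumeration P (suc m)
    keep {m = m} {P = P} P0 (f , f∈ , inj , sur) = g , g∈ , g-inj , g-sur
      where
      g : Fin (suc m) → _
      g zero    = zero
      g (suc i) = suc (f i)
      g∈ : ∀ i → P (g i)
      g∈ zero    = P0
      g∈ (suc i) = f∈ i
      g-inj : ∀ {i j} → g i ≡ g j → i ≡ j
      g-inj {zero}  {zero}  _  = ≡.refl
      g-inj {suc i} {suc j} eq = ≡.cong suc (inj (Fin.suc-injective eq))
      g-sur : ∀ i → P i → ∃ λ j → g j ≡ i
      g-sur zero    _  = zero , ≡.refl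
      g-sur (suc i) Pi = let j , eq = sur i Pi in suc j , ≡.cong suc eq

    skip : {P : Pred (Fin (suc n)) p} → ¬ P zero → Enumeration (P ∘ suc) m → Enumeration P m
    skip {P = P} ¬P0 (f , f∈ , inj , sur) = suc ∘ f , f∈ , inj ∘ Fin.suc-injective , g-sur
      where
      g-sur : ∀ i → P i → ∃ λ j → suc (f j) ≡ i
      g-sur zero    P0 = contradiction P0 ¬P0
      g-sur (suc i) Pi = let j , eq = sur i Pi in j , ≡.cong suc eq

    -- The subset and its complement are listed in one recursion, so that their sizes are linked by
    -- `m + k ≡ n`, which stands in for a subtraction.
    enumerate : ∀ {n} {P : Pred (Fin n) p} → Decidable P →
      ∃₂ λ m k → Enumeration P m × Enumeration (∁ P) k × m + k ≡ n
    enumerate {n = zero} P? = 0 , 0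
      , ((λ ()) , (λ ()) , (λ {}) , λ ()) , ((λ ()) , (λ ()) , (λ {}) , λ ()) , ≡.refl
    enumerate {n = suc n} P? with enumerate (P? ∘ suc) | P? zero
    ... | m , k , e , e′ , eq | yes P0 =
      suc m , k , keep P0 e , skip (λ ¬P0 → ¬P0 P0) e′ , ≡.cong suc eq
    ... | m , k , e , e′ , eq | no ¬P0 =
      m , suc k , skip ¬P0 e , keep ¬P0 e′ , ≡.trans (ℕ.+-suc m k) (≡.cong suc eq)

  module _ {S : Setoid a ℓ₁} (size : HasSize S n) where
    open Setoid S
    open Inverse size using (to; from; to-cong; from-cong; strictlyInverseˡ; strictlyInverseʳ)

    private
      enumeration-size : {P : Pred Carrier p} → P Respects _≈_ →
                         Enumeration (P ∘ from) m → HasSize (S ∣ₛ P) m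
      enumeration-size resp (f , f∈ , inj , sur) =
        sizeByBijection {A = ≡.setoid _} (Identity.inverse _)
          (λ i → from (f i) , f∈ i) (λ { ≡.refl → refl })
          (λ eq → inj (≡.trans (≡.sym (strictlyInverseˡ _)) (≡.trans (to-cong eq) (strictlyInverseˡ _))))
          (λ (x , Px) → let j , eq = sur (to x) (resp (sym (strictlyInverseʳ x)) Px)
                        in j , trans (from-cong eq) (strictlyInverseʳ x))

    split : {P : Pred Carrier p} → P Respects _≈_ → Decidable P →
      ∃₂ λ m k → HasSize (S ∣ₛ P) m × HasSize (S ∣ₛ ∁ P) k × m + k ≡ n
    split {P = P} resp P? =
      let m , k , e , e′ , eq = enumerate (P? ∘ from)
      in m , k , enumeration-size resp e
       , enumeration-size (λ x≈y ¬Px Py → ¬Px (resp (sym x≈y) Py)) e′ , eq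

  record FreeInvolution (S : Setoid a ℓ₁) : Set (a ⊔ ℓ₁) where
    open Setoid S
    field
      τ            : Carrier → Carrier
      τ-cong       : ∀ {x y} → x ≈ y → τ x ≈ τ y
      τ-involutive : ∀ x → τ (τ x) ≈ x
      τ-free       : ∀ x → ¬ τ x ≈ x

    ≈τ-sym : ∀ {x y} → x ≈ τ y → y ≈ τ x
    ≈τ-sym x≈τy = trans (sym (τ-involutive _)) (τ-cong (sym x≈τy))

    infix 4 _≈τ_
    _≈τ_ : Carrier → Carrier → Set ℓ₁
    x ≈τ y = x ≈ y ⊎ x ≈ τ y

    orbits : Setoid a ℓ₁
    orbits = record
      { Carrier = Carrier
      ; _≈_     = _≈τ_
      ; isEquivalence = record
        { refl  = inj₁ refl
        ; sym   = λ { (inj₁ x≈y)  → inj₁ (sym x≈y)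
                    ; (inj₂ x≈τy) → inj₂ (≈τ-sym x≈τy) }
        ; trans = λ { (inj₁ x≈y)  (inj₁ y≈z)  → inj₁ (trans x≈y y≈z)
                    ; (inj₁ x≈y)  (inj₂ y≈τz) → inj₂ (trans x≈y y≈τz)
                    ; (inj₂ x≈τy) (inj₁ y≈z)  → inj₂ (trans x≈τy (τ-cong y≈z))
                    ; (inj₂ x≈τy) (inj₂ y≈τz) → inj₁ (trans x≈τy (trans (τ-cong y≈τz) (τ-involutive _))) }
        }
      }

    -- An orbit consists of x and τ x, and exactly one of the two has the smaller index in the
    -- enumeration. These low elements represent the orbits, and τ maps them bijectively onto the
    -- remaining elements, so they make up half of the setoid.
    orbits-size : HasSize S n → ∃ λ m → HasSize orbits m × m + m ≡ n
    orbits-size size =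
      let m , k , s , s′ , eq = split size Low-resp Low?
          m≡k = size-unique (sizeByBijection s
            (λ (x , lx) → τ x , λ lτx → ℕ.<-asym lx (Low-resp′ x lτx)) τ-cong τ-injective
            (λ (x , hx) → (τ x , high⇒low x hx) , τ-involutive x)) s′
      in m , sizeByBijection s proj₁ inj₁ (λ {x} {y} → low-injective {x} {y}) low-surjective
           , ≡.trans (≡.cong (λ i → m + i) m≡k) eq
      where
      open Inverse size using (to; to-cong)
      Low : Pred Carrier _
      Low x = to x Fin.< to (τ x)
      Low? : Decidable Low
      Low? x = to x Fin.<? to (τ x)
      Low-resp : Low Respects _≈_
      Low-resp x≈y = ≡.subst₂ Fin._<_ (to-cong x≈y) (to-cong (τ-cong x≈y))
      Low-resp′ : ∀ x → Low (τ x) → to (τ x) Fin.< to x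
      Low-resp′ x = ≡.subst (to (τ x) Fin.<_) (to-cong (τ-involutive x))
      τ-injective : ∀ {x y} → τ x ≈ τ y → x ≈ y
      τ-injective τx≈τy = trans (≈τ-sym (sym τx≈τy)) (τ-involutive _)
      high⇒low : ∀ x → ¬ Low x → Low (τ x)
      high⇒low x hx with Fin.<-cmp (to x) (to (τ x))
      ... | tri< l _ _ = contradiction l hx
      ... | tri≈ _ e _ = contradiction (sym (to-injective size e)) (τ-free x)
      ... | tri> _ _ g = ≡.subst (to (τ x) Fin.<_) (to-cong (sym (τ-involutive x))) g
      low-injective : ∀ {x y : ∃ Low} → proj₁ x ≈τ proj₁ y → proj₁ x ≈ proj₁ y
      low-injective (inj₁ x≈y) = x≈y
      low-injective {x , lx} {y , ly} (inj₂ x≈τy) = contradiction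
        (≡.subst₂ Fin._<_ (to-cong x≈τy) (to-cong (sym (≈τ-sym x≈τy))) lx) (ℕ.<-asym ly)
      low-surjective : ∀ x → ∃ λ (y : ∃ Low) → proj₁ y ≈τ x
      low-surjective x with Low? x
      ... | yes lx = (x , lx) , inj₁ refl
      ... | no  hx = (τ x , high⇒low x hx) , inj₂ refl

    module _ {X : Setoid b ℓ₂} where
      private
        module X = Setoid X

      -- The fibres of `φ` are precisely the orbits of τ, so `φ` is two-to-one. Products of two
      -- distinct linear forms are counted in this way from their ordered factorizations.
      sizeByFolding : HasSize S n →
        (φ : Carrier → X.Carrier) → (∀ {x y} → x ≈ y → φ x X.≈ φ y) → (∀ x → φ (τ x) X.≈ φ x) →
        (∀ {x y} → φ x X.≈ φ y → x ≈τ y) → (∀ x → ∃ λ y → φ y X.≈ x) →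
        ∃ λ m → HasSize X m × m + m ≡ n
      sizeByFolding size φ cong φτ inj ψ =
        let m , s , eq = orbits-size size
        in m , sizeByBijection s φ φ-cong inj ψ , eq
        where
        φ-cong : ∀ {x y} → x ≈τ y → φ x X.≈ φ y
        φ-cong (inj₁ x≈y)  = cong x≈y
        φ-cong (inj₂ x≈τy) = X.trans (cong x≈τy) (φτ _)

  module _ {A : Setoid a ℓ₁} {B : Setoid b ℓ₂} where
    private
      module A = Setoid A
      module B = Setoid B

    -- The image has n elements, hence its complement has none; as membership in the image is
    -- decidable, a preimage can be extracted. This takes the place of dimension arguments for the
    -- extension field.
    injective⇒surjective : HasSize A n → HasSize B n →
      (φ : A.Carrier → B.Carrier) → (∀ {x y} → x A.≈ y → φ x B.≈ φ y) →
      (∀ {x y} → φ x B.≈ φ y → x A.≈ y) → ∀ y → ∃ λ x → φ x B.≈ y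
    injective⇒surjective s t φ cong inj y =
      let m , k , image , rest , eq = split t {P = Image} resp image?
          n≡m = size-unique (sizeByBijection s (λ x → φ x , x , B.refl) cong inj
                  (λ (y , x , φx≈y) → x , φx≈y)) image
          k≡0 = ℕ.+-cancelˡ-≡ m _ _ (≡.trans eq (≡.trans n≡m (≡.sym (ℕ.+-identityʳ m))))
      in decidable-stable (image? y) λ y∉ → ¬Fin0 (≡.subst Fin k≡0 (Inverse.to rest (y , y∉)))
      where
      Image : Pred B.Carrier _
      Image y = ∃ λ x → φ x B.≈ y
      resp : Image Respects B._≈_
      resp y≈z (x , φx≈y) = x , B.trans φx≈y y≈z
      image? : Decidable Image
      image? y = finite-any? s (λ x≈x′ φx≈y → B.trans (cong (A.sym x≈x′)) φx≈y)
                               (λ x → finite-≟ t (φ x) y)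
      ¬Fin0 : ¬ Fin 0
      ¬Fin0 ()

  module _ {S : Setoid a ℓ₁} (size : HasSize S n) where
    open Setoid S

    complement-size : {P : Pred Carrier p} → P Respects _≈_ → Decidable P →
      HasSize (S ∣ₛ P) m → ∃ λ k → HasSize (S ∣ₛ ∁ P) k × m + k ≡ n
    complement-size resp P? s =
      let m′ , k , s′ , t , eq = split size resp P?
      in k , t , ≡.trans (≡.cong (_+ k) (size-unique s s′)) eq

    punctured-size : ∀ x → ∃ λ k → HasSize (S ∣ₛ λ y → ¬ y ≈ x) k × suc k ≡ n
    punctured-size x = complement-size (λ y≈z y≈x → trans (sym y≈z) y≈x) (λ y → finite-≟ size y x)
      (sizeByBijection {A = ≡.setoid (Fin 1)} (Identity.inverse _) (λ _ → x , refl) (λ _ → refl)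
        (λ { {zero} {zero} _ → ≡.refl }) (λ (_ , y≈x) → zero , sym y≈x))

  swap-free : (S : Setoid a ℓ₁) → FreeInvolution (⊎-setoid S S)
  swap-free S = record
    { τ            = Sum.swap
    ; τ-cong       = λ { (inj₁ e) → inj₂ e ; (inj₂ e) → inj₁ e }
    ; τ-involutive = λ { (inj₁ x) → inj₁ (Setoid.refl S) ; (inj₂ x) → inj₂ (Setoid.refl S) }
    ; τ-free       = λ { (inj₁ x) () ; (inj₂ x) () }
    }

  ⊎-free : {S : Setoid a ℓ₁} {T : Setoid b ℓ₂} →
           FreeInvolution S → FreeInvolution T → FreeInvolution (⊎-setoid S T)
  ⊎-free s t = record
    { τ            = Sum.map S.τ T.τ
    ; τ-cong       = λ { (inj₁ e) → inj₁ (S.τ-cong e) ; (inj₂ e) → inj₂ (T.τ-cong e) }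
    ; τ-involutive = λ { (inj₁ x) → inj₁ (S.τ-involutive x) ; (inj₂ x) → inj₂ (T.τ-involutive x) }
    ; τ-free       = λ { (inj₁ x) (inj₁ e) → S.τ-free x e ; (inj₂ x) (inj₂ e) → T.τ-free x e }
    }
    where
    module S = FreeInvolution s
    module T = FreeInvolution t

open FiniteSetoids

-- A ring solver with integer coefficients: an identity e₁ ≈ e₂ is checked by computing the normal
-- form of e₁ − e₂ over ℤ, so that no term of the ring itself is evaluated.

coefficients : RawCoeff _ _
coefficients = record { rawRing = ℤ.+-*-rawRing ; isZero = λ { (+ 0) → true ; _ → false } }

module Poly = Tactic.RingSolver.Core.Polynomial.Base coefficients

normal : ∀ {n} → Expr ℤ n → Poly.Poly n
normal (Κ x)   = Poly.κ x
normal (Ι x)   = Poly.ι x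
normal (x ⊕ y) = normal x Poly.⊞ normal y
normal (x ⊗ y) = normal x Poly.⊠ normal y
normal (⊝ x)   = Poly.⊟ normal x
normal (x ⊛ i) = normal x Poly.⊡ i

-- For a true identity this reduces to the unit type, so the hidden arguments of `solve` and
-- `prove₆` are filled in by computation.
Vanishes : ∀ {n} → Expr ℤ n → Set
Vanishes e = Poly.Zero (normal e)

-- Syntax as a raw ring: `QuadraticForms`, instantiated with it, turns each formula about forms into
-- an expression for the solver, so that large identities need not be spelled out a second time.
exprs : ℕ → RawRing _ _
exprs n = record { Carrier = Expr ℤ n ; _≈_ = _≡_ ; _+_ = _⊕_ ; _*_ = _⊗_ ; -_ = ⊝_ ; 0# = Κ (+ 0) ; 1# = Κ (+ 1) }

infix 4 _⊜_
_⊜_ : ∀ {n} → Expr ℤ n → Expr ℤ n → Expr ℤ n × Expr ℤ n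
_⊜_ = _,_

∀₆ : ∀ {p} {P : Fin 6 → Set p} → P 0F × P 1F × P 2F × P 3F × P 4F × P 5F → ∀ i → P i
∀₆ (p , _) 0F = p
∀₆ (_ , p , _) 1F = p
∀₆ (_ , _ , p , _) 2F = p
∀₆ (_ , _ , _ , p , _) 3F = p
∀₆ (_ , _ , _ , _ , p , _) 4F = p
∀₆ (_ , _ , _ , _ , _ , p) 5F = p

module Solver {c ℓ} (R : CommutativeRing c ℓ) where
  open CommutativeRing R
  open Algebra.Properties.Semiring.Mult.TCOptimised semiring using (1+×; ×-homo-+; ×1-homo-*) renaming (_×_ to _·_)
  open import Data.Nat using (zero; suc)
  open Algebra.Properties.Ring ring using (-‿distribˡ-*; -‿distribʳ-*; -0#≈0#; -‿involutive)
  open Algebra.Properties.AbelianGroup +-abelianGroup using (⁻¹-∙-comm; x∙y⁻¹≈ε⇒x≈y)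
  open import Relation.Binary.Reasoning.Setoid setoid

  ⟦_⟧ℤ : ℤ → Carrier
  ⟦ + n ⟧ℤ      = n · 1#
  ⟦ -[1+ n ] ⟧ℤ = - (suc n · 1#)

  ⟦⊖⟧ : ∀ m n → ⟦ m ⊖ n ⟧ℤ ≈ m · 1# - n · 1#
  ⟦⊖⟧ m zero = begin
    m · 1#        ≈⟨ +-identityʳ _ ⟨
    m · 1# + 0#   ≈⟨ +-congˡ -0#≈0# ⟨
    m · 1# - 0#   ∎
  ⟦⊖⟧ zero (suc n) = sym (+-identityˡ _)
  ⟦⊖⟧ (suc m) (suc n) = begin
    ⟦ suc m ⊖ suc n ⟧ℤ                    ≡⟨ ≡.cong ⟦_⟧ℤ (ℤ.[1+m]⊖[1+n]≡m⊖n m n) ⟩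
    ⟦ m ⊖ n ⟧ℤ                            ≈⟨ ⟦⊖⟧ m n ⟩
    m · 1# - n · 1#                       ≈⟨ +-identityˡ _ ⟨
    0# + (m · 1# - n · 1#)                ≈⟨ +-congʳ (-‿inverseʳ 1#) ⟨
    (1# - 1#) + (m · 1# - n · 1#)         ≈⟨ interchange 1# (- 1#) (m · 1#) (- (n · 1#)) ⟩
    (1# + m · 1#) + (- 1# + - (n · 1#))   ≈⟨ +-congˡ (⁻¹-∙-comm _ _) ⟩
    (1# + m · 1#) - (1# + n · 1#)         ≈⟨ +-cong (1+× m 1#) (-‿cong (1+× n 1#)) ⟨
    suc m · 1# - suc n · 1#               ∎
    where
    open import Algebra.Properties.CommutativeSemigroup +-commutativeSemigroup using (interchange)

  ⟦⟧-homo-+ : ∀ x y → ⟦ x ℤ.+ y ⟧ℤ ≈ ⟦ x ⟧ℤ + ⟦ y ⟧ℤ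
  ⟦⟧-homo-+ (+ m)      (+ n)      = ×-homo-+ 1# m n
  ⟦⟧-homo-+ (+ m)      -[1+ n ]   = ⟦⊖⟧ m (suc n)
  ⟦⟧-homo-+ -[1+ m ]   (+ n)      = trans (⟦⊖⟧ n (suc m)) (+-comm _ _)
  ⟦⟧-homo-+ -[1+ m ]   -[1+ n ]   = begin
    - (suc (suc (m ℕ.+ n)) · 1#)          ≡⟨ ≡.cong (λ k → - (k · 1#)) (ℕ-lemma m n) ⟨
    - ((suc m ℕ.+ suc n) · 1#)            ≈⟨ -‿cong (×-homo-+ 1# (suc m) (suc n)) ⟩
    - (suc m · 1# + suc n · 1#)           ≈⟨ ⁻¹-∙-comm _ _ ⟨
    - (suc m · 1#) + - (suc n · 1#)       ∎
    where
    open import Data.Nat.Properties using (+-suc)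
    ℕ-lemma : ∀ m n → suc m ℕ.+ suc n ≡ suc (suc (m ℕ.+ n))
    ℕ-lemma m n = ≡.cong suc (+-suc m n)

  ⟦⟧-homo-‿ : ∀ x → ⟦ ℤ.- x ⟧ℤ ≈ - ⟦ x ⟧ℤ
  ⟦⟧-homo-‿ (+ zero)   = sym -0#≈0#
  ⟦⟧-homo-‿ (+ suc n)  = refl
  ⟦⟧-homo-‿ -[1+ n ]   = sym (-‿involutive _)

  ⟦+⟧-homo-* : ∀ m y → ⟦ + m ℤ.* y ⟧ℤ ≈ m · 1# * ⟦ y ⟧ℤ
  ⟦+⟧-homo-* m (+ n) = begin
    ⟦ + m ℤ.* + n ⟧ℤ  ≡⟨ ≡.cong ⟦_⟧ℤ (ℤ.pos-* m n) ⟨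
    (m ℕ.* n) · 1#    ≈⟨ ×1-homo-* m n ⟩
    m · 1# * n · 1#   ∎
  ⟦+⟧-homo-* m -[1+ n ] = begin
    ⟦ + m ℤ.* -[1+ n ] ⟧ℤ       ≡⟨ ≡.cong ⟦_⟧ℤ (ℤ.neg-distribʳ-* (+ m) (+ suc n)) ⟨
    ⟦ ℤ.- (+ m ℤ.* + suc n) ⟧ℤ  ≈⟨ ⟦⟧-homo-‿ (+ m ℤ.* + suc n) ⟩
    - ⟦ + m ℤ.* + suc n ⟧ℤ      ≈⟨ -‿cong (⟦+⟧-homo-* m (+ suc n)) ⟩
    - (m · 1# * suc n · 1#)     ≈⟨ -‿distribʳ-* _ _ ⟩
    m · 1# * - (suc n · 1#)     ∎

  ⟦⟧-homo-* : ∀ x y → ⟦ x ℤ.* y ⟧ℤ ≈ ⟦ x ⟧ℤ * ⟦ y ⟧ℤ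
  ⟦⟧-homo-* (+ m)    y = ⟦+⟧-homo-* m y
  ⟦⟧-homo-* -[1+ m ] y = begin
    ⟦ -[1+ m ] ℤ.* y ⟧ℤ       ≡⟨ ≡.cong ⟦_⟧ℤ (ℤ.neg-distribˡ-* (+ suc m) y) ⟨
    ⟦ ℤ.- (+ suc m ℤ.* y) ⟧ℤ  ≈⟨ ⟦⟧-homo-‿ (+ suc m ℤ.* y) ⟩
    - ⟦ + suc m ℤ.* y ⟧ℤ      ≈⟨ -‿cong (⟦+⟧-homo-* (suc m) y) ⟩
    - (suc m · 1# * ⟦ y ⟧ℤ)   ≈⟨ -‿distribˡ-* _ _ ⟩
    - (suc m · 1#) * ⟦ y ⟧ℤ   ∎

  homomorphism : Homomorphism _ _ _ _
  homomorphism = record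
    { from           = coefficients
    ; to             = fromCommutativeRing R (λ _ → nothing)
    ; morphism       = record
        { ⟦_⟧    = ⟦_⟧ℤ
        ; +-homo = ⟦⟧-homo-+
        ; *-homo = ⟦⟧-homo-*
        ; -‿homo = ⟦⟧-homo-‿
        ; 0-homo = refl
        ; 1-homo = refl
        }
    ; Zero-C⟶Zero-R = λ { (+ 0) _ → refl }
    }

  open Eval rawRing ⟦_⟧ℤ public
  module Sem = Tactic.RingSolver.Core.Polynomial.Semantics homomorphism
  open Tactic.RingSolver.Core.Polynomial.Homomorphism homomorphism
  open import Algebra.Properties.Semiring.Exp.TCOptimised semiring using (^-congˡ)

  normal-correct : ∀ {n} (e : Expr ℤ n) ρ → Sem.⟦ normal e ⟧ ρ ≈ ⟦ e ⟧ ρ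
  normal-correct (Κ x)   ρ = κ-hom x ρ
  normal-correct (Ι x)   ρ = ι-hom x ρ
  normal-correct (x ⊕ y) ρ = trans (⊞-hom (normal x) (normal y) ρ) (+-cong (normal-correct x ρ) (normal-correct y ρ))
  normal-correct (x ⊗ y) ρ = trans (⊠-hom (normal x) (normal y) ρ) (*-cong (normal-correct x ρ) (normal-correct y ρ))
  normal-correct (⊝ x)   ρ = trans (⊟-hom (normal x) ρ) (-‿cong (normal-correct x ρ))
  normal-correct (x ⊛ i) ρ = trans (⊡-hom (normal x) i ρ) (^-congˡ i (normal-correct x ρ))

  Zero-correct : ∀ {n} (p : Poly.Poly n) ρ → Poly.Zero p → Sem.⟦ p ⟧ ρ ≈ 0#
  Zero-correct (Poly.Κ (+ 0) Poly.⊐ _) ρ _ = refl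


  prove : ∀ {n} (e₁ e₂ : Expr ℤ n) → Vanishes (e₁ ⊕ ⊝ e₂) → ∀ ρ → ⟦ e₁ ⟧ ρ ≈ ⟦ e₂ ⟧ ρ
  prove e₁ e₂ z ρ = x∙y⁻¹≈ε⇒x≈y _ _ (trans (sym (normal-correct (e₁ ⊕ ⊝ e₂) ρ)) (Zero-correct (normal (e₁ ⊕ ⊝ e₂)) ρ z))
  

  solve : ∀ n (f : N-ary n (Expr ℤ n) (Expr ℤ n × Expr ℤ n)) →
          (let e₁ , e₂ = f $ⁿ Vec.map Ι (Vec.allFin n)) {_ : Vanishes (e₁ ⊕ ⊝ e₂)} →
          ∀ⁿ n (curryⁿ λ ρ → ⟦ e₁ ⟧ ρ ≈ ⟦ e₂ ⟧ ρ)
  solve n f {z} = Equivalence.from (uncurry-∀ⁿ n) λ ρ →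
    ≡.subst id (≡.sym (left-inverse (λ ρ → ⟦ proj₁ e ⟧ ρ ≈ ⟦ proj₂ e ⟧ ρ) ρ))
      (prove (proj₁ e) (proj₂ e) z ρ)
    where
    e = f $ⁿ Vec.map Ι (Vec.allFin n)

  prove₆ : ∀ {n} (e₁ e₂ : Vector (Expr ℤ n) 6)
    {_ : Vanishes (e₁ 0F ⊕ ⊝ e₂ 0F)} {_ : Vanishes (e₁ 1F ⊕ ⊝ e₂ 1F)}
    {_ : Vanishes (e₁ 2F ⊕ ⊝ e₂ 2F)} {_ : Vanishes (e₁ 3F ⊕ ⊝ e₂ 3F)}
    {_ : Vanishes (e₁ 4F ⊕ ⊝ e₂ 4F)} {_ : Vanishes (e₁ 5F ⊕ ⊝ e₂ 5F)} →
    ∀ ρ → let E = λ i → ⟦ e₁ i ⟧ ρ ≈ ⟦ e₂ i ⟧ ρ in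
    E 0F × E 1F × E 2F × E 3F × E 4F × E 5F
  prove₆ e₁ e₂ {z₀} {z₁} {z₂} {z₃} {z₄} {z₅} ρ =
      prove (e₁ 0F) (e₂ 0F) z₀ ρ
    , prove (e₁ 1F) (e₂ 1F) z₁ ρ
    , prove (e₁ 2F) (e₂ 2F) z₂ ρ
    , prove (e₁ 3F) (e₂ 3F) z₃ ρ
    , prove (e₁ 4F) (e₂ 4F) z₄ ρ
    , prove (e₁ 5F) (e₂ 5F) z₅ ρ

-- Finite fields

double≡*2 : ∀ m → m ℕ.+ m ≡ m ℕ.* 2
double≡*2 m = ≡.trans (≡.cong (m ℕ.+_) (≡.sym (ℕ.+-identityʳ m))) (ℕ.*-comm 2 m)

module FieldProperties {q c ℓ} (F : FiniteField q c ℓ) where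
  open FiniteField F
  open Solver commutativeRing using (solve)
  open import Relation.Binary.Reasoning.Setoid setoid
  open import Algebra.Properties.AbelianGroup +-abelianGroup using () renaming (x∙y⁻¹≈ε⇒x≈y to x-y≈0⇒x≈y) public
  open import Algebra.Properties.Ring ring using (-0#≈0#) public

  infix 4 _≟_
  _≟_ : ∀ x y → Dec (x ≈ y)
  _≟_ = finite-≟ order

  divide : ∀ {a} → ¬ a ≈ 0# → ∀ b → ∃ λ x → b ≈ a * x
  divide {a} a≉0 b = let a⁻¹ , aa⁻¹≈1 = inverse a a≉0 in a⁻¹ * b , (begin
    b              ≈⟨ *-identityˡ b ⟨
    1# * b         ≈⟨ *-congʳ aa⁻¹≈1 ⟨
    a * a⁻¹ * b    ≈⟨ *-assoc a a⁻¹ b ⟩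
    a * (a⁻¹ * b)  ∎)

  *-cancel-0 : ∀ {a b} → ¬ a ≈ 0# → a * b ≈ 0# → b ≈ 0#
  *-cancel-0 {a} {b} a≉0 ab≈0 = let a⁻¹ , aa⁻¹≈1 = inverse a a≉0 in begin
    b              ≈⟨ *-identityˡ b ⟨
    1# * b         ≈⟨ *-congʳ aa⁻¹≈1 ⟨
    a * a⁻¹ * b    ≈⟨ solve 3 (λ a b c → a ⊗ c ⊗ b ⊜ c ⊗ (a ⊗ b)) a b a⁻¹ ⟩
    a⁻¹ * (a * b)  ≈⟨ *-congˡ ab≈0 ⟩
    a⁻¹ * 0#       ≈⟨ zeroʳ a⁻¹ ⟩
    0#             ∎

  *-cancelˡ : ∀ {a b c} → ¬ a ≈ 0# → a * b ≈ a * c → b ≈ c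
  *-cancelˡ {a} {b} {c} a≉0 ab≈ac = x-y≈0⇒x≈y b c (*-cancel-0 a≉0 (begin
    a * (b - c)      ≈⟨ solve 3 (λ a b c → a ⊗ (b ⊕ ⊝ c) ⊜ a ⊗ b ⊕ ⊝ (a ⊗ c)) a b c ⟩
    a * b - a * c    ≈⟨ +-congʳ ab≈ac ⟩
    a * c - a * c    ≈⟨ -‿inverseʳ (a * c) ⟩
    0#               ∎))

  *-zero : ∀ {a b} → a * b ≈ 0# → a ≈ 0# ⊎ b ≈ 0#
  *-zero {a} ab≈0 with a ≟ 0#
  ... | yes a≈0 = inj₁ a≈0
  ... | no  a≉0 = inj₂ (*-cancel-0 a≉0 ab≈0)

  *-nonzero : ∀ {a b} → ¬ a ≈ 0# → ¬ b ≈ 0# → ¬ a * b ≈ 0#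
  *-nonzero a≉0 b≉0 ab≈0 = b≉0 (*-cancel-0 a≉0 ab≈0)

  square-zero : ∀ {a} → a * a ≈ 0# → a ≈ 0#
  square-zero {a} aa≈0 with *-zero aa≈0
  ... | inj₁ a≈0 = a≈0
  ... | inj₂ a≈0 = a≈0

  +≈0⇒≈- : ∀ {x y} → x + y ≈ 0# → y ≈ - x
  +≈0⇒≈- {x} {y} x+y≈0 = begin
    y              ≈⟨ solve 2 (λ x y → y ⊜ (x ⊕ y) ⊕ ⊝ x) x y ⟩
    (x + y) - x    ≈⟨ +-congʳ x+y≈0 ⟩
    0# - x         ≈⟨ +-identityˡ _ ⟩
    - x            ∎

  -≈0⇒≈0 : ∀ {x} → - x ≈ 0# → x ≈ 0#
  -≈0⇒≈0 {x} -x≈0 = begin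
    x      ≈⟨ solve 1 (λ x → x ⊜ ⊝ (⊝ x)) x ⟩
    - - x  ≈⟨ -‿cong -x≈0 ⟩
    - 0#   ≈⟨ -0#≈0# ⟩
    0#     ∎

  roots : ∀ {x y z} → (x - y) * (x - z) ≈ 0# → x ≈ y ⊎ x ≈ z
  roots e with *-zero e
  ... | inj₁ x-y≈0 = inj₁ (x-y≈0⇒x≈y _ _ x-y≈0)
  ... | inj₂ x-z≈0 = inj₂ (x-y≈0⇒x≈y _ _ x-z≈0)

  -- Equal sum and product mean that both pairs are the roots of one quadratic polynomial, so x is a
  -- root of (X - y)(X - y′).
  sameFactors : ∀ {x x′ y y′} → x + x′ ≈ y + y′ → x * x′ ≈ y * y′ → (x ≈ y × x′ ≈ y′) ⊎ (x ≈ y′ × x′ ≈ y)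
  sameFactors {x} {x′} {y} {y′} s p with roots {x} {y} {y′} (begin
    (x - y) * (x - y′)                   ≈⟨ solve 3 (λ x y y′ → (x ⊕ ⊝ y) ⊗ (x ⊕ ⊝ y′)
        ⊜ x ⊗ x ⊕ ⊝ (x ⊗ (y ⊕ y′)) ⊕ y ⊗ y′) x y y′ ⟩
    x * x - x * (y + y′) + y * y′        ≈⟨ +-cong (+-congˡ (-‿cong (*-congˡ s))) p ⟨
    x * x - x * (x + x′) + x * x′
      ≈⟨ solve 2 (λ x x′ → x ⊗ x ⊕ ⊝ (x ⊗ (x ⊕ x′)) ⊕ x ⊗ x′ ⊜ Κ (+ 0)) x x′ ⟩
    0#                                   ∎)
  ... | inj₁ x≈y = inj₁ (x≈y , other x≈y s)
    where
    other : ∀ {x x′ y y′} → x ≈ y → x + x′ ≈ y + y′ → x′ ≈ y′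
    other {x} {x′} {y} {y′} x≈y s = begin
      x′            ≈⟨ solve 2 (λ x x′ → x′ ⊜ (x ⊕ x′) ⊕ ⊝ x) x x′ ⟩
      (x + x′) - x  ≈⟨ +-cong s (-‿cong x≈y) ⟩
      (y + y′) - y  ≈⟨ solve 2 (λ x x′ → (x ⊕ x′) ⊕ ⊝ x ⊜ x′) y y′ ⟩
      y′            ∎
  ... | inj₂ x≈y′ = inj₂ (x≈y′ , (begin
      x′             ≈⟨ solve 2 (λ x x′ → x′ ⊜ (x ⊕ x′) ⊕ ⊝ x) x x′ ⟩
      (x + x′) - x   ≈⟨ +-cong s (-‿cong x≈y′) ⟩
      (y + y′) - y′  ≈⟨ solve 2 (λ x x′ → (x ⊕ x′) ⊕ ⊝ x′ ⊜ x) y y′ ⟩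
      y              ∎))

  sameSquare : ∀ {x y} → x * x ≈ y * y → x ≈ y ⊎ x ≈ - y
  sameSquare {x} {y} e = roots (begin
    (x - y) * (x - - y)  ≈⟨ solve 2 (λ x y → (x ⊕ ⊝ y) ⊗ (x ⊕ ⊝ (⊝ y)) ⊜ x ⊗ x ⊕ ⊝ (y ⊗ y)) x y ⟩
    x * x - y * y        ≈⟨ +-congʳ e ⟩
    y * y - y * y        ≈⟨ -‿inverseʳ _ ⟩
    0#                   ∎)

  double : ∀ x → x + x ≈ (1# + 1#) * x
  double = solve 1 (λ x → x ⊕ x ⊜ (Κ (+ 1) ⊕ Κ (+ 1)) ⊗ x)

  1<q : 1 ℕ.< q
  1<q = lemma (λ { ≡.refl → 1≉0 (no-elements order) }) (λ { ≡.refl → 1≉0 (one-element order) })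
    where
    no-elements : HasSize setoid 0 → 1# ≈ 0#
    no-elements s with Inverse.to s 0#
    ... | ()
    one-element : HasSize setoid 1 → 1# ≈ 0#
    one-element s = to-injective s (unique _ _)
      where
      unique : ∀ (i j : Fin 1) → i ≡ j
      unique 0F 0F = ≡.refl
    lemma : ∀ {q} → ¬ q ≡ 0 → ¬ q ≡ 1 → 1 ℕ.< q
    lemma {0} q≢0 _ = contradiction ≡.refl q≢0
    lemma {1} _ q≢1 = contradiction ≡.refl q≢1
    lemma {ℕ.suc (ℕ.suc _)} _ _ = ℕ.s≤s (ℕ.s≤s ℕ.z≤n)

  -- If 1 + 1 = 0, then x ↦ x + 1 is an involution without fixed points, and q is even.
  odd⇒2≉0 : ¬ 2 ∣ q → ¬ 1# + 1# ≈ 0#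
  odd⇒2≉0 2∤q 2≈0 = let m , _ , m+m≡q = FreeInvolution.orbits-size translation order in
    2∤q (divides m (≡.trans (≡.sym m+m≡q) (double≡*2 m)))
    where
    translation : FreeInvolution setoid
    translation = record
      { τ            = _+ 1#
      ; τ-cong       = +-congʳ
      ; τ-involutive = λ x → begin
          x + 1# + 1#    ≈⟨ +-assoc x 1# 1# ⟩
          x + (1# + 1#)  ≈⟨ +-congˡ 2≈0 ⟩
          x + 0#         ≈⟨ +-identityʳ x ⟩
          x              ∎
      ; τ-free       = λ x x+1≈x → 1≉0 (begin
          1#              ≈⟨ solve 1 (λ x → Κ (+ 1) ⊜ (x ⊕ Κ (+ 1)) ⊕ ⊝ x) x ⟩
          (x + 1#) - x    ≈⟨ +-congʳ x+1≈x ⟩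
          x - x           ≈⟨ -‿inverseʳ x ⟩
          0#              ∎)
      }

  -- If 1 + 1 ≠ 0, negation has no fixed point among the q - 1 nonzero elements, and q - 1 is even.
  even⇒2≈0 : 2 ∣ q → 1# + 1# ≈ 0#
  even⇒2≈0 2∣q = decidable-stable (1# + 1# ≟ 0#) λ 2≉0 →
    let k , s , 1+k≡q = punctured-size order 0#
        m , _ , m+m≡k = FreeInvolution.orbits-size (negation 2≉0) s
        2∣m+m = divides m (double≡*2 m)
    in contradiction (∣1⇒≡1 (∣m+n∣m⇒∣n (≡.subst (2 ∣_) (≡.sym (≡.trans (ℕ.+-comm k 1) 1+k≡q)) 2∣q) (≡.subst (2 ∣_) m+m≡k 2∣m+m))) λ ()
    where
    negation : ¬ 1# + 1# ≈ 0# → FreeInvolution (setoid ∣ₛ λ x → ¬ x ≈ 0#)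
    negation 2≉0 = record
      { τ            = λ (x , x≉0) → - x , λ -x≈0 → x≉0 (-≈0⇒≈0 -x≈0)
      ; τ-cong       = -‿cong
      ; τ-involutive = λ (x , _) → solve 1 (λ x → ⊝ (⊝ x) ⊜ x) x
      ; τ-free       = λ (x , x≉0) -x≈x → x≉0 (*-cancel-0 2≉0 (begin
          (1# + 1#) * x  ≈⟨ double x ⟨
          x + x          ≈⟨ +-congʳ -x≈x ⟨
          - x + x        ≈⟨ -‿inverseˡ x ⟩
          0#             ∎))
      }

  module Characteristic2 (2≈0 : 1# + 1# ≈ 0#) where
    x+x≈0 : ∀ x → x + x ≈ 0#
    x+x≈0 x = trans (double x) (trans (*-congʳ 2≈0) (zeroˡ x))

    -x≈x : ∀ x → - x ≈ x
    -x≈x x = sym (+≈0⇒≈- (x+x≈0 x))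

    square-injective : ∀ {x y} → x * x ≈ y * y → x ≈ y
    square-injective e with sameSquare e
    ... | inj₁ x≈y  = x≈y
    ... | inj₂ x≈-y = trans x≈-y (-x≈x _)

    -- Squaring is an injective map of a finite set to itself.
    sqrt : ∀ x → ∃ λ y → y * y ≈ x
    sqrt = injective⇒surjective order order (λ y → y * y) (λ x≈y → *-cong x≈y x≈y) square-injective

-- Substitutions in quadratic forms

module QuadraticForms {c ℓ} (R : RawRing c ℓ) where
  open RawRing R
  open import Data.Vec.Functional using ([]; _∷_)

  Matrix : Set c
  Matrix = Fin 3 → Fin 3 → Carrier

  column : Matrix → Fin 3 → Vector Carrier 3
  column A j i = A i j

  -- The nesting and the final `0#` reproduce the unfolding of `sum`, so that the matrix products
  -- and incidences of the statement agree with these formulas definitionally. The same holds for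
  -- `pairing`.
  _·_ : Vector Carrier 3 → Vector Carrier 3 → Carrier
  u · v = u 0F * v 0F + (u 1F * v 1F + (u 2F * v 2F + 0#))

  _·ᴹ_ : Vector Carrier 3 → Matrix → Vector Carrier 3
  (u ·ᴹ A) j = u · column A j

  _∙ᴹ_ : Matrix → Matrix → Matrix
  (A ∙ᴹ B) i = A i ·ᴹ B

  transpose : Matrix → Matrix
  transpose A i j = A j i

  unit : Matrix
  unit 0F 0F = 1#
  unit 1F 1F = 1#
  unit 2F 2F = 1#
  unit _  _  = 0#

  linearProduct : Vector Carrier 3 → Vector Carrier 3 → Vector Carrier 6
  linearProduct u v =
      u 0F * v 0F
    ∷ u 0F * v 1F + u 1F * v 0F
    ∷ u 0F * v 2F + u 2F * v 0F
    ∷ u 1F * v 1F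
    ∷ u 1F * v 2F + u 2F * v 1F
    ∷ u 2F * v 2F
    ∷ []

  value : Vector Carrier 6 → Vector Carrier 3 → Carrier
  value f u = f 0F * (u 0F * u 0F) + f 1F * (u 0F * u 1F) + f 2F * (u 0F * u 2F)
    + f 3F * (u 1F * u 1F) + f 4F * (u 1F * u 2F) + f 5F * (u 2F * u 2F)

  -- This is f(u + v) - f(u) - f(v), the mixed coefficient in a substitution. Written without
  -- division by 2, it is valid in every characteristic.
  polar : Vector Carrier 6 → Vector Carrier 3 → Vector Carrier 3 → Carrier
  polar f u v =
      (f 0F + f 0F) * (u 0F * v 0F)
    + f 1F * (u 0F * v 1F + u 1F * v 0F)
    + f 2F * (u 0F * v 2F + u 2F * v 0F)
    + (f 3F + f 3F) * (u 1F * v 1F)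
    + f 4F * (u 1F * v 2F + u 2F * v 1F)
    + (f 5F + f 5F) * (u 2F * v 2F)

  -- The coefficients of f(AX).
  pull : Matrix → Vector Carrier 6 → Vector Carrier 6
  pull A f =
      value f (column A 0F)
    ∷ polar f (column A 0F) (column A 1F)
    ∷ polar f (column A 0F) (column A 2F)
    ∷ value f (column A 1F)
    ∷ polar f (column A 1F) (column A 2F)
    ∷ value f (column A 2F)
    ∷ []

  pairing : Vector Carrier 6 → Vector Carrier 6 → Carrier
  pairing f y = f 0F * y 0F + (f 1F * y 1F + (f 2F * y 2F
    + (f 3F * y 3F + (f 4F * y 4F + (f 5F * y 5F + 0#)))))

  congruence : Matrix → Vector Carrier 6 → Matrix
  congruence A m = (A ∙ᴹ (λ i j → m (index i j))) ∙ᴹ transpose A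

  upper : Matrix → Vector Carrier 6
  upper M = M 0F 0F ∷ M 0F 1F ∷ M 0F 2F ∷ M 1F 1F ∷ M 1F 2F ∷ M 2F 2F ∷ []

  -- The sum of copies of `t` is `multiple 4` unfolded, which makes this definitionally the
  -- expression in `ℋ₃`.
  discriminant : Vector Carrier 6 → Carrier
  discriminant f =
      (t + (t + (t + (t + 0#))))
    + f 1F * f 2F * f 4F
    + - (f 0F * (f 4F * f 4F))
    + - (f 3F * (f 2F * f 2F))
    + - (f 5F * (f 1F * f 1F))
    where t = f 0F * f 3F * f 5F

  determinant : Matrix → Carrier
  determinant A =
      A 0F 0F * (A 1F 1F * A 2F 2F + - (A 1F 2F * A 2F 1F))
    + - (A 0F 1F * (A 1F 0F * A 2F 2F + - (A 1F 2F * A 2F 0F)))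
    + A 0F 2F * (A 1F 0F * A 2F 1F + - (A 1F 1F * A 2F 0F))

private
  -- A block of k consecutive solver variables, with n variables before it and m after it.
  variables : ∀ {k} n m → Vector (Expr ℤ (n ℕ.+ (k ℕ.+ m))) k
  variables n m i = Ι (n ↑ʳ (i ↑ˡ m))

  matrixVariables : ∀ n m → Fin 3 → Vector (Expr ℤ (n ℕ.+ (9 ℕ.+ m))) 3
  matrixVariables n m i j = variables {9} n m (combine i j)

module FormIdentities {c ℓ} (R : CommutativeRing c ℓ) where
  open CommutativeRing R
  open import Data.Vec.Functional using ([]; _∷_)
  open Solver R
  open QuadraticForms rawRing

  private
    entries : (Fin 3 → Fin 3 → Carrier) → Vec Carrier 9
    entries A = Vec.concat (Vec.tabulate (Vec.tabulate ∘ A))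

    coefficients₆ : Vector Carrier 6 → Vec Carrier 6
    coefficients₆ = Vec.tabulate

    infixr 5 _++_
    _++_ : ∀ {m n} → Vec Carrier m → Vec Carrier n → Vec Carrier (m ℕ.+ n)
    _++_ = Vec._++_

  -- A polynomial identity over ℤ, hence valid in characteristic 2 too, where the discriminant is no
  -- longer derived from the determinant of a symmetric matrix.
  discriminant-pull : ∀ A f → discriminant (pull A f) ≈ determinant A * determinant A * discriminant f
  discriminant-pull A f = prove (E.discriminant (E.pull A′ f′)) (E.determinant A′ ⊗ E.determinant A′ ⊗ E.discriminant f′) _
    (entries A ++ coefficients₆ f)
    where
    module E = QuadraticForms (exprs 15)
    A′ = matrixVariables 0 6
    f′ = variables {6} 9 0

  pull-∙ : ∀ A B f i → pull B (pull A f) i ≈ pull (A ∙ᴹ B) f i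
  pull-∙ A B f = ∀₆ (prove₆ (E.pull B′ (E.pull A′ f′)) (E.pull (A′ E.∙ᴹ B′) f′) (entries A ++ entries B ++ coefficients₆ f))
    where
    module E = QuadraticForms (exprs 24)
    A′ = matrixVariables 0 15
    B′ = matrixVariables 9 6
    f′ = variables {6} 18 0

  pull-unit : ∀ f i → pull unit f i ≈ f i
  pull-unit f = ∀₆ (prove₆ (E.pull E.unit f′) f′ (coefficients₆ f))
    where
    module E = QuadraticForms (exprs 6)
    f′ = variables {6} 0 0

  pull-product : ∀ A u v i → pull A (linearProduct u v) i ≈ linearProduct (u ·ᴹ A) (v ·ᴹ A) i
  pull-product A u v = ∀₆ (prove₆ (E.pull A′ (E.linearProduct u′ v′)) (E.linearProduct (u′ E.·ᴹ A′) (v′ E.·ᴹ A′))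
    (entries A ++ Vec.tabulate u ++ Vec.tabulate v))
    where
    module E = QuadraticForms (exprs 15)
    A′ = matrixVariables 0 6
    u′ = variables {3} 9 3
    v′ = variables {3} 12 0

  pull-scale : ∀ A a f i → pull A (λ j → a * f j) i ≈ a * pull A f i
  pull-scale A a f = ∀₆ (prove₆ (E.pull A′ (λ j → Ι 0F ⊗ f′ j)) (λ j → Ι 0F ⊗ E.pull A′ f′ j)
    (a Vec.∷ entries A ++ coefficients₆ f))
    where
    module E = QuadraticForms (exprs 16)
    A′ = matrixVariables 1 6
    f′ = variables {6} 10 0

  -- The duality between the two actions. For a matrix m = xxᵀ of rank one, both sides are the value
  -- f(Ax), and both sides are linear in m.
  pairing-congruence : ∀ A f m → pairing f (upper (congruence A m)) ≈ pairing (pull A f) m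
  pairing-congruence A f m = prove (E.pairing f′ (E.upper (E.congruence A′ m′))) (E.pairing (E.pull A′ f′) m′) _
    (entries A ++ coefficients₆ f ++ coefficients₆ m)
    where
    module E = QuadraticForms (exprs 21)
    A′ = matrixVariables 0 12
    f′ = variables {6} 9 6
    m′ = variables {6} 15 0

  congruence-symmetric : ∀ A m i j → congruence A m i j ≈ congruence A m j i
  congruence-symmetric A m i j = step i j
    where
    module E = QuadraticForms (exprs 15)
    A′ = matrixVariables 0 6
    m′ = variables {6} 9 0
    e = E.congruence A′ m′
    ρ = entries A ++ coefficients₆ m
    step : ∀ i j → congruence A m i j ≈ congruence A m j i
    step 0F 0F = refl
    step 1F 1F = refl
    step 2F 2F = refl
    step 0F 1F = prove (e 0F 1F) (e 1F 0F) _ ρ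
    step 0F 2F = prove (e 0F 2F) (e 2F 0F) _ ρ
    step 1F 2F = prove (e 1F 2F) (e 2F 1F) _ ρ
    step 1F 0F = prove (e 1F 0F) (e 0F 1F) _ ρ
    step 2F 0F = prove (e 2F 0F) (e 0F 2F) _ ρ
    step 2F 1F = prove (e 2F 1F) (e 1F 2F) _ ρ

  ·ᴹ-∙ : ∀ u A B j → ((u ·ᴹ A) ·ᴹ B) j ≈ (u ·ᴹ (A ∙ᴹ B)) j
  ·ᴹ-∙ u A B j = solve 15 (λ u₀ u₁ u₂ a b c d e f g h i x y z →
    let A = (a ∷ b ∷ c ∷ []) ∷ (d ∷ e ∷ f ∷ []) ∷ (g ∷ h ∷ i ∷ []) ∷ []
        open QuadraticForms (exprs 15) renaming (_·_ to _·′_; _·ᴹ_ to _·ᴹ′_)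
        u = u₀ ∷ u₁ ∷ u₂ ∷ [] ; v = x ∷ y ∷ z ∷ []
    in (u ·ᴹ′ A) ·′ v ⊜ u ·′ (λ i → A i ·′ v))
    (u 0F) (u 1F) (u 2F) (A 0F 0F) (A 0F 1F) (A 0F 2F) (A 1F 0F) (A 1F 1F) (A 1F 2F) (A 2F 0F) (A 2F 1F) (A 2F 2F)
    (B 0F j) (B 1F j) (B 2F j)

  ·-cong : ∀ {u u′ v v′} → (∀ i → u i ≈ u′ i) → (∀ i → v i ≈ v′ i) → u · v ≈ u′ · v′
  ·-cong p r = +-cong (*-cong (p 0F) (r 0F)) (+-cong (*-cong (p 1F) (r 1F)) (+-congʳ (*-cong (p 2F) (r 2F))))

  ·ᴹ-unit : ∀ u j → (u ·ᴹ unit) j ≈ u j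
  ·ᴹ-unit u 0F = solve 3 (λ a b c → a ⊗ Κ (+ 1) ⊕ (b ⊗ Κ (+ 0) ⊕ (c ⊗ Κ (+ 0) ⊕ Κ (+ 0)))
      ⊜ a) (u 0F) (u 1F) (u 2F)
  ·ᴹ-unit u 1F = solve 3 (λ a b c → a ⊗ Κ (+ 0) ⊕ (b ⊗ Κ (+ 1) ⊕ (c ⊗ Κ (+ 0) ⊕ Κ (+ 0)))
      ⊜ b) (u 0F) (u 1F) (u 2F)
  ·ᴹ-unit u 2F = solve 3 (λ a b c → a ⊗ Κ (+ 0) ⊕ (b ⊗ Κ (+ 0) ⊕ (c ⊗ Κ (+ 1) ⊕ Κ (+ 0)))
      ⊜ c) (u 0F) (u 1F) (u 2F)

  ·ᴹ-scale : ∀ a u A j → ((λ i → a * u i) ·ᴹ A) j ≈ a * (u ·ᴹ A) j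
  ·ᴹ-scale a u A j = solve 7 (λ a b c d x y z →
    (a ⊗ b) ⊗ x ⊕ ((a ⊗ c) ⊗ y ⊕ ((a ⊗ d) ⊗ z ⊕ Κ (+ 0))) ⊜ a ⊗ (b ⊗ x ⊕ (c ⊗ y ⊕ (d ⊗ z ⊕ Κ (+ 0)))))
    a (u 0F) (u 1F) (u 2F) (A 0F j) (A 1F j) (A 2F j)

  value-cong : ∀ {f f′ u u′} → (∀ i → f i ≈ f′ i) → (∀ i → u i ≈ u′ i) → value f u ≈ value f′ u′
  value-cong {f} {f′} {u} {u′} f≈f′ u≈u′ =
    +-cong (+-cong (+-cong (+-cong (+-cong
      (t 0F 0F 0F) (t 1F 0F 1F)) (t 2F 0F 2F)) (t 3F 1F 1F)) (t 4F 1F 2F)) (t 5F 2F 2F)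
    where
    t : ∀ i j k → f i * (u j * u k) ≈ f′ i * (u′ j * u′ k)
    t i j k = *-cong (f≈f′ i) (*-cong (u≈u′ j) (u≈u′ k))

  polar-cong : ∀ {f f′ u u′ v v′} → (∀ i → f i ≈ f′ i) → (∀ i → u i ≈ u′ i) → (∀ i → v i ≈ v′ i) →
    polar f u v ≈ polar f′ u′ v′
  polar-cong {f} {f′} {u} {u′} {v} {v′} f≈f′ u≈u′ v≈v′ =
    +-cong (+-cong (+-cong (+-cong (+-cong
      (s 0F 0F) (t 1F 0F 1F)) (t 2F 0F 2F)) (s 3F 1F)) (t 4F 1F 2F)) (s 5F 2F)
    where
    uv : ∀ j k → u j * v k ≈ u′ j * v′ k
    uv j k = *-cong (u≈u′ j) (v≈v′ k)
    s : ∀ i j → (f i + f i) * (u j * v j) ≈ (f′ i + f′ i) * (u′ j * v′ j)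
    s i j = *-cong (+-cong (f≈f′ i) (f≈f′ i)) (uv j j)
    t : ∀ i j k → f i * (u j * v k + u k * v j) ≈ f′ i * (u′ j * v′ k + u′ k * v′ j)
    t i j k = *-cong (f≈f′ i) (+-cong (uv j k) (uv k j))

  pull-cong : ∀ {A B f g} → (∀ i j → A i j ≈ B i j) → (∀ i → f i ≈ g i) → ∀ i → pull A f i ≈ pull B g i
  pull-cong A≈B f≈g = ∀₆
    ( value-cong f≈g (λ i → A≈B i 0F)
    , polar-cong f≈g (λ i → A≈B i 0F) (λ i → A≈B i 1F)
    , polar-cong f≈g (λ i → A≈B i 0F) (λ i → A≈B i 2F)
    , value-cong f≈g (λ i → A≈B i 1F)
    , polar-cong f≈g (λ i → A≈B i 1F) (λ i → A≈B i 2F)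
    , value-cong f≈g (λ i → A≈B i 2F)
    )

  product-cong : ∀ {u u′ v v′} → (∀ i → u i ≈ u′ i) → (∀ i → v i ≈ v′ i) → ∀ i → linearProduct u v i ≈ linearProduct u′ v′ i
  product-cong {u} {u′} {v} {v′} u≈u′ v≈v′ = ∀₆
    (uv 0F 0F , +-cong (uv 0F 1F) (uv 1F 0F) , +-cong (uv 0F 2F) (uv 2F 0F)
    , uv 1F 1F , +-cong (uv 1F 2F) (uv 2F 1F) , uv 2F 2F)
    where
    uv : ∀ j k → u j * v k ≈ u′ j * v′ k
    uv j k = *-cong (u≈u′ j) (v≈v′ k)

  pairing-cong : ∀ {f f′ y y′} → (∀ i → f i ≈ f′ i) → (∀ i → y i ≈ y′ i) → pairing f y ≈ pairing f′ y′
  pairing-cong f≈f′ y≈y′ = +-cong (t 0F) (+-cong (t 1F) (+-cong (t 2F) (+-cong (t 3F) (+-cong (t 4F) (+-congʳ (t 5F))))))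
    where
    t = λ i → *-cong (f≈f′ i) (y≈y′ i)

  discriminant-cong : ∀ {f g} → (∀ i → f i ≈ g i) → discriminant f ≈ discriminant g
  discriminant-cong {f} {g} f≈g = +-cong (+-cong (+-cong (+-cong
    (+-cong (t 0F 3F 5F) (+-cong (t 0F 3F 5F) (+-cong (t 0F 3F 5F) (+-congʳ (t 0F 3F 5F)))))
    (t 1F 2F 4F)) (-‿cong (s 0F 4F))) (-‿cong (s 3F 2F))) (-‿cong (s 5F 1F))
    where
    t : ∀ i j k → f i * f j * f k ≈ g i * g j * g k
    t i j k = *-cong (*-cong (f≈g i) (f≈g j)) (f≈g k)
    s : ∀ i j → f i * (f j * f j) ≈ g i * (g j * g j)
    s i j = *-cong (f≈g i) (*-cong (f≈g j) (f≈g j))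

  pull-inverse : ∀ {A B} → (∀ i j → (A ∙ᴹ B) i j ≈ unit i j) → ∀ f i → pull B (pull A f) i ≈ f i
  pull-inverse {A} {B} AB≈1 f i = trans (pull-∙ A B f i) (trans (pull-cong {f = f} AB≈1 (λ _ → refl) i) (pull-unit f i))

  ·ᴹ-inverse : ∀ {A B} → (∀ i j → (A ∙ᴹ B) i j ≈ unit i j) → ∀ u i → ((u ·ᴹ A) ·ᴹ B) i ≈ u i
  ·ᴹ-inverse {A} {B} AB≈1 u j = trans (·ᴹ-∙ u A B j) (trans (·-cong {u} (λ _ → refl) (λ i → AB≈1 i j)) (·ᴹ-unit u j))

-- Quadratic forms under ring homomorphisms

module _ {a b ℓ₁ ℓ₂} (R : CommutativeRing a ℓ₁) (S : CommutativeRing b ℓ₂) where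
  private
    module R = CommutativeRing R
    module S = CommutativeRing S
    module P = QuadraticForms R.rawRing
    module Q = QuadraticForms S.rawRing
  open RingMorphisms R.rawRing S.rawRing using (IsRingHomomorphism)

  module _ {h : R.Carrier → S.Carrier} (isHom : IsRingHomomorphism h) where
    open IsRingHomomorphism isHom

    private
      infixl 6 _⟨+⟩_
      _⟨+⟩_ : ∀ {x y x′ y′} → h x S.≈ x′ → h y S.≈ y′ → h (x R.+ y) S.≈ x′ S.+ y′
      p ⟨+⟩ q = S.trans (+-homo _ _) (S.+-cong p q)
      infixl 7 _⟨*⟩_
      _⟨*⟩_ : ∀ {x y x′ y′} → h x S.≈ x′ → h y S.≈ y′ → h (x R.* y) S.≈ x′ S.* y′
      p ⟨*⟩ q = S.trans (*-homo _ _) (S.*-cong p q)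
      $ : ∀ {x} → h x S.≈ h x
      $ = S.refl

    value-homo : ∀ f u → h (P.value f u) S.≈ Q.value (λ i → h (f i)) (λ i → h (u i))
    value-homo f u = t ⟨+⟩ t ⟨+⟩ t ⟨+⟩ t ⟨+⟩ t ⟨+⟩ t
      where
      t : ∀ {x y z} → h (x R.* (y R.* z)) S.≈ h x S.* (h y S.* h z)
      t = $ ⟨*⟩ ($ ⟨*⟩ $)

    polar-homo : ∀ f u v → h (P.polar f u v) S.≈ Q.polar (λ i → h (f i)) (λ i → h (u i)) (λ i → h (v i))
    polar-homo f u v = s ⟨+⟩ t ⟨+⟩ t ⟨+⟩ s ⟨+⟩ t ⟨+⟩ s
      where
      s : ∀ {x y z} → h ((x R.+ x) R.* (y R.* z)) S.≈ (h x S.+ h x) S.* (h y S.* h z)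
      s = ($ ⟨+⟩ $) ⟨*⟩ ($ ⟨*⟩ $)
      t : ∀ {x y z y′ z′} → h (x R.* (y R.* z R.+ y′ R.* z′)) S.≈ h x S.* (h y S.* h z S.+ h y′ S.* h z′)
      t = $ ⟨*⟩ ($ ⟨*⟩ $ ⟨+⟩ $ ⟨*⟩ $)

    pull-homo : ∀ A f i → h (P.pull A f i) S.≈ Q.pull (λ j k → h (A j k)) (λ j → h (f j)) i
    pull-homo A f = ∀₆
      ( value-homo f (p 0F) , polar-homo f (p 0F) (p 1F) , polar-homo f (p 0F) (p 2F)
      , value-homo f (p 1F) , polar-homo f (p 1F) (p 2F) , value-homo f (p 2F) )
      where
      p = P.column A

    ·-homo : ∀ u v → h (u P.· v) S.≈ (λ i → h (u i)) Q.· (λ i → h (v i))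
    ·-homo u v = $ ⟨*⟩ $ ⟨+⟩ ($ ⟨*⟩ $ ⟨+⟩ ($ ⟨*⟩ $ ⟨+⟩ 0#-homo))

    unit-homo : ∀ i j → h (P.unit i j) S.≈ Q.unit i j
    unit-homo 0F 0F = 1#-homo
    unit-homo 0F 1F = 0#-homo
    unit-homo 0F 2F = 0#-homo
    unit-homo 1F 0F = 0#-homo
    unit-homo 1F 1F = 1#-homo
    unit-homo 1F 2F = 0#-homo
    unit-homo 2F 0F = 0#-homo
    unit-homo 2F 1F = 0#-homo
    unit-homo 2F 2F = 1#-homo

-- The action on hyperplanes and the reduction to the representative line

module _ {q c ℓ} (F : FiniteField q c ℓ) where
  open FiniteField F
  open QuadraticForms rawRing

  identity≈unit : ∀ i j → identity F i j ≈ unit i j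
  identity≈unit 0F 0F = refl
  identity≈unit 0F 1F = refl
  identity≈unit 0F 2F = refl
  identity≈unit 1F 0F = refl
  identity≈unit 1F 1F = refl
  identity≈unit 1F 2F = refl
  identity≈unit 2F 0F = refl
  identity≈unit 2F 1F = refl
  identity≈unit 2F 2F = refl

module GL₃Action {q c ℓ} (F : FiniteField q c ℓ) where
  open FiniteField F
  open QuadraticForms rawRing
  open FormIdentities commutativeRing

  GL₃-inverse : GL₃ F → GL₃ F
  GL₃-inverse g = record { A = A⁻¹ ; A⁻¹ = A ; inverseˡ = inverseʳ ; inverseʳ = inverseˡ }
    where open GL₃ g

  module _ (g : GL₃ F) where
    open GL₃ g

    A∙A⁻¹≈unit : ∀ i j → (A ∙ᴹ A⁻¹) i j ≈ unit i j
    A∙A⁻¹≈unit i j = trans (inverseʳ i j) (identity≈unit F i j)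

    pull-pull⁻¹ : ∀ f i → pull A⁻¹ (pull A f) i ≈ f i
    pull-pull⁻¹ = pull-inverse {A = A} {B = A⁻¹} A∙A⁻¹≈unit

    transform : Hyperplane F → Hyperplane F
    transform (f , f≉0) = pull A f , λ pf≈0 → f≉0 λ i →
      trans (sym (pull-pull⁻¹ f i)) (trans (pull-cong {A = A⁻¹} (λ _ _ → refl) pf≈0 i)
        (trans (sym (pull-cong {A = A⁻¹} (λ _ _ → refl) (λ _ → zeroˡ 0#) i))
        (trans (pull-scale A⁻¹ 0# (λ _ → 0#) i) (zeroˡ _))))

    transform-cong : ∀ {H H′} → Setoid._≈_ (hyperplanes F) H H′ →
                     Setoid._≈_ (hyperplanes F) (transform H) (transform H′)
    transform-cong {f , _} {f′ , _} (a , a≉0 , f≈af′) = a , a≉0 , λ i →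
      trans (pull-cong {A = A} (λ _ _ → refl) f≈af′ i) (pull-scale A a f′ i)

    proportional-·ᴹ : ∀ {u v} → Proportional F (u ·ᴹ A) (v ·ᴹ A) → Proportional F u v
    proportional-·ᴹ {u} {v} (a , a≉0 , uA≈avA) = a , a≉0 , λ i →
      trans (sym (·ᴹ-inverse {A = A} {B = A⁻¹} A∙A⁻¹≈unit u i))
      (trans (·-cong {u = u ·ᴹ A} {v = column A⁻¹ i} uA≈avA (λ _ → refl))
      (trans (·ᴹ-scale a (v ·ᴹ A) A⁻¹ i)
      (*-congˡ (·ᴹ-inverse {A = A} {B = A⁻¹} A∙A⁻¹≈unit v i))))

  ∼-of-≈ : ∀ {n} {f g : Vector Carrier n} → (∀ i → f i ≈ g i) → Proportional F f g
  ∼-of-≈ f≈g = 1# , 1≉0 , λ i → trans (f≈g i) (sym (*-identityˡ _))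

module _ {q c ℓ} (F : FiniteField q c ℓ) where
  open FiniteField F
  open QuadraticForms rawRing
  open FormIdentities commutativeRing
  open GL₃Action F
  open import Data.Vec.Functional using ([]; _∷_)

  -- The quadratic forms a₀₀X₀² + a₀₂X₀X₂ + a₁₁X₁² + a₂₂X₂²: the hyperplanes
  -- through the representative of the orbit.
  ContainsRepresentative : Pred (Hyperplane F) ℓ
  ContainsRepresentative (f , _) = f 1F ≈ 0# × f 4F ≈ 0#

  Normal : ∀ {r} → Pred (Hyperplane F) r → Setoid _ _
  Normal 𝒮 = hyperplanes F ∣ₛ λ H → H ∈ 𝒮 × H ∈ ContainsRepresentative

  Invariant : ∀ {r} → Pred (Hyperplane F) r → Set _
  Invariant 𝒮 = ∀ g {H} → H ∈ 𝒮 → transform g H ∈ 𝒮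

  module _ (L : Line F) (g : GL₃ F) (L≐image : Line.points L ≐ image F g (representative₁₂,₁ F)) where
    open GL₃ g
    open import Relation.Binary.Reasoning.Setoid setoid

    private
      e₁ e₄ : Vector Carrier 6
      e₁ = 0# ∷ 1# ∷ 0# ∷ 0# ∷ 0# ∷ 0# ∷ []
      e₄ = 0# ∷ 0# ∷ 0# ∷ 0# ∷ 1# ∷ 0# ∷ []

      pairing-e₁ : ∀ f → pairing f e₁ ≈ f 1F
      pairing-e₁ f = Solver.solve commutativeRing 6 (λ a b c d e f →
        a ⊗ Κ (+ 0) ⊕ (b ⊗ Κ (+ 1) ⊕ (c ⊗ Κ (+ 0) ⊕ (d ⊗ Κ (+ 0) ⊕ (e ⊗ Κ (+ 0) ⊕ (f ⊗ Κ (+ 0) ⊕ Κ (+ 0)))))) ⊜ b)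
        (f 0F) (f 1F) (f 2F) (f 3F) (f 4F) (f 5F)

      pairing-e₄ : ∀ f → pairing f e₄ ≈ f 4F
      pairing-e₄ f = Solver.solve commutativeRing 6 (λ a b c d e f →
        a ⊗ Κ (+ 0) ⊕ (b ⊗ Κ (+ 0) ⊕ (c ⊗ Κ (+ 0) ⊕ (d ⊗ Κ (+ 0) ⊕ (e ⊗ Κ (+ 1) ⊕ (f ⊗ Κ (+ 0) ⊕ Κ (+ 0)))))) ⊜ e)
        (f 0F) (f 1F) (f 2F) (f 3F) (f 4F) (f 5F)

      pairing-0 : ∀ f {y} → (∀ i → y i ≈ 0#) → pairing f y ≈ 0#
      pairing-0 f y≈0 = trans (pairing-cong {f = f} (λ _ → refl) y≈0) (Solver.solve commutativeRing 6 (λ a b c d e f →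
        a ⊗ Κ (+ 0) ⊕ (b ⊗ Κ (+ 0) ⊕ (c ⊗ Κ (+ 0) ⊕ (d ⊗ Κ (+ 0) ⊕ (e ⊗ Κ (+ 0) ⊕ (f ⊗ Κ (+ 0) ⊕ Κ (+ 0)))))) ⊜ Κ (+ 0))
        (f 0F) (f 1F) (f 2F) (f 3F) (f 4F) (f 5F))

      congruence-upper : ∀ M → (∀ i j → M i j ≈ M j i) → ∀ i j → upper M (index i j) ≈ M i j
      congruence-upper M M-sym 0F 0F = refl
      congruence-upper M M-sym 0F 1F = refl
      congruence-upper M M-sym 0F 2F = refl
      congruence-upper M M-sym 1F 0F = M-sym 0F 1F
      congruence-upper M M-sym 1F 1F = refl
      congruence-upper M M-sym 1F 2F = refl
      congruence-upper M M-sym 2F 0F = M-sym 0F 2F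
      congruence-upper M M-sym 2F 1F = M-sym 1F 2F
      congruence-upper M M-sym 2F 2F = refl

      vanishes : ∀ H → Line.points L ⊆ pointsOn F H →
                 (N : Point F) → N ∈ representative₁₂,₁ F → pairing (pull A (proj₁ H)) (proj₁ N) ≈ 0#
      vanishes (f , f≉0) L⊆H N N∈ = trans (sym (pairing-congruence A f (proj₁ N))) on
        where
        y = upper (congruence A (proj₁ N))
        on : pairing f y ≈ 0#
        -- This case does not occur, but it is easier to settle than to exclude.
        on with Fin.all? (λ i → finite-≟ order (y i) 0#)
        ... | yes y≈0 = pairing-0 f y≈0
        ... | no  y≉0 = L⊆H {y , y≉0} (proj₂ L≐image {y , y≉0} (N , N∈ , 1# , 1≉0 , λ i j →
          trans (congruence-upper (congruence A (proj₁ N)) (congruence-symmetric A (proj₁ N)) i j) (sym (*-identityˡ _))))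

      -- The representative line is spanned by `e₁` and `e₄`, and pairing a form with them reads off
      -- its coefficients at X₀X₁ and X₁X₂.
      contains⇒ : ∀ H → Line.points L ⊆ pointsOn F H → transform g H ∈ ContainsRepresentative
      contains⇒ H@(f , f≉0) L⊆H =
          trans (sym (pairing-e₁ (pull A f))) (vanishes H (λ {x} → L⊆H {x}) (e₁ , λ e≈0 → 1≉0 (e≈0 1F))
            (1# , 0# , (λ (1≈0 , _) → 1≉0 1≈0) , ∼-of-≈ {f = e₁} (∀₆ (refl , refl , refl , refl , refl , refl))))
        , trans (sym (pairing-e₄ (pull A f))) (vanishes H (λ {x} → L⊆H {x}) (e₄ , λ e≈0 → 1≉0 (e≈0 4F))
            (0# , 1# , (λ (_ , 1≈0) → 1≉0 1≈0) , ∼-of-≈ {f = e₄} (∀₆ (refl , refl , refl , refl , refl , refl))))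

      contains⇐ : ∀ H → transform g H ∈ ContainsRepresentative → Line.points L ⊆ pointsOn F H
      contains⇐ (f , f≉0) (f₁≈0 , f₄≈0) {P@(y , _)} y∈L with proj₁ L≐image {P} y∈L
      ... | (N , N≉0) , (s , t , _ , b , _ , N≈bst) , a , _ , y≈ = begin
        pairing f y
          ≈⟨ pairing-cong {f = f} {y = y} {y′ = λ i → a * upper (congruence A N) i} (λ _ → refl) (∀₆ (y≈ 0F 0F , y≈ 0F 1F , y≈ 0F 2F , y≈ 1F 1F , y≈ 1F 2F , y≈ 2F 2F)) ⟩
        pairing f (λ i → a * upper (congruence A N) i)
          ≈⟨ Solver.solve commutativeRing 13 (λ a f₀ f₁ f₂ f₃ f₄ f₅ y₀ y₁ y₂ y₃ y₄ y₅ →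
            f₀ ⊗ (a ⊗ y₀) ⊕ (f₁ ⊗ (a ⊗ y₁) ⊕ (f₂ ⊗ (a ⊗ y₂) ⊕ (f₃ ⊗ (a ⊗ y₃) ⊕ (f₄ ⊗ (a ⊗ y₄) ⊕ (f₅ ⊗ (a ⊗ y₅) ⊕ Κ (+ 0))))))
            ⊜ a ⊗ (f₀ ⊗ y₀ ⊕ (f₁ ⊗ y₁ ⊕ (f₂ ⊗ y₂ ⊕ (f₃ ⊗ y₃ ⊕ (f₄ ⊗ y₄ ⊕ (f₅ ⊗ y₅ ⊕ Κ (+ 0))))))))
            a (f 0F) (f 1F) (f 2F) (f 3F) (f 4F) (f 5F) (C 0F 0F) (C 0F 1F) (C 0F 2F) (C 1F 1F) (C 1F 2F) (C 2F 2F) ⟩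
        a * pairing f (upper (congruence A N))           ≈⟨ *-congˡ (pairing-congruence A f N) ⟩
        a * pairing (pull A f) N
          ≈⟨ *-congˡ (pairing-cong {f = pull A f} {h 0F ∷ 0# ∷ h 2F ∷ h 3F ∷ 0# ∷ h 5F ∷ []} (∀₆ (refl , f₁≈0 , refl , refl , f₄≈0 , refl)) N≈bst) ⟩
        a * pairing (h 0F ∷ 0# ∷ h 2F ∷ h 3F ∷ 0# ∷ h 5F ∷ []) (λ i → b * (0# ∷ s ∷ 0# ∷ 0# ∷ t ∷ 0# ∷ []) i)
          ≈⟨ Solver.solve commutativeRing 8 (λ a b s t h₀ h₂ h₃ h₅ → let z = Κ (+ 0) in
            a ⊗ (h₀ ⊗ (b ⊗ z) ⊕ (z ⊗ (b ⊗ s) ⊕ (h₂ ⊗ (b ⊗ z) ⊕ (h₃ ⊗ (b ⊗ z) ⊕ (z ⊗ (b ⊗ t) ⊕ (h₅ ⊗ (b ⊗ z) ⊕ z)))))) ⊜ z)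
            a b s t (h 0F) (h 2F) (h 3F) (h 5F) ⟩
        0#                                               ∎
        where
        C = congruence A N
        h = pull A f

    -- Substituting A and A⁻¹ gives mutually inverse maps between the hyperplanes through L and
    -- those through the representative. Invariance is used for g and for its inverse, so that
    -- neither map leaves the class.
    transport : ∀ {r n} {𝒮 : Pred (Hyperplane F) r} → Invariant 𝒮 →
                HasSize (Normal 𝒮) n → CountContaining F L 𝒮 n
    transport {𝒮 = 𝒮} invariant size = sizeByBijection {A = Normal 𝒮} size
      (λ (H , H∈𝒮 , H∈N) → transform g⁻¹ H , invariant g⁻¹ H∈𝒮
        , λ {y} y∈L → contains⇐ (transform g⁻¹ H) (trans (back H 1F) (proj₁ H∈N) , trans (back H 4F) (proj₂ H∈N)) {y} y∈L)
      (λ {x} {y} → transform-cong g⁻¹ {proj₁ x} {proj₁ y})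
      (λ {x} {y} eq → Setoid.trans (hyperplanes F) {proj₁ x} {transform g (transform g⁻¹ (proj₁ x))} {proj₁ y}
        (∼-of-≈ (λ i → sym (back (proj₁ x) i)))
        (Setoid.trans (hyperplanes F) {transform g (transform g⁻¹ (proj₁ x))} {transform g (transform g⁻¹ (proj₁ y))} {proj₁ y}
          (transform-cong g {transform g⁻¹ (proj₁ x)} {transform g⁻¹ (proj₁ y)} eq) (∼-of-≈ (back (proj₁ y)))))
      (λ (H , H∈𝒮 , L⊆H) → (transform g H , invariant g H∈𝒮 , contains⇒ H (λ {x} → L⊆H {x}))
        , ∼-of-≈ (pull-pull⁻¹ g (proj₁ H)))
      where
      g⁻¹ = GL₃-inverse g
      back : ∀ H i → proj₁ (transform g (transform g⁻¹ H)) i ≈ proj₁ H i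
      back H = pull-pull⁻¹ g⁻¹ (proj₁ H)

  ℋ₁-invariant : Invariant (ℋ₁ F)
  ℋ₁-invariant g {f , _} (a , u , a≉0 , f≈auu) = a , u ·ᴹ A , a≉0 , λ i →
    trans (pull-cong {A = A} (λ _ _ → refl) f≈auu i)
    (trans (pull-scale A a (linearProduct u u) i) (*-congˡ (pull-product A u u i)))
    where open GL₃ g

  ℋ₂ᵣ-invariant : Invariant (ℋ₂ᵣ F)
  ℋ₂ᵣ-invariant g {f , _} (u , v , u≁v , f≈uv) = u ·ᴹ A , v ·ᴹ A , (λ uA∼vA → u≁v (proportional-·ᴹ g uA∼vA)) , λ i →
    trans (pull-cong {A = A} (λ _ _ → refl) f≈uv i) (pull-product A u v i)
    where open GL₃ g

  -- The transformation law is applied to A⁻¹ instead of A: it writes the discriminant of f as a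
  -- multiple of that of f(AX), so det A never has to be inverted.
  ℋ₃-invariant : Invariant (ℋ₃ F)
  ℋ₃-invariant g {f , _} disc≉0 disc≈0 = disc≉0 (begin
    discriminant f                                     ≈⟨ discriminant-cong (pull-pull⁻¹ g f) ⟨
    discriminant (pull A⁻¹ (pull A f))                 ≈⟨ discriminant-pull A⁻¹ (pull A f) ⟩
    d * d * discriminant (pull A f)                    ≈⟨ *-congˡ disc≈0 ⟩
    d * d * 0#                                         ≈⟨ zeroʳ _ ⟩
    0#                                                 ∎)
    where
    open GL₃ g
    open import Relation.Binary.Reasoning.Setoid setoid
    d = determinant A⁻¹

  module _ {c′ ℓ′} (E : QuadraticExtension F c′ ℓ′) where
    private
      module E = QuadraticExtension E
      module EQ = QuadraticForms E.rawRing
      module EI = FormIdentities E.commutativeRing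
    open E using (ι; hom)
    open RingMorphisms.IsRingHomomorphism hom using (⟦⟧-cong)

    extend : GL₃ F → GL₃ E.extension
    extend g = record
      { A        = λ i j → ι (A i j)
      ; A⁻¹      = λ i j → ι (A⁻¹ i j)
      ; inverseˡ = λ i j → lift {A⁻¹} {A} {i} {j} (inverseˡ i j)
      ; inverseʳ = λ i j → lift {A} {A⁻¹} {i} {j} (inverseʳ i j)
      }
      where
      open GL₃ g
      lift : ∀ {A B : Matrix} {i j} → (A ∙ᴹ B) i j ≈ identity F i j →
             ((λ i j → ι (A i j)) EQ.∙ᴹ (λ i j → ι (B i j))) i j E.≈ identity E.extension i j
      lift {A} {B} {i} {j} eq =
        E.trans (E.sym (·-homo commutativeRing E.commutativeRing hom (A i) (column B j)))
        (E.trans (⟦⟧-cong (trans eq (identity≈unit F i j)))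
        (E.trans (unit-homo commutativeRing E.commutativeRing hom i j) (E.sym (identity≈unit E.extension i j))))

    -- The automorphism fixes the entries of A, which lie in F, so conjugating a linear form
    -- commutes with the substitution. Proportionality is cancelled over the extension, where A
    -- stays invertible.
    ℋ₂ᵢ-invariant : Invariant (ℋ₂ᵢ F E)
    ℋ₂ᵢ-invariant g {f , _} (s , a , u , a≉0 , u≁ū , f≈auū) =
      s , a , u EQ.·ᴹ A′ , a≉0
      , (λ (b , b≉0 , eq) → u≁ū (GL₃Action.proportional-·ᴹ E.extension (extend g)
          (b , b≉0 , λ i → E.trans (eq i) (E.*-congˡ (conjugate i)))))
      , λ i → E.trans (pull-homo commutativeRing E.commutativeRing hom A f i)
          (E.trans (EI.pull-cong {A = A′} (λ _ _ → E.refl) f≈auū i)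
          (E.trans (EI.pull-scale A′ (ι a) (EQ.linearProduct u ū) i)
          (E.*-congˡ (E.trans (EI.pull-product A′ u ū i)
            (EI.product-cong {u EQ.·ᴹ A′} (λ _ → E.refl) (λ j → E.sym (conjugate j)) i)))))
      where
      open GL₃ g
      open E.Automorphism s using (σ; isIsomorphism; fixesBaseField)
      open RingMorphisms.IsRingIsomorphism isIsomorphism using (isRingHomomorphism)
      A′ = GL₃.A (extend g)
      ū : Vector E.Carrier 3
      ū i = σ (u i)
      conjugate : ∀ j → σ ((u EQ.·ᴹ A′) j) E.≈ (ū EQ.·ᴹ A′) j
      conjugate j = E.trans (·-homo E.commutativeRing E.commutativeRing isRingHomomorphism u (EQ.column A′ j))
        (EI.·-cong {u = ū} (λ _ → E.refl) (λ i → fixesBaseField (A i j)))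

-- Conjugation in the quadratic extension

module Conjugation {q c ℓ c′ ℓ′} (F : FiniteField q c ℓ) (𝔼 : QuadraticExtension F c′ ℓ′) where
  private
    module F = FiniteField F
    module Fₚ = FieldProperties F
    module E = QuadraticExtension 𝔼
    module Eₚ = FieldProperties E.extension
  open E using (ι; hom; _≈_; _+_; _*_; -_; _-_; 0#; 1#; refl; sym; trans; +-cong; +-congˡ; +-congʳ; *-cong; *-congˡ; *-congʳ; -‿cong)
  open RingMorphisms.IsRingHomomorphism hom
  open Solver E.commutativeRing using (solve)
  open import Relation.Binary.Reasoning.Setoid E.setoid

  ι-zero : ∀ {x} → ι x ≈ 0# → x F.≈ F.0#
  ι-zero {x} ιx≈0 = decidable-stable (x Fₚ.≟ F.0#) λ x≉0 →
    let y , xy≈1 = F.inverse x x≉0 in E.1≉0 (begin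
      1#          ≈⟨ 1#-homo ⟨
      ι F.1#      ≈⟨ ⟦⟧-cong xy≈1 ⟨
      ι (x F.* y) ≈⟨ *-homo x y ⟩
      ι x * ι y   ≈⟨ *-congʳ ιx≈0 ⟩
      0# * ι y    ≈⟨ E.zeroˡ _ ⟩
      0#          ∎)

  ι-injective : ∀ {x y} → ι x ≈ ι y → x F.≈ y
  ι-injective {x} {y} ιx≈ιy = Fₚ.x-y≈0⇒x≈y x y (ι-zero (begin
    ι (x F.- y)      ≈⟨ +-homo x (F.- y) ⟩
    ι x + ι (F.- y)  ≈⟨ +-cong ιx≈ιy (-‿homo y) ⟩
    ι y - ι y        ≈⟨ E.-‿inverseʳ _ ⟩
    0#               ∎))

  Base : Pred E.Carrier _
  Base z = ∃ λ a → ι a ≈ z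

  Base-resp : Base Respects _≈_
  Base-resp z≈w (a , ιa≈z) = a , trans ιa≈z z≈w

  base? : Decidable Base
  base? z = finite-any? F.order (λ x≈y ιx≈z → trans (⟦⟧-cong (F.sym x≈y)) ιx≈z) (λ a → ι a Eₚ.≟ z)

  nonBase-size : ∃ λ k → HasSize (E.setoid ∣ₛ ∁ Base) k × q ℕ.+ k ≡ q ℕ.^ 2
  nonBase-size = complement-size E.order Base-resp base?
    (sizeByBijection F.order (λ a → ι a , a , refl) ⟦⟧-cong ι-injective (λ (_ , a , ιa≈z) → a , ιa≈z))

  abstract
    -- The base field has q < q² elements because q > 1, so something lies outside it; any such
    -- element serves as α.
    generator : ∃ (∁ Base)
    generator with nonBase-size
    ... | ℕ.suc k , size , _ = Inverse.from size 0F
    ... | ℕ.zero , _ , q≡q² = contradiction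
      (≡.trans (≡.sym (ℕ.+-identityʳ q)) (≡.trans q≡q² (≡.cong (q ℕ.*_) (ℕ.*-identityʳ q))))
      (ℕ.<⇒≢ (ℕ.m<m*n q q {{ℕ.>-nonZero (ℕ.<-trans (ℕ.s≤s ℕ.z≤n) Fₚ.1<q)}} Fₚ.1<q))

  α : E.Carrier
  α = proj₁ generator

  α∉Base : ¬ Base α
  α∉Base = proj₂ generator

  linear : E.Carrier → F.Carrier → F.Carrier → E.Carrier
  linear β a b = ι a + ι b * β

  linear-cong : ∀ {a a′ b b′} β → a F.≈ a′ → b F.≈ b′ → linear β a b ≈ linear β a′ b′
  linear-cong β a≈a′ b≈b′ = +-cong (⟦⟧-cong a≈a′) (*-congʳ (⟦⟧-cong b≈b′))

  independent : ∀ {a b} → linear α a b ≈ 0# → a F.≈ F.0# × b F.≈ F.0#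
  independent {a} {b} e = ι-zero ιa≈0 , b≈0
    where
    b≈0 : b F.≈ F.0#
    b≈0 = decidable-stable (b Fₚ.≟ F.0#) λ b≉0 →
      let x , -a≈bx = Fₚ.divide b≉0 (F.- a) in α∉Base (x , Eₚ.*-cancelˡ (λ ιb≈0 → b≉0 (ι-zero ιb≈0)) (begin
        ι b * ι x   ≈⟨ *-homo b x ⟨
        ι (b F.* x) ≈⟨ ⟦⟧-cong -a≈bx ⟨
        ι (F.- a)   ≈⟨ -‿homo a ⟩
        - ι a       ≈⟨ Eₚ.+≈0⇒≈- e ⟨
        ι b * α     ∎))
    ιa≈0 : ι a ≈ 0#
    ιa≈0 = begin
      ι a              ≈⟨ E.+-identityʳ _ ⟨
      ι a + 0#         ≈⟨ +-congˡ (E.zeroˡ α) ⟨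
      ι a + 0# * α     ≈⟨ +-congˡ (*-congʳ (trans (⟦⟧-cong b≈0) 0#-homo)) ⟨
      linear α a b     ≈⟨ e ⟩
      0#               ∎

  linear-injective : ∀ {a b a′ b′} → linear α a b ≈ linear α a′ b′ → a F.≈ a′ × b F.≈ b′
  linear-injective {a} {b} {a′} {b′} e =
    let a-a′≈0 , b-b′≈0 = independent (begin
          ι (a F.- a′) + ι (b F.- b′) * α
            ≈⟨ +-cong (trans (+-homo _ _) (+-congˡ (-‿homo _))) (*-congʳ (trans (+-homo _ _) (+-congˡ (-‿homo _)))) ⟩
          (ι a - ι a′) + (ι b - ι b′) * α
            ≈⟨ solve 5 (λ a a′ b b′ x → (a ⊕ ⊝ a′) ⊕ (b ⊕ ⊝ b′) ⊗ x
                ⊜ (a ⊕ b ⊗ x) ⊕ ⊝ (a′ ⊕ b′ ⊗ x)) (ι a) (ι a′) (ι b) (ι b′) α ⟩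
          linear α a b - linear α a′ b′   ≈⟨ +-congʳ e ⟩
          linear α a′ b′ - linear α a′ b′ ≈⟨ E.-‿inverseʳ _ ⟩
          0#                              ∎)
    in Fₚ.x-y≈0⇒x≈y _ _ a-a′≈0 , Fₚ.x-y≈0⇒x≈y _ _ b-b′≈0

  abstract
    -- The q·q combinations of 1 and α are distinct by independence, and the extension has just as
    -- many elements.
    coordinates : ∀ z → ∃₂ λ a b → linear α a b ≈ z
    coordinates z =
      let (a , b) , e = injective⇒surjective (size-× F.order F.order)
            (≡.subst (HasSize E.setoid) (≡.cong (q ℕ.*_) (ℕ.*-identityʳ q)) E.order)
            (λ (a , b) → linear α a b) (λ (p , r) → linear-cong α p r) linear-injective z
      in a , b , e

  -- The minimal polynomial of α is X² - sX - t.
  t s : F.Carrier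
  t = proj₁ (coordinates (α * α))
  s = proj₁ (proj₂ (coordinates (α * α)))

  α² : α * α ≈ linear α t s
  α² = sym (proj₂ (proj₂ (coordinates (α * α))))

  -- The second root of the minimal polynomial: the two roots have sum s.
  ᾱ : E.Carrier
  ᾱ = ι s - α

  ᾱ² : ᾱ * ᾱ ≈ linear ᾱ t s
  ᾱ² = begin
    (ι s - α) * (ι s - α)                        ≈⟨ solve 2 (λ s x → (s ⊕ ⊝ x) ⊗ (s ⊕ ⊝ x)
        ⊜ s ⊗ s ⊕ ⊝ (s ⊗ x ⊕ s ⊗ x) ⊕ x ⊗ x) (ι s) α ⟩
    ι s * ι s - (ι s * α + ι s * α) + α * α      ≈⟨ +-congˡ α² ⟩
    ι s * ι s - (ι s * α + ι s * α) + (ι t + ι s * α)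
      ≈⟨ solve 3 (λ s t x → s ⊗ s ⊕ ⊝ (s ⊗ x ⊕ s ⊗ x) ⊕ (t ⊕ s ⊗ x) ⊜ t ⊕ s ⊗ (s ⊕ ⊝ x)) (ι s) (ι t) α ⟩
    ι t + ι s * (ι s - α)                        ∎

  abstract
    -- Defined by sending α to ᾱ in coordinates rather than as the power z ↦ z^q. Additivity is then
    -- linear algebra, and multiplicativity needs only that ᾱ satisfies the same quadratic equation
    -- as α.
    conj : E.Carrier → E.Carrier
    conj z = let a , b , _ = coordinates z in linear ᾱ a b

    conj-linear : ∀ {z a b} → z ≈ linear α a b → conj z ≈ linear ᾱ a b
    conj-linear {z} e =
      let _ , _ , e′ = coordinates z
          p , r = linear-injective (trans e′ e)
      in linear-cong ᾱ p r

  conj-cong : ∀ {z w} → z ≈ w → conj z ≈ conj w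
  conj-cong {z} {w} z≈w = let _ , _ , e = coordinates w in
    trans (conj-linear (trans z≈w (sym e))) (sym (conj-linear (sym e)))

  linear-+ : ∀ β a b a′ b′ → linear β (a F.+ a′) (b F.+ b′) ≈ linear β a b + linear β a′ b′
  linear-+ β a b a′ b′ = begin
    ι (a F.+ a′) + ι (b F.+ b′) * β    ≈⟨ +-cong (+-homo _ _) (*-congʳ (+-homo _ _)) ⟩
    (ι a + ι a′) + (ι b + ι b′) * β    ≈⟨ solve 5 (λ a a′ b b′ x → (a ⊕ a′) ⊕ (b ⊕ b′) ⊗ x
        ⊜ (a ⊕ b ⊗ x) ⊕ (a′ ⊕ b′ ⊗ x)) (ι a) (ι a′) (ι b) (ι b′) β ⟩
    linear β a b + linear β a′ b′      ∎

  -- Multiplication in coordinates has the same structure constants for every root β of X² - sX - t.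
  -- Applied to α and to ᾱ, this makes `conj` multiplicative.
  linear-* : ∀ {β} → β * β ≈ linear β t s → ∀ a b a′ b′ →
    linear β (a F.* a′ F.+ b F.* b′ F.* t) (a F.* b′ F.+ b F.* a′ F.+ b F.* b′ F.* s) ≈ linear β a b * linear β a′ b′
  linear-* {β} β² a b a′ b′ = begin
    ι (a F.* a′ F.+ b F.* b′ F.* t) + ι (a F.* b′ F.+ b F.* a′ F.+ b F.* b′ F.* s) * β
      ≈⟨ +-cong ($ ⟨*⟩ $ ⟨+⟩ $ ⟨*⟩ $ ⟨*⟩ $) (*-congʳ ($ ⟨*⟩ $ ⟨+⟩ $ ⟨*⟩ $ ⟨+⟩ $ ⟨*⟩ $ ⟨*⟩ $)) ⟩
    (ι a * ι a′ + ι b * ι b′ * ι t) + (ι a * ι b′ + ι b * ι a′ + ι b * ι b′ * ι s) * β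
      ≈⟨ solve 7 (λ a b a′ b′ t s x → (a ⊗ a′ ⊕ b ⊗ b′ ⊗ t) ⊕ (a ⊗ b′ ⊕ b ⊗ a′ ⊕ b ⊗ b′ ⊗ s) ⊗ x
          ⊜ (a ⊗ a′ ⊕ (a ⊗ b′ ⊕ b ⊗ a′) ⊗ x) ⊕ b ⊗ b′ ⊗ (t ⊕ s ⊗ x)) (ι a) (ι b) (ι a′) (ι b′) (ι t) (ι s) β ⟩
    (ι a * ι a′ + (ι a * ι b′ + ι b * ι a′) * β) + ι b * ι b′ * (ι t + ι s * β)
      ≈⟨ +-congˡ (*-congˡ β²) ⟨
    (ι a * ι a′ + (ι a * ι b′ + ι b * ι a′) * β) + ι b * ι b′ * (β * β)
      ≈⟨ solve 5 (λ a b a′ b′ x → (a ⊗ a′ ⊕ (a ⊗ b′ ⊕ b ⊗ a′) ⊗ x) ⊕ b ⊗ b′ ⊗ (x ⊗ x)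
          ⊜ (a ⊕ b ⊗ x) ⊗ (a′ ⊕ b′ ⊗ x)) (ι a) (ι b) (ι a′) (ι b′) β ⟩
    linear β a b * linear β a′ b′ ∎
    where
    infixl 6 _⟨+⟩_
    _⟨+⟩_ : ∀ {x y x′ y′} → ι x ≈ x′ → ι y ≈ y′ → ι (x F.+ y) ≈ x′ + y′
    p ⟨+⟩ r = trans (+-homo _ _) (+-cong p r)
    infixl 7 _⟨*⟩_
    _⟨*⟩_ : ∀ {x y x′ y′} → ι x ≈ x′ → ι y ≈ y′ → ι (x F.* y) ≈ x′ * y′
    p ⟨*⟩ r = trans (*-homo _ _) (*-cong p r)
    $ : ∀ {x} → ι x ≈ ι x
    $ = refl

  conj-+ : ∀ x y → conj (x + y) ≈ conj x + conj y
  conj-+ x y =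
    let a , b , e = coordinates x
        a′ , b′ , e′ = coordinates y
    in trans (conj-linear (trans (+-cong (sym e) (sym e′)) (sym (linear-+ α a b a′ b′)))) (trans (linear-+ ᾱ a b a′ b′) (+-cong (sym (conj-linear (sym e))) (sym (conj-linear (sym e′)))))

  conj-* : ∀ x y → conj (x * y) ≈ conj x * conj y
  conj-* x y =
    let a , b , e = coordinates x
        a′ , b′ , e′ = coordinates y
    in trans (conj-linear (trans (*-cong (sym e) (sym e′)) (sym (linear-* α² a b a′ b′)))) (trans (linear-* ᾱ² a b a′ b′) (*-cong (sym (conj-linear (sym e))) (sym (conj-linear (sym e′)))))

  linear-base : ∀ β a → ι a ≈ linear β a F.0#
  linear-base β a = begin
    ι a               ≈⟨ solve 2 (λ a x → a ⊜ a ⊕ Κ (+ 0) ⊗ x) (ι a) β ⟩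
    ι a + 0# * β      ≈⟨ +-congˡ (*-congʳ 0#-homo) ⟨
    ι a + ι F.0# * β  ∎

  conj-ι : ∀ a → conj (ι a) ≈ ι a
  conj-ι a = trans (conj-linear (linear-base α a)) (sym (linear-base ᾱ a))

  conj-0 : conj 0# ≈ 0#
  conj-0 = trans (conj-cong (sym 0#-homo)) (trans (conj-ι F.0#) 0#-homo)

  conj-1 : conj 1# ≈ 1#
  conj-1 = trans (conj-cong (sym 1#-homo)) (trans (conj-ι F.1#) 1#-homo)

  linear-generator : ∀ β → β ≈ linear β F.0# F.1#
  linear-generator β = begin
    β                      ≈⟨ solve 1 (λ x → x ⊜ Κ (+ 0) ⊕ Κ (+ 1) ⊗ x) β ⟩
    0# + 1# * β            ≈⟨ +-cong 0#-homo (*-congʳ 1#-homo) ⟨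
    ι F.0# + ι F.1# * β    ∎

  conj-α : conj α ≈ ᾱ
  conj-α = trans (conj-linear (linear-generator α)) (sym (linear-generator ᾱ))

  conj-‿ : ∀ z → conj (- z) ≈ - conj z
  conj-‿ z = Eₚ.+≈0⇒≈- (begin
    conj z + conj (- z)   ≈⟨ conj-+ z (- z) ⟨
    conj (z - z)          ≈⟨ conj-cong (E.-‿inverseʳ z) ⟩
    conj 0#               ≈⟨ conj-0 ⟩
    0#                    ∎)

  conj-ᾱ : conj ᾱ ≈ α
  conj-ᾱ = begin
    conj (ι s - α)          ≈⟨ conj-+ (ι s) (- α) ⟩
    conj (ι s) + conj (- α) ≈⟨ +-cong (conj-ι s) (trans (conj-‿ α) (-‿cong conj-α)) ⟩
    ι s - (ι s - α)         ≈⟨ solve 2 (λ s x → s ⊕ ⊝ (s ⊕ ⊝ x) ⊜ x) (ι s) α ⟩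
    α                       ∎

  conj-involutive : ∀ z → conj (conj z) ≈ z
  conj-involutive z = let a , b , e = coordinates z in begin
    conj (conj z)                         ≈⟨ conj-cong (conj-linear (sym e)) ⟩
    conj (ι a + ι b * ᾱ)                  ≈⟨ conj-+ _ _ ⟩
    conj (ι a) + conj (ι b * ᾱ)
      ≈⟨ +-cong (conj-ι a) (trans (conj-* _ _) (*-cong (conj-ι b) conj-ᾱ)) ⟩
    ι a + ι b * α                         ≈⟨ e ⟩
    z                                     ∎

  conjugation : E.Automorphism
  conjugation = record
    { σ              = conj
    ; isIsomorphism  = record
      { isRingMonomorphism = record
        { isRingHomomorphism = record
          { isSemiringHomomorphism = record
            { isNearSemiringHomomorphism = record
              { +-isMonoidHomomorphism = record
                { isMagmaHomomorphism = record
                  { isRelHomomorphism = record { cong = conj-cong }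
                  ; homo              = conj-+
                  }
                ; ε-homo = conj-0
                }
              ; *-homo = conj-*
              }
            ; 1#-homo = conj-1
            }
          ; -‿homo = conj-‿
          }
        ; injective = λ {x} {y} e → trans (sym (conj-involutive x)) (trans (conj-cong e) (conj-involutive y))
        }
      ; surjective = λ z → conj z , λ e → trans (conj-cong e) (conj-involutive z)
      }
    ; fixesBaseField = conj-ι
    }

  -- The difference of the two roots, a square root of the discriminant s² + 4t of the minimal
  -- polynomial.
  δ : E.Carrier
  δ = α - ᾱ

  conj-δ : conj δ ≈ - δ
  conj-δ = begin
    conj (α - ᾱ)          ≈⟨ conj-+ α (- ᾱ) ⟩
    conj α + conj (- ᾱ)   ≈⟨ +-cong conj-α (trans (conj-‿ ᾱ) (-‿cong conj-ᾱ)) ⟩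
    ᾱ - α                 ≈⟨ solve 2 (λ x y → y ⊕ ⊝ x ⊜ ⊝ (x ⊕ ⊝ y)) α ᾱ ⟩
    - (α - ᾱ)             ∎

  -- Separability: otherwise the characteristic is 2 and α² = t, but t is a square in F.
  δ≉0 : ¬ δ ≈ 0#
  δ≉0 δ≈0 = α∉Base (r , sym (Eₚ.Characteristic2.square-injective 2≈0ᴱ (begin
    α * α            ≈⟨ α² ⟩
    ι t + ι s * α    ≈⟨ +-congˡ (*-congʳ (trans (⟦⟧-cong s≈0) 0#-homo)) ⟩
    ι t + 0# * α     ≈⟨ solve 2 (λ a x → a ⊕ Κ (+ 0) ⊗ x ⊜ a) (ι t) α ⟩
    ι t              ≈⟨ ⟦⟧-cong r²≈t ⟨
    ι (r F.* r)      ≈⟨ *-homo r r ⟩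
    ι r * ι r        ∎)))
    where
    relation : (F.- s) F.≈ F.0# × F.1# F.+ F.1# F.≈ F.0#
    relation = independent (begin
      ι (F.- s) + ι (F.1# F.+ F.1#) * α
        ≈⟨ +-cong (-‿homo s) (*-congʳ (trans (+-homo _ _) (+-cong 1#-homo 1#-homo))) ⟩
      - ι s + (1# + 1#) * α
        ≈⟨ solve 2 (λ s x → ⊝ s ⊕ (Κ (+ 1) ⊕ Κ (+ 1)) ⊗ x ⊜ x ⊕ ⊝ (s ⊕ ⊝ x)) (ι s) α ⟩
      α - (ι s - α)                      ≈⟨ δ≈0 ⟩
      0#                                 ∎)
    s≈0 : s F.≈ F.0#
    s≈0 = Fₚ.-≈0⇒≈0 (proj₁ relation)
    2≈0ᴱ : 1# + 1# ≈ 0#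
    2≈0ᴱ = begin
      1# + 1#             ≈⟨ +-cong 1#-homo 1#-homo ⟨
      ι F.1# + ι F.1#     ≈⟨ +-homo _ _ ⟨
      ι (F.1# F.+ F.1#)   ≈⟨ ⟦⟧-cong (proj₂ relation) ⟩
      ι F.0#              ≈⟨ 0#-homo ⟩
      0#                  ∎
    r = proj₁ (Fₚ.Characteristic2.sqrt (proj₂ relation) t)
    r²≈t = proj₂ (Fₚ.Characteristic2.sqrt (proj₂ relation) t)

  abstract
    -- For z = a + bα the difference of z and its conjugate is bδ, and δ ≠ 0 forces b = 0.
    fixed⇒Base : ∀ {z} → conj z ≈ z → Base z
    fixed⇒Base {z} fixed = let a , b , e = coordinates z in a , (begin
      ι a                     ≈⟨ linear-base α a ⟩
      linear α a F.0#         ≈⟨ linear-cong α F.refl (b≈0 a b e) ⟨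
      linear α a b            ≈⟨ e ⟩
      z                       ∎)
      where
      b≈0 : ∀ a b → linear α a b ≈ z → b F.≈ F.0#
      b≈0 a b e = ι-zero (Eₚ.*-cancel-0 δ≉0 (begin
        (α - ᾱ) * ι b                      ≈⟨ solve 4 (λ a b x y → (x ⊕ ⊝ y) ⊗ b
            ⊜ (a ⊕ b ⊗ x) ⊕ ⊝ (a ⊕ b ⊗ y)) (ι a) (ι b) α ᾱ ⟩
        linear α a b - linear ᾱ a b
          ≈⟨ +-cong e (-‿cong (trans (sym (conj-linear (sym e))) fixed)) ⟩
        z - z                              ≈⟨ E.-‿inverseʳ z ⟩
        0#                                 ∎))

  trace∈Base : ∀ z → Base (z + conj z)
  trace∈Base z = fixed⇒Base (begin
    conj (z + conj z)          ≈⟨ conj-+ z (conj z) ⟩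
    conj z + conj (conj z)     ≈⟨ +-congˡ (conj-involutive z) ⟩
    conj z + z                 ≈⟨ E.+-comm _ _ ⟩
    z + conj z                 ∎)

  norm∈Base : ∀ z → Base (z * conj z)
  norm∈Base z = fixed⇒Base (begin
    conj (z * conj z)          ≈⟨ conj-* z (conj z) ⟩
    conj z * conj (conj z)     ≈⟨ *-congˡ (conj-involutive z) ⟩
    conj z * z                 ≈⟨ E.*-comm _ _ ⟩
    z * conj z                 ∎)

  δ²∈Base : Base (δ * δ)
  δ²∈Base = fixed⇒Base (begin
    conj (δ * δ)      ≈⟨ conj-* δ δ ⟩
    conj δ * conj δ   ≈⟨ *-cong conj-δ conj-δ ⟩
    - δ * - δ         ≈⟨ solve 1 (λ x → ⊝ x ⊗ ⊝ x ⊜ x ⊗ x) δ ⟩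
    δ * δ             ∎)

  abstract
    -- Both z and δ change sign under conjugation, so z/δ is fixed and lies in F. In characteristic
    -- 2 skew elements are the fixed ones, and δ itself lies in F.
    skew⇒multiple : ∀ {z} → conj z ≈ - z → ∃ λ x → z ≈ δ * ι x
    skew⇒multiple {z} skew =
      let w , z≈δw = Eₚ.divide δ≉0 z
          x , ιx≈w = fixed⇒Base (Eₚ.*-cancelˡ δ≉0 (begin
            δ * conj w          ≈⟨ solve 2 (λ d w → d ⊗ w ⊜ ⊝ (⊝ d ⊗ w)) δ (conj w) ⟩
            - (- δ * conj w)    ≈⟨ -‿cong (*-congʳ conj-δ) ⟨
            - (conj δ * conj w) ≈⟨ -‿cong (conj-* δ w) ⟨
            - conj (δ * w)      ≈⟨ -‿cong (conj-cong z≈δw) ⟨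
            - conj z            ≈⟨ -‿cong skew ⟩
            - - z               ≈⟨ solve 1 (λ z → ⊝ (⊝ z) ⊜ z) z ⟩
            z                   ≈⟨ z≈δw ⟩
            δ * w               ∎))
      in x , trans z≈δw (*-congˡ (sym ιx≈w))

  module _ (𝓈 : E.Automorphism) where
    open E.Automorphism 𝓈
    private
      module σ = RingMorphisms.IsRingIsomorphism isIsomorphism

      σ-linear : ∀ {a b z β} → linear α a b ≈ z → σ α ≈ β → σ z ≈ linear β a b
      σ-linear {a} {b} {z} {β} e σα≈β = begin
        σ z                    ≈⟨ σ.⟦⟧-cong e ⟨
        σ (ι a + ι b * α)      ≈⟨ σ.+-homo _ _ ⟩
        σ (ι a) + σ (ι b * α)
          ≈⟨ +-cong (fixesBaseField a) (trans (σ.*-homo _ _) (*-cong (fixesBaseField b) σα≈β)) ⟩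
        ι a + ι b * β          ∎

      root : (σ α - α) * (σ α - ᾱ) ≈ 0#
      root = begin
        (σ α - α) * (σ α - (ι s - α))
          ≈⟨ solve 3 (λ y x s → (y ⊕ ⊝ x) ⊗ (y ⊕ ⊝ (s ⊕ ⊝ x))
              ⊜ y ⊗ y ⊕ ⊝ (s ⊗ y) ⊕ (s ⊗ x ⊕ ⊝ (x ⊗ x))) (σ α) α (ι s) ⟩
        σ α * σ α - ι s * σ α + (ι s * α - α * α)
          ≈⟨ +-cong (+-congʳ (trans (sym (σ.*-homo α α)) (σ-linear (sym α²) refl))) (+-congˡ (-‿cong α²)) ⟩
        (ι t + ι s * σ α) - ι s * σ α + (ι s * α - (ι t + ι s * α))
          ≈⟨ solve 4 (λ y x s t → (t ⊕ s ⊗ y) ⊕ ⊝ (s ⊗ y) ⊕ (s ⊗ x ⊕ ⊝ (t ⊕ s ⊗ x))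
              ⊜ Κ (+ 0)) (σ α) α (ι s) (ι t) ⟩
        0# ∎

    -- Being the identity on F, σ permutes the roots of the minimal polynomial of α, and it is
    -- determined by the image of α because 1 and α span the extension.
    identity-or-conjugation : (∀ z → σ z ≈ z) ⊎ (∀ z → σ z ≈ conj z)
    identity-or-conjugation = Sum.map
      (λ σα≈α z → let a , b , e = coordinates z in trans (σ-linear e σα≈α) e)
      (λ σα≈ᾱ z → let a , b , e = coordinates z in trans (σ-linear e σα≈ᾱ) (sym (conj-linear (sym e))))
      (Eₚ.roots root)

-- Counting the forms without X₀X₁ and X₁X₂ terms

module NormalForms {q c ℓ} (F : FiniteField q c ℓ) where
  open import Data.Vec.Functional using ([]; _∷_)
  open FiniteField F
  open FieldProperties F
  open Solver commutativeRing using (solve)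
  open QuadraticForms rawRing
  open FormIdentities commutativeRing
  open import Relation.Binary.Reasoning.Setoid setoid

  -- a X₀² + b X₀X₂ + d X₁² + c X₂²
  quad : Carrier → Carrier → Carrier → Carrier → Vector Carrier 6
  quad a b d c = a ∷ 0# ∷ b ∷ d ∷ 0# ∷ c ∷ []

  quad-cong : ∀ {a a′ b b′ d d′ c c′} → a ≈ a′ → b ≈ b′ → d ≈ d′ → c ≈ c′ →
              ∀ i → quad a b d c i ≈ quad a′ b′ d′ c′ i
  quad-cong a b d c = ∀₆ (a , refl , b , d , refl , c)

  ∼-sym : ∀ {n} {f g : Vector Carrier n} → Proportional F f g → Proportional F g f
  ∼-sym {f = f} {g} (a , a≉0 , f≈ag) =
    let b , ab≈1 = inverse a a≉0 in b , (λ b≈0 → 1≉0 (trans (sym ab≈1) (trans (*-congˡ b≈0) (zeroʳ a)))) , λ i → begin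
      g i              ≈⟨ *-identityˡ _ ⟨
      1# * g i         ≈⟨ *-congʳ ab≈1 ⟨
      a * b * g i      ≈⟨ solve 3 (λ a b g → a ⊗ b ⊗ g ⊜ b ⊗ (a ⊗ g)) a b (g i) ⟩
      b * (a * g i)    ≈⟨ *-congˡ (f≈ag i) ⟨
      b * f i          ∎

  module _ {f g : Vector Carrier 6} (f∼g : Proportional F f g) where
    private
      k = proj₁ f∼g
      k≉0 = proj₁ (proj₂ f∼g)
      f≈kg = proj₂ (proj₂ f∼g)

    -- A common coordinate 1 forces the scalar to be 1. Each family of forms below is normalized so
    -- that this applies.
    ∼⇒≈ : ∀ i → f i ≈ 1# → g i ≈ 1# → ∀ j → f j ≈ g j
    ∼⇒≈ i fi≈1 gi≈1 j = trans (f≈kg j) (trans (*-congʳ k≈1) (*-identityˡ _))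
      where
      k≈1 : k ≈ 1#
      k≈1 = begin
        k        ≈⟨ *-identityʳ k ⟨
        k * 1#   ≈⟨ *-congˡ gi≈1 ⟨
        k * g i  ≈⟨ f≈kg i ⟨
        f i      ≈⟨ fi≈1 ⟩
        1#       ∎

    ∼-zeroʳ : ∀ i → g i ≈ 0# → f i ≈ 0#
    ∼-zeroʳ i gi≈0 = trans (f≈kg i) (trans (*-congˡ gi≈0) (zeroʳ k))

    ∼-zeroˡ : ∀ i → f i ≈ 0# → g i ≈ 0#
    ∼-zeroˡ i fi≈0 = *-cancel-0 k≉0 (trans (sym (f≈kg i)) fi≈0)

  sameDirection : ∀ {u v : Vector Carrier 3} i (w : Vector Carrier 3) → ¬ u i ≈ 0# → ¬ v i ≈ 0# →
    (∀ j → u j ≈ u i * w j) → (∀ j → v j ≈ v i * w j) → Proportional F u v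
  sameDirection {u} {v} i w uᵢ≉0 vᵢ≉0 u≈ v≈ =
    let b , uᵢ≈vᵢb = divide vᵢ≉0 (u i)
    in b , (λ b≈0 → uᵢ≉0 (trans uᵢ≈vᵢb (trans (*-congˡ b≈0) (zeroʳ _)))) , λ j → begin
      u j              ≈⟨ u≈ j ⟩
      u i * w j        ≈⟨ *-congʳ uᵢ≈vᵢb ⟩
      v i * b * w j    ≈⟨ solve 3 (λ v b w → v ⊗ b ⊗ w ⊜ b ⊗ (v ⊗ w)) (v i) b (w j) ⟩
      b * (v i * w j)  ≈⟨ *-congˡ (v≈ j) ⟨
      b * v j          ∎

  -- The product (X₀ + tX₂)(X₀ + t′X₂), given through the sum s and the product p of t and t′.
  -- Conjugate factors over the extension have the same shape, with trace and norm in place of s and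
  -- p.
  split-form : Carrier → Carrier → Vector Carrier 6
  split-form s p = quad 1# s 0# p

  -- The product X₂(X₀ + tX₂): one of the two points of PG(1,q) is at infinity.
  infinite-form : Carrier → Vector Carrier 6
  infinite-form t = quad 0# 1# 0# t

  -- X₁² − D (x X₀ + y X₂)²
  affine-form : Carrier → Carrier → Carrier → Vector Carrier 6
  affine-form D x y = quad (- (D * (x * x))) (- (D * (x * y + x * y))) 1# (- (D * (y * y)))

  plane : Setoid _ _
  plane = ×-setoid setoid setoid

  -- For l = xX₀ + yX₂ this says that X₁ + l and X₁ - l are different lines. Phrased by doubling, it
  -- lets one parametrization serve both parities of q.
  NotTwoTorsion : Pred (Carrier × Carrier) _
  NotTwoTorsion (x , y) = ¬ (x + x ≈ 0# × y + y ≈ 0#)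

  x+x≈0⇒-x≈x : ∀ {x} → x + x ≈ 0# → - x ≈ x
  x+x≈0⇒-x≈x x+x≈0 = sym (+≈0⇒≈- x+x≈0)

  negation : FreeInvolution (plane ∣ₛ NotTwoTorsion)
  negation = record
    { τ            = λ ((x , y) , 2≉0) → (- x , - y) , λ (x , y) → 2≉0 (torsion x , torsion y)
    ; τ-cong       = λ (p , r) → -‿cong p , -‿cong r
    ; τ-involutive = λ _ → neg-neg _ , neg-neg _
    ; τ-free       = λ (_ , 2≉0) (p , r) → 2≉0 (fixed p , fixed r)
    }
    where
    neg-neg : ∀ x → - - x ≈ x
    neg-neg = solve 1 (λ x → ⊝ (⊝ x) ⊜ x)
    torsion : ∀ {x} → - x + - x ≈ 0# → x + x ≈ 0#
    torsion {x} e = -≈0⇒≈0 (trans (solve 1 (λ x → ⊝ (x ⊕ x) ⊜ ⊝ x ⊕ ⊝ x) x) e)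
    fixed : ∀ {x} → - x ≈ x → x + x ≈ 0#
    fixed {x} e = trans (+-congʳ (sym e)) (-‿inverseˡ x)

  affine-cong : ∀ D {x x′ y y′} → x ≈ x′ → y ≈ y′ → ∀ i → affine-form D x y i ≈ affine-form D x′ y′ i
  affine-cong D x y = quad-cong (-‿cong (*-congˡ (*-cong x x))) (-‿cong (*-congˡ (+-cong (*-cong x y) (*-cong x y))))
    refl (-‿cong (*-congˡ (*-cong y y)))

  affine-neg : ∀ D x y i → affine-form D (- x) (- y) i ≈ affine-form D x y i
  affine-neg D x y = quad-cong
    (solve 2 (λ d x → ⊝ (d ⊗ (⊝ x ⊗ ⊝ x)) ⊜ ⊝ (d ⊗ (x ⊗ x))) D x)
    (solve 3 (λ d x y → ⊝ (d ⊗ (⊝ x ⊗ ⊝ y ⊕ ⊝ x ⊗ ⊝ y)) ⊜ ⊝ (d ⊗ (x ⊗ y ⊕ x ⊗ y))) D x y)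
    refl
    (solve 2 (λ d x → ⊝ (d ⊗ (⊝ x ⊗ ⊝ x)) ⊜ ⊝ (d ⊗ (x ⊗ x))) D y)

  -- The x = ± x′ and y = ± y′ obtained from the squares have compatible signs because of the middle coefficient.
  affine-injective : ∀ {D} → ¬ D ≈ 0# → ∀ {x y x′ y′} → affine-form D x y 0F ≈ affine-form D x′ y′ 0F →
    affine-form D x y 2F ≈ affine-form D x′ y′ 2F → affine-form D x y 5F ≈ affine-form D x′ y′ 5F →
    (x ≈ x′ × y ≈ y′) ⊎ (x ≈ - x′ × y ≈ - y′)
  affine-injective {D} D≉0 {x} {y} {x′} {y′} e₀ e₂ e₅ = signs (sameSquare (cancel e₀)) (sameSquare (cancel e₅))
    where
    cancel : ∀ {a b} → - (D * a) ≈ - (D * b) → a ≈ b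
    cancel {a} {b} e = *-cancelˡ D≉0 (begin
      D * a        ≈⟨ solve 1 (λ x → x ⊜ ⊝ (⊝ x)) (D * a) ⟩
      - - (D * a)  ≈⟨ -‿cong e ⟩
      - - (D * b)  ≈⟨ solve 1 (λ x → ⊝ (⊝ x) ⊜ x) (D * b) ⟩
      D * b        ∎)
    -- Disagreeing signs give -2x′y′ = 2x′y′, that is 4x′y′ = 0. Either 2 = 0 and signs are
    -- immaterial, or one coordinate is 0 and its sign can be changed at will.
    mixed : - (x′ * y′ + x′ * y′) ≈ x′ * y′ + x′ * y′ → - x′ ≈ x′ ⊎ - y′ ≈ y′
    mixed e with 1# + 1# ≟ 0#
    ... | yes 2≈0 = inj₁ (Characteristic2.-x≈x 2≈0 x′)
    ... | no  2≉0 with *-zero (*-cancel-0 2≉0 (*-cancel-0 2≉0 (begin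
      (1# + 1#) * ((1# + 1#) * (x′ * y′))
        ≈⟨ solve 2 (λ x y → (Κ (+ 1) ⊕ Κ (+ 1)) ⊗ ((Κ (+ 1) ⊕ Κ (+ 1)) ⊗ (x ⊗ y))
            ⊜ (x ⊗ y ⊕ x ⊗ y) ⊕ (x ⊗ y ⊕ x ⊗ y)) x′ y′ ⟩
      (x′ * y′ + x′ * y′) + (x′ * y′ + x′ * y′)    ≈⟨ +-congʳ e ⟨
      - (x′ * y′ + x′ * y′) + (x′ * y′ + x′ * y′)  ≈⟨ -‿inverseˡ _ ⟩
      0#                                           ∎)))
    ...   | inj₁ x′≈0 = inj₁ (x+x≈0⇒-x≈x (trans (+-cong x′≈0 x′≈0) (+-identityˡ 0#)))
    ...   | inj₂ y′≈0 = inj₂ (x+x≈0⇒-x≈x (trans (+-cong y′≈0 y′≈0) (+-identityˡ 0#)))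
    signs : x ≈ x′ ⊎ x ≈ - x′ → y ≈ y′ ⊎ y ≈ - y′ → (x ≈ x′ × y ≈ y′) ⊎ (x ≈ - x′ × y ≈ - y′)
    signs (inj₁ p) (inj₁ r) = inj₁ (p , r)
    signs (inj₂ p) (inj₂ r) = inj₂ (p , r)
    signs (inj₁ p) (inj₂ r) with mixed (begin
      - (x′ * y′ + x′ * y′)    ≈⟨ solve 2 (λ x y → ⊝ (x ⊗ y ⊕ x ⊗ y) ⊜ x ⊗ ⊝ y ⊕ x ⊗ ⊝ y) x′ y′ ⟩
      x′ * - y′ + x′ * - y′    ≈⟨ +-cong (*-cong p r) (*-cong p r) ⟨
      x * y + x * y            ≈⟨ cancel e₂ ⟩
      x′ * y′ + x′ * y′        ∎)
    ... | inj₁ -x′≈x′ = inj₂ (trans p (sym -x′≈x′) , r)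
    ... | inj₂ -y′≈y′ = inj₁ (p , trans r -y′≈y′)
    signs (inj₂ p) (inj₁ r) with mixed (begin
      - (x′ * y′ + x′ * y′)    ≈⟨ solve 2 (λ x y → ⊝ (x ⊗ y ⊕ x ⊗ y) ⊜ ⊝ x ⊗ y ⊕ ⊝ x ⊗ y) x′ y′ ⟩
      - x′ * y′ + - x′ * y′    ≈⟨ +-cong (*-cong p r) (*-cong p r) ⟨
      x * y + x * y            ≈⟨ cancel e₂ ⟩
      x′ * y′ + x′ * y′        ∎)
    ... | inj₁ -x′≈x′ = inj₁ (trans p -x′≈x′ , r)
    ... | inj₂ -y′≈y′ = inj₂ (p , trans r (sym -y′≈y′))

  -- Pairs of real lines

  module RealPairs where
    distinctPairs : Setoid _ _
    distinctPairs = plane ∣ₛ λ (t , t′) → ¬ t ≈ t′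

    swapPairs : FreeInvolution distinctPairs
    swapPairs = record
      { τ            = λ ((t , t′) , t≉t′) → (t′ , t) , λ e → t≉t′ (sym e)
      ; τ-cong       = λ (p , r) → r , p
      ; τ-involutive = λ _ → refl , refl
      ; τ-free       = λ (_ , t≉t′) (e , _) → t≉t′ (sym e)
      }

    distinctPairs-size : ∃ λ k → HasSize distinctPairs k × q ℕ.+ k ≡ q ℕ.* q
    distinctPairs-size = complement-size (size-× order order)
      (λ (p , r) e → trans (sym p) (trans e r)) (λ (t , t′) → t ≟ t′)
      (sizeByBijection order (λ t → (t , t) , refl) (λ e → e , e) proj₁ (λ ((t , t′) , e) → t , refl , e))

    -- A root t of X₀ + tX₂ paired with the point X₂ at infinity is listed twice,
    -- so that every factorization appears in two orders.
    factorizations : Setoid _ _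
    factorizations = ⊎-setoid (⊎-setoid distinctPairs (⊎-setoid setoid setoid)) (plane ∣ₛ NotTwoTorsion)

    exchange : FreeInvolution factorizations
    exchange = ⊎-free (⊎-free swapPairs (swap-free setoid)) negation

    open FreeInvolution exchange using (τ; _≈τ_)
    module Fac = Setoid factorizations

    form : Fac.Carrier → Vector Carrier 6
    form (inj₁ (inj₁ ((t , t′) , _))) = split-form (t + t′) (t * t′)
    form (inj₁ (inj₂ (inj₁ t)))       = infinite-form t
    form (inj₁ (inj₂ (inj₂ t)))       = infinite-form t
    form (inj₂ ((x , y) , _))         = affine-form 1# x y

    form-cong : ∀ {e e′} → e Fac.≈ e′ → ∀ i → form e i ≈ form e′ i
    form-cong (inj₁ (inj₁ (p , r)))  = quad-cong refl (+-cong p r) refl (*-cong p r)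
    form-cong (inj₁ (inj₂ (inj₁ e))) = quad-cong refl refl refl e
    form-cong (inj₁ (inj₂ (inj₂ e))) = quad-cong refl refl refl e
    form-cong (inj₂ (p , r))         = affine-cong 1# p r

    form-τ : ∀ e i → form (τ e) i ≈ form e i
    form-τ (inj₁ (inj₁ _))        = quad-cong refl (+-comm _ _) refl (*-comm _ _)
    form-τ (inj₁ (inj₂ (inj₁ _))) i = refl
    form-τ (inj₁ (inj₂ (inj₂ _))) i = refl
    form-τ (inj₂ ((x , y) , _))   = affine-neg 1# x y

    -- The coefficient at X₁² separates the affine family from the binary forms, and the one at X₀²
    -- separates the forms with a factor X₂ from the others. Within a family, the roots are
    -- recovered from sum and product, and l is recovered up to sign.
    form-injective : ∀ e e′ → Proportional F (form e) (form e′) → e ≈τ e′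
    form-injective (inj₁ (inj₁ _)) (inj₁ (inj₁ _)) f∼g
      with sameFactors (∼⇒≈ f∼g 0F refl refl 2F) (∼⇒≈ f∼g 0F refl refl 5F)
    ... | inj₁ e = inj₁ (inj₁ (inj₁ e))
    ... | inj₂ e = inj₂ (inj₁ (inj₁ e))
    form-injective (inj₁ (inj₂ (inj₁ _))) (inj₁ (inj₂ (inj₁ _))) f∼g = inj₁ (inj₁ (inj₂ (inj₁ (∼⇒≈ f∼g 2F refl refl 5F))))
    form-injective (inj₁ (inj₂ (inj₁ _))) (inj₁ (inj₂ (inj₂ _))) f∼g = inj₂ (inj₁ (inj₂ (inj₁ (∼⇒≈ f∼g 2F refl refl 5F))))
    form-injective (inj₁ (inj₂ (inj₂ _))) (inj₁ (inj₂ (inj₁ _))) f∼g = inj₂ (inj₁ (inj₂ (inj₂ (∼⇒≈ f∼g 2F refl refl 5F))))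
    form-injective (inj₁ (inj₂ (inj₂ _))) (inj₁ (inj₂ (inj₂ _))) f∼g = inj₁ (inj₁ (inj₂ (inj₂ (∼⇒≈ f∼g 2F refl refl 5F))))
    form-injective (inj₂ _) (inj₂ _) f∼g
      with affine-injective 1≉0 (∼⇒≈ f∼g 3F refl refl 0F) (∼⇒≈ f∼g 3F refl refl 2F) (∼⇒≈ f∼g 3F refl refl 5F)
    ... | inj₁ e = inj₁ (inj₂ e)
    ... | inj₂ e = inj₂ (inj₂ e)
    form-injective (inj₁ (inj₁ _)) (inj₁ (inj₂ (inj₁ _))) f∼g = contradiction (∼-zeroʳ f∼g 0F refl) 1≉0
    form-injective (inj₁ (inj₁ _)) (inj₁ (inj₂ (inj₂ _))) f∼g = contradiction (∼-zeroʳ f∼g 0F refl) 1≉0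
    form-injective (inj₁ (inj₂ (inj₁ _))) (inj₁ (inj₁ _)) f∼g = contradiction (∼-zeroˡ f∼g 0F refl) 1≉0
    form-injective (inj₁ (inj₂ (inj₂ _))) (inj₁ (inj₁ _)) f∼g = contradiction (∼-zeroˡ f∼g 0F refl) 1≉0
    form-injective (inj₁ (inj₁ _)) (inj₂ _) f∼g = contradiction (∼-zeroˡ f∼g 3F refl) 1≉0
    form-injective (inj₁ (inj₂ (inj₁ _))) (inj₂ _) f∼g = contradiction (∼-zeroˡ f∼g 3F refl) 1≉0
    form-injective (inj₁ (inj₂ (inj₂ _))) (inj₂ _) f∼g = contradiction (∼-zeroˡ f∼g 3F refl) 1≉0
    form-injective (inj₂ _) (inj₁ (inj₁ _)) f∼g = contradiction (∼-zeroʳ f∼g 3F refl) 1≉0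
    form-injective (inj₂ _) (inj₁ (inj₂ (inj₁ _))) f∼g = contradiction (∼-zeroʳ f∼g 3F refl) 1≉0
    form-injective (inj₂ _) (inj₁ (inj₂ (inj₂ _))) f∼g = contradiction (∼-zeroʳ f∼g 3F refl) 1≉0

module RealPairsCount {q c ℓ} (F : FiniteField q c ℓ) where
  open import Data.Vec.Functional using ([]; _∷_)
  open FiniteField F
  open FieldProperties F
  open NormalForms F
  open RealPairs
  open Solver commutativeRing using (solve)
  open QuadraticForms rawRing
  open import Relation.Binary.Reasoning.Setoid setoid

  private
    Target = Normal F (ℋ₂ᵣ F)
    module T = Setoid Target

    Member : Vector Carrier 6 → Set _
    Member f = ¬ (∀ i → f i ≈ 0#)
      × (∃₂ λ u v → ¬ Proportional F u v × (∀ i → f i ≈ product F u v i))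
      × f 1F ≈ 0# × f 4F ≈ 0#

  split-member : ∀ {t t′} → ¬ t ≈ t′ → Member (split-form (t + t′) (t * t′))
  split-member {t} {t′} t≉t′ =
      (λ f≈0 → 1≉0 (f≈0 0F))
    , ( 1# ∷ 0# ∷ t ∷ [] , 1# ∷ 0# ∷ t′ ∷ []
      , (λ (a , _ , u≈av) → let a≈1 = trans (sym (*-identityʳ a)) (sym (u≈av 0F))
                            in t≉t′ (trans (u≈av 2F) (trans (*-congʳ a≈1) (*-identityˡ t′))))
      , ∀₆ ( solve 0 (Κ (+ 1) ⊜ Κ (+ 1) ⊗ Κ (+ 1))
           , solve 0 (Κ (+ 0) ⊜ Κ (+ 1) ⊗ Κ (+ 0) ⊕ Κ (+ 0) ⊗ Κ (+ 1))
           , solve 2 (λ t t′ → t ⊕ t′ ⊜ Κ (+ 1) ⊗ t′ ⊕ t ⊗ Κ (+ 1)) t t′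
           , solve 0 (Κ (+ 0) ⊜ Κ (+ 0) ⊗ Κ (+ 0))
           , solve 2 (λ t t′ → Κ (+ 0) ⊜ Κ (+ 0) ⊗ t′ ⊕ t ⊗ Κ (+ 0)) t t′
           , refl ))
    , refl , refl

  infinite-member : ∀ t → Member (infinite-form t)
  infinite-member t =
      (λ f≈0 → 1≉0 (f≈0 2F))
    , ( 0# ∷ 0# ∷ 1# ∷ [] , 1# ∷ 0# ∷ t ∷ []
      , (λ (a , a≉0 , u≈av) → a≉0 (trans (sym (*-identityʳ a)) (sym (u≈av 0F))))
      , ∀₆ ( solve 0 (Κ (+ 0) ⊜ Κ (+ 0) ⊗ Κ (+ 1))
           , solve 0 (Κ (+ 0) ⊜ Κ (+ 0) ⊗ Κ (+ 0) ⊕ Κ (+ 0) ⊗ Κ (+ 1))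
           , solve 1 (λ t → Κ (+ 1) ⊜ Κ (+ 0) ⊗ t ⊕ Κ (+ 1) ⊗ Κ (+ 1)) t
           , solve 0 (Κ (+ 0) ⊜ Κ (+ 0) ⊗ Κ (+ 0))
           , solve 1 (λ t → Κ (+ 0) ⊜ Κ (+ 0) ⊗ t ⊕ Κ (+ 1) ⊗ Κ (+ 0)) t
           , sym (*-identityˡ t) ))
    , refl , refl

  affine-member : ∀ {x y} → NotTwoTorsion (x , y) → Member (affine-form 1# x y)
  affine-member {x} {y} 2≉0 =
      (λ f≈0 → 1≉0 (f≈0 3F))
    , ( x ∷ 1# ∷ y ∷ [] , - x ∷ 1# ∷ - y ∷ []
      , (λ (a , _ , u≈av) →
          let a≈1 = trans (sym (*-identityʳ a)) (sym (u≈av 1F))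
              torsion : ∀ {z} → z ≈ a * - z → z + z ≈ 0#
              torsion {z} z≈-az = trans (+-congʳ (trans z≈-az (trans (*-congʳ a≈1) (*-identityˡ _)))) (-‿inverseˡ z)
          in 2≉0 (torsion (u≈av 0F) , torsion (u≈av 2F)))
      , ∀₆ ( solve 1 (λ x → ⊝ (Κ (+ 1) ⊗ (x ⊗ x)) ⊜ x ⊗ ⊝ x) x
           , solve 1 (λ x → Κ (+ 0) ⊜ x ⊗ Κ (+ 1) ⊕ Κ (+ 1) ⊗ ⊝ x) x
           , solve 2 (λ x y → ⊝ (Κ (+ 1) ⊗ (x ⊗ y ⊕ x ⊗ y)) ⊜ x ⊗ ⊝ y ⊕ y ⊗ ⊝ x) x y
           , solve 0 (Κ (+ 1) ⊜ Κ (+ 1) ⊗ Κ (+ 1))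
           , solve 1 (λ y → Κ (+ 0) ⊜ Κ (+ 1) ⊗ ⊝ y ⊕ y ⊗ Κ (+ 1)) y
           , solve 1 (λ x → ⊝ (Κ (+ 1) ⊗ (x ⊗ x)) ⊜ x ⊗ ⊝ x) y ))
    , refl , refl

  member : ∀ e → Member (form e)
  member (inj₁ (inj₁ (_ , t≉t′)))  = split-member t≉t′
  member (inj₁ (inj₂ (inj₁ t)))    = infinite-member t
  member (inj₁ (inj₂ (inj₂ t)))    = infinite-member t
  member (inj₂ (_ , 2≉0))          = affine-member 2≉0

  hyperplane : Fac.Carrier → T.Carrier
  hyperplane e = let f≉0 , f∈ , n = member e in (form e , f≉0) , f∈ , n

  module _ {f : Vector Carrier 6} (f≉0 : ¬ (∀ i → f i ≈ 0#)) (f₁≈0 : f 1F ≈ 0#) (f₄≈0 : f 4F ≈ 0#) where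
    private
      Factored : Vector Carrier 3 → Vector Carrier 3 → Set _
      Factored u v = ¬ Proportional F u v × (∀ i → f i ≈ product F u v i)

      Found : Set _
      Found = ∃ λ e → Proportional F (form e) f

      swapped : ∀ {u v} → Factored u v → Factored v u
      swapped {u} {v} (u≁v , f≈uv) = (λ v∼u → u≁v (∼-sym v∼u)) , λ i → trans (f≈uv i) (product-comm i)
        where
        product-comm : ∀ i → product F u v i ≈ product F v u i
        product-comm = ∀₆ (*-comm _ _ , flip 0F 1F , flip 0F 2F , *-comm _ _ , flip 1F 2F , *-comm _ _)
          where
          flip : ∀ i j → u i * v j + u j * v i ≈ v i * u j + v j * u i
          flip i j = solve 4 (λ a b c d → a ⊗ d ⊕ b ⊗ c ⊜ c ⊗ b ⊕ d ⊗ a) (u i) (u j) (v i) (v j)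

      zeroˡ′ : ∀ {a} b → a ≈ 0# → a * b ≈ 0#
      zeroˡ′ b a≈0 = trans (*-congʳ a≈0) (zeroˡ b)
      zeroʳ′ : ∀ a {b} → b ≈ 0# → a * b ≈ 0#
      zeroʳ′ a b≈0 = trans (*-congˡ b≈0) (zeroʳ a)
      zero+ : ∀ {a b} → a ≈ 0# → b ≈ 0# → a + b ≈ 0#
      zero+ a≈0 b≈0 = trans (+-cong a≈0 b≈0) (+-identityˡ 0#)

      zero-factor : ∀ {u v} → Factored u v → (∀ i → u i ≈ 0#) → Found
      zero-factor {u} {v} (_ , f≈uv) u≈0 = contradiction (λ i → trans (f≈uv i) (uv≈0 i)) f≉0
        where
        uv≈0 : ∀ i → product F u v i ≈ 0#
        uv≈0 = ∀₆ (z 0F , zero+ (z 0F) (z 1F) , zero+ (z 0F) (z 2F) , z 1F , zero+ (z 1F) (z 2F) , z 2F)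
          where
          z : ∀ i {x} → u i * x ≈ 0#
          z i = zeroˡ′ _ (u≈0 i)

      -- After scaling both factors to have coefficient 1 at X₁, the missing terms X₀X₁ and X₁X₂ say
      -- that the remaining coefficients of v are the negatives of those of u: the factors are X₁ +
      -- l and X₁ - l. If 2l were 0, they would be proportional.
      affine-case : ∀ {u v} → Factored u v → ¬ u 1F ≈ 0# → Found
      affine-case {u} {v} uv@(u≁v , f≈uv) u₁≉0 with v 1F ≟ 0#
      -- Only u₁v₀ and u₁v₂ remain of the two vanishing cross coefficients, so v would be 0, and f
      -- with it.
      ... | yes v₁≈0 = zero-factor (swapped uv) (λ { 0F → v₀≈0 ; 1F → v₁≈0 ; 2F → v₂≈0 })
        where
        v₀≈0 : v 0F ≈ 0#
        v₀≈0 = *-cancel-0 u₁≉0 (begin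
          u 1F * v 0F                  ≈⟨ +-identityˡ _ ⟨
          0# + u 1F * v 0F             ≈⟨ +-congʳ (zeroʳ′ (u 0F) v₁≈0) ⟨
          u 0F * v 1F + u 1F * v 0F    ≈⟨ f≈uv 1F ⟨
          f 1F                         ≈⟨ f₁≈0 ⟩
          0#                           ∎)
        v₂≈0 : v 2F ≈ 0#
        v₂≈0 = *-cancel-0 u₁≉0 (begin
          u 1F * v 2F                  ≈⟨ +-identityʳ _ ⟨
          u 1F * v 2F + 0#             ≈⟨ +-congˡ (zeroʳ′ (u 2F) v₁≈0) ⟨
          u 1F * v 2F + u 2F * v 1F    ≈⟨ f≈uv 4F ⟨
          f 4F                         ≈⟨ f₄≈0 ⟩
          0#                           ∎)
      ... | no v₁≉0 = inj₂ ((x , y) , 2≉0) , ∼-sym (k , *-nonzero u₁≉0 v₁≉0 , f≈)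
        where
        k = u 1F * v 1F
        x = proj₁ (divide u₁≉0 (u 0F))
        y = proj₁ (divide u₁≉0 (u 2F))
        u₀≈ = proj₂ (divide u₁≉0 (u 0F))
        u₂≈ = proj₂ (divide u₁≉0 (u 2F))
        v₀≈ : v 0F ≈ - (x * v 1F)
        v₀≈ = +≈0⇒≈- (*-cancel-0 u₁≉0 (begin
          u 1F * (x * v 1F + v 0F)
            ≈⟨ solve 4 (λ a x b c → a ⊗ (x ⊗ b ⊕ c) ⊜ a ⊗ x ⊗ b ⊕ a ⊗ c) (u 1F) x (v 1F) (v 0F) ⟩
          u 1F * x * v 1F + u 1F * v 0F    ≈⟨ +-congʳ (*-congʳ u₀≈) ⟨
          u 0F * v 1F + u 1F * v 0F        ≈⟨ f≈uv 1F ⟨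
          f 1F                             ≈⟨ f₁≈0 ⟩
          0#                               ∎))
        v₂≈ : v 2F ≈ - (y * v 1F)
        v₂≈ = +≈0⇒≈- (*-cancel-0 u₁≉0 (begin
          u 1F * (y * v 1F + v 2F)
            ≈⟨ solve 4 (λ a x b c → a ⊗ (x ⊗ b ⊕ c) ⊜ a ⊗ c ⊕ a ⊗ x ⊗ b) (u 1F) y (v 1F) (v 2F) ⟩
          u 1F * v 2F + u 1F * y * v 1F    ≈⟨ +-congˡ (*-congʳ u₂≈) ⟨
          u 1F * v 2F + u 2F * v 1F        ≈⟨ f≈uv 4F ⟨
          f 4F                             ≈⟨ f₄≈0 ⟩
          0#                               ∎))
        2≉0 : NotTwoTorsion (x , y)
        2≉0 (2x≈0 , 2y≈0) = u≁v (sameDirection 1F (x ∷ 1# ∷ y ∷ []) u₁≉0 v₁≉0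
          (λ { 0F → u₀≈ ; 1F → sym (*-identityʳ _) ; 2F → u₂≈ })
          (λ { 0F → trans v₀≈ (turn 2x≈0) ; 1F → sym (*-identityʳ _) ; 2F → trans v₂≈ (turn 2y≈0) }))
          where
          turn : ∀ {x} → x + x ≈ 0# → - (x * v 1F) ≈ v 1F * x
          turn {x} 2x≈0 = begin
            - (x * v 1F)   ≈⟨ solve 2 (λ x v → ⊝ (x ⊗ v) ⊜ v ⊗ ⊝ x) x (v 1F) ⟩
            v 1F * - x     ≈⟨ *-congˡ (x+x≈0⇒-x≈x 2x≈0) ⟩
            v 1F * x       ∎
        f≈ : ∀ i → f i ≈ k * affine-form 1# x y i
        f≈ = ∀₆
          ( trans (f≈uv 0F) (trans (*-cong u₀≈ v₀≈) (solve 3 (λ a b x → (a ⊗ x) ⊗ ⊝ (x ⊗ b)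
              ⊜ (a ⊗ b) ⊗ ⊝ (Κ (+ 1) ⊗ (x ⊗ x))) (u 1F) (v 1F) x))
          , trans f₁≈0 (sym (zeroʳ k))
          , trans (f≈uv 2F) (trans (+-cong (*-cong u₀≈ v₂≈) (*-cong u₂≈ v₀≈))
              (solve 4 (λ a b x y → (a ⊗ x) ⊗ ⊝ (y ⊗ b) ⊕ (a ⊗ y) ⊗ ⊝ (x ⊗ b)
                  ⊜ (a ⊗ b) ⊗ ⊝ (Κ (+ 1) ⊗ (x ⊗ y ⊕ x ⊗ y))) (u 1F) (v 1F) x y))
          , trans (f≈uv 3F) (sym (*-identityʳ k))
          , trans f₄≈0 (sym (zeroʳ k))
          , trans (f≈uv 5F) (trans (*-cong u₂≈ v₂≈) (solve 3 (λ a b x → (a ⊗ x) ⊗ ⊝ (x ⊗ b)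
              ⊜ (a ⊗ b) ⊗ ⊝ (Κ (+ 1) ⊗ (x ⊗ x))) (u 1F) (v 1F) y))
          )

      infinite-case : ∀ {u v} → Factored u v → u 0F ≈ 0# → u 1F ≈ 0# → ¬ v 0F ≈ 0# → v 1F ≈ 0# → Found
      infinite-case {u} {v} uv@(u≁v , f≈uv) u₀≈0 u₁≈0 v₀≉0 v₁≈0 with u 2F ≟ 0#
      ... | yes u₂≈0 = zero-factor uv (λ { 0F → u₀≈0 ; 1F → u₁≈0 ; 2F → u₂≈0 })
      ... | no  u₂≉0 = inj₁ (inj₂ (inj₁ t)) , ∼-sym (k , *-nonzero u₂≉0 v₀≉0 , ∀₆
          ( trans (f≈uv 0F) (trans (zeroˡ′ _ u₀≈0) (sym (zeroʳ k)))
          , trans f₁≈0 (sym (zeroʳ k))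
          , trans (f≈uv 2F) (trans (+-congʳ (zeroˡ′ _ u₀≈0)) (trans (+-identityˡ _) (sym (*-identityʳ k))))
          , trans (f≈uv 3F) (trans (zeroˡ′ _ u₁≈0) (sym (zeroʳ k)))
          , trans f₄≈0 (sym (zeroʳ k))
          , trans (f≈uv 5F) (trans (*-congˡ v₂≈) (sym (*-assoc _ _ _)))
          ))
        where
        k = u 2F * v 0F
        t = proj₁ (divide v₀≉0 (v 2F))
        v₂≈ = proj₂ (divide v₀≉0 (v 2F))

      split-case : ∀ {u v} → Factored u v → u 1F ≈ 0# → v 1F ≈ 0# → ¬ u 0F ≈ 0# → ¬ v 0F ≈ 0# → Found
      split-case {u} {v} uv@(u≁v , f≈uv) u₁≈0 v₁≈0 u₀≉0 v₀≉0 =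
        inj₁ (inj₁ ((t , t′) , t≉t′)) , ∼-sym (k , *-nonzero u₀≉0 v₀≉0 , ∀₆
          ( trans (f≈uv 0F) (sym (*-identityʳ k))
          , trans f₁≈0 (sym (zeroʳ k))
          , trans (f≈uv 2F) (trans (+-cong (*-congˡ v₂≈) (*-congʳ u₂≈))
              (solve 4 (λ a b t t′ → a ⊗ (b ⊗ t′) ⊕ a ⊗ t ⊗ b ⊜ (a ⊗ b) ⊗ (t ⊕ t′)) (u 0F) (v 0F) t t′))
          , trans (f≈uv 3F) (trans (zeroˡ′ _ u₁≈0) (sym (zeroʳ k)))
          , trans f₄≈0 (sym (zeroʳ k))
          , trans (f≈uv 5F) (trans (*-cong u₂≈ v₂≈)
              (solve 4 (λ a b t t′ → (a ⊗ t) ⊗ (b ⊗ t′) ⊜ (a ⊗ b) ⊗ (t ⊗ t′)) (u 0F) (v 0F) t t′))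
          ))
        where
        k = u 0F * v 0F
        t = proj₁ (divide u₀≉0 (u 2F))
        t′ = proj₁ (divide v₀≉0 (v 2F))
        u₂≈ = proj₂ (divide u₀≉0 (u 2F))
        v₂≈ = proj₂ (divide v₀≉0 (v 2F))
        t≉t′ : ¬ t ≈ t′
        t≉t′ t≈t′ = u≁v (sameDirection 0F (1# ∷ 0# ∷ t′ ∷ []) u₀≉0 v₀≉0
          (λ { 0F → sym (*-identityʳ _) ; 1F → trans u₁≈0 (sym (zeroʳ _)) ; 2F → trans u₂≈ (*-congˡ t≈t′) })
          (λ { 0F → sym (*-identityʳ _) ; 1F → trans v₁≈0 (sym (zeroʳ _)) ; 2F → v₂≈ }))

      double-infinite : ∀ {u v} → Factored u v → u 0F ≈ 0# → u 1F ≈ 0# → v 0F ≈ 0# → v 1F ≈ 0# → Found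
      double-infinite {u} {v} uv@(u≁v , f≈uv) u₀≈0 u₁≈0 v₀≈0 v₁≈0 with u 2F ≟ 0# | v 2F ≟ 0#
      ... | yes u₂≈0 | _ = zero-factor uv (λ { 0F → u₀≈0 ; 1F → u₁≈0 ; 2F → u₂≈0 })
      ... | _ | yes v₂≈0 = zero-factor (swapped uv) (λ { 0F → v₀≈0 ; 1F → v₁≈0 ; 2F → v₂≈0 })
      ... | no u₂≉0 | no v₂≉0 = contradiction (sameDirection 2F (0# ∷ 0# ∷ 1# ∷ []) u₂≉0 v₂≉0
          (λ { 0F → trans u₀≈0 (sym (zeroʳ _)) ; 1F → trans u₁≈0 (sym (zeroʳ _)) ; 2F → sym (*-identityʳ _) })
          (λ { 0F → trans v₀≈0 (sym (zeroʳ _)) ; 1F → trans v₁≈0 (sym (zeroʳ _)) ; 2F → sym (*-identityʳ _) })) u≁v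

    factor : ∀ u v → ¬ Proportional F u v → (∀ i → f i ≈ product F u v i) → Found
    factor u v u≁v f≈uv with u 1F ≟ 0# | v 1F ≟ 0# | u 0F ≟ 0# | v 0F ≟ 0#
    ... | no u₁≉0  | _        | _        | _        = affine-case (u≁v , f≈uv) u₁≉0
    ... | yes _    | no v₁≉0  | _        | _        = affine-case (swapped (u≁v , f≈uv)) v₁≉0
    ... | yes u₁≈0 | yes v₁≈0 | yes u₀≈0 | yes v₀≈0 = double-infinite (u≁v , f≈uv) u₀≈0 u₁≈0 v₀≈0 v₁≈0
    ... | yes u₁≈0 | yes v₁≈0 | yes u₀≈0 | no v₀≉0  = infinite-case (u≁v , f≈uv) u₀≈0 u₁≈0 v₀≉0 v₁≈0
    ... | yes u₁≈0 | yes v₁≈0 | no u₀≉0  | yes v₀≈0 = infinite-case (swapped (u≁v , f≈uv)) v₀≈0 v₁≈0 u₀≉0 u₁≈0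
    ... | yes u₁≈0 | yes v₁≈0 | no u₀≉0  | no v₀≉0  = split-case (u≁v , f≈uv) u₁≈0 v₁≈0 u₀≉0 v₀≉0

  -- `k` counts ordered pairs of distinct finite points of PG(1,q), `q + q` the pairs with the point
  -- at infinity in either order, and `b` the affine factorizations.
  ℋ₂ᵣ-size : ∀ {b} → HasSize (plane ∣ₛ NotTwoTorsion) b →
    ∃₂ λ m k → HasSize Target m × q ℕ.+ k ≡ q ℕ.* q × m ℕ.+ m ≡ (k ℕ.+ (q ℕ.+ q)) ℕ.+ b
  ℋ₂ᵣ-size b-size =
    let k , k-size , q+k≡q² = distinctPairs-size
        m , m-size , m+m≡ = FreeInvolution.sizeByFolding exchange {X = Target}
          (size-⊎ (size-⊎ k-size (size-⊎ order order)) b-size)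
          hyperplane
          (λ {e} {e′} e≈e′ → GL₃Action.∼-of-≈ F (form-cong e≈e′))
          (λ e → GL₃Action.∼-of-≈ F (form-τ e))
          (λ {e} {e′} → form-injective e e′)
          (λ ((f , f≉0) , (u , v , u≁v , f≈uv) , f₁≈0 , f₄≈0) → factor f≉0 f₁≈0 f₄≈0 u v u≁v f≈uv)
    in m , k , m-size , q+k≡q² , m+m≡

-- Pairs of conjugate imaginary lines

module ImaginaryPairsCount {q c ℓ c′ ℓ′} (F : FiniteField q c ℓ) (𝔼 : QuadraticExtension F c′ ℓ′) where
  private
    module F = FiniteField F
    module Fₚ = FieldProperties F
    module E = QuadraticExtension 𝔼
    module Eₚ = FieldProperties E.extension
    module Eₙ = NormalForms E.extension
    module Q = QuadraticForms E.rawRing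
  open import Data.Vec.Functional using ([]; _∷_)
  open Conjugation F 𝔼
  open NormalForms F
  open E using (ι; hom; _≈_; _+_; _*_; -_; _-_; 0#; 1#; refl; sym; trans; +-cong; +-congˡ; +-congʳ; *-cong; *-congˡ; *-congʳ; -‿cong)
  open RingMorphisms.IsRingHomomorphism hom
  open Solver E.commutativeRing using (solve)
  open import Relation.Binary.Reasoning.Setoid E.setoid

  private
    Target = Normal F (ℋ₂ᵢ F 𝔼)
    module T = Setoid Target

  conjugatePairs : Setoid _ _
  conjugatePairs = ⊎-setoid (E.setoid ∣ₛ ∁ Base) (plane ∣ₛ NotTwoTorsion)

  exchange : FreeInvolution conjugatePairs
  exchange = ⊎-free (record
    { τ            = λ (z , z∉) → conj z , λ (a , ιa≈z̄) → z∉ (a , (begin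
        ι a             ≈⟨ conj-ι a ⟨
        conj (ι a)      ≈⟨ conj-cong ιa≈z̄ ⟩
        conj (conj z)   ≈⟨ conj-involutive z ⟩
        z               ∎))
    ; τ-cong       = conj-cong
    ; τ-involutive = λ (z , _) → conj-involutive z
    ; τ-free       = λ (z , z∉) z̄≈z → z∉ (fixed⇒Base z̄≈z)
    }) negation

  open FreeInvolution exchange using (τ; _≈τ_)
  private
    module C = Setoid conjugatePairs

  trace norm : E.Carrier → F.Carrier
  trace z = proj₁ (trace∈Base z)
  norm z = proj₁ (norm∈Base z)

  ι-trace : ∀ z → ι (trace z) ≈ z + conj z
  ι-trace z = proj₂ (trace∈Base z)

  ι-norm : ∀ z → ι (norm z) ≈ z * conj z
  ι-norm z = proj₂ (norm∈Base z)

  D : F.Carrier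
  D = proj₁ δ²∈Base

  ι-D : ι D ≈ δ * δ
  ι-D = proj₂ δ²∈Base

  D≉0 : ¬ D F.≈ F.0#
  D≉0 D≈0 = δ≉0 (Eₚ.square-zero (trans (sym ι-D) (trans (⟦⟧-cong D≈0) 0#-homo)))

  form : C.Carrier → Vector F.Carrier 6
  form (inj₁ (z , _))       = split-form (trace z) (norm z)
  form (inj₂ ((x , y) , _)) = affine-form D x y

  form-cong : ∀ {e e′} → e C.≈ e′ → ∀ i → form e i F.≈ form e′ i
  form-cong (inj₁ {z , _} {w , _} z≈w) = quad-cong F.refl
    (ι-injective (trans (ι-trace z) (trans (+-cong z≈w (conj-cong z≈w)) (sym (ι-trace w)))))
    F.refl
    (ι-injective (trans (ι-norm z) (trans (*-cong z≈w (conj-cong z≈w)) (sym (ι-norm w)))))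
  form-cong (inj₂ (p , r)) = affine-cong D p r

  form-τ : ∀ e i → form (τ e) i F.≈ form e i
  form-τ (inj₁ (z , _)) = quad-cong F.refl
    (ι-injective (begin
      ι (trace (conj z))         ≈⟨ ι-trace (conj z) ⟩
      conj z + conj (conj z)     ≈⟨ +-congˡ (conj-involutive z) ⟩
      conj z + z                 ≈⟨ E.+-comm _ _ ⟩
      z + conj z                 ≈⟨ ι-trace z ⟨
      ι (trace z)                ∎))
    F.refl
    (ι-injective (begin
      ι (norm (conj z))          ≈⟨ ι-norm (conj z) ⟩
      conj z * conj (conj z)     ≈⟨ *-congˡ (conj-involutive z) ⟩
      conj z * z                 ≈⟨ E.*-comm _ _ ⟩
      z * conj z                 ≈⟨ ι-norm z ⟨
      ι (norm z)                 ∎))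
  form-τ (inj₂ ((x , y) , _)) = affine-neg D x y

  form-injective : ∀ e e′ → Proportional F (form e) (form e′) → e ≈τ e′
  form-injective (inj₁ (z , _)) (inj₁ (w , _)) f∼g = Sum.map (λ (z≈w , _) → inj₁ z≈w) (λ (z≈w̄ , _) → inj₁ z≈w̄)
    (Eₚ.sameFactors
      (trans (sym (ι-trace z)) (trans (⟦⟧-cong (∼⇒≈ f∼g 0F F.refl F.refl 2F)) (ι-trace w)))
      (trans (sym (ι-norm z)) (trans (⟦⟧-cong (∼⇒≈ f∼g 0F F.refl F.refl 5F)) (ι-norm w))))
  form-injective (inj₂ _) (inj₂ _) f∼g = Sum.map inj₂ inj₂
    (affine-injective D≉0 (∼⇒≈ f∼g 3F F.refl F.refl 0F) (∼⇒≈ f∼g 3F F.refl F.refl 2F) (∼⇒≈ f∼g 3F F.refl F.refl 5F))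
  form-injective (inj₁ _) (inj₂ _) f∼g = contradiction (∼-zeroˡ f∼g 3F F.refl) F.1≉0
  form-injective (inj₂ _) (inj₁ _) f∼g = contradiction (∼-zeroʳ f∼g 3F F.refl) F.1≉0

  private
    Member : Vector F.Carrier 6 → Set _
    Member f = ¬ (∀ i → f i F.≈ F.0#)
      × ((f≉0 : ¬ (∀ i → f i F.≈ F.0#)) → (f , f≉0) ∈ ℋ₂ᵢ F 𝔼)
      × f 1F F.≈ F.0# × f 4F F.≈ F.0#

    ι1* : ∀ {a b} → a ≈ b → a ≈ ι F.1# * b
    ι1* a≈b = trans a≈b (trans (sym (E.*-identityˡ _)) (*-congʳ (sym 1#-homo)))

  split-member : ∀ {z} → ¬ Base z → Member (split-form (trace z) (norm z))
  split-member {z} z∉ =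
      (λ f≈0 → F.1≉0 (f≈0 0F))
    , (λ _ → conjugation , F.1# , u , F.1≉0
      , (λ (b , _ , u≈bū) →
          let b≈1 = trans (sym (E.*-identityʳ b)) (trans (*-congˡ (sym conj-1)) (sym (u≈bū 0F)))
          in z∉ (fixed⇒Base (sym (trans (u≈bū 2F) (trans (*-congʳ b≈1) (E.*-identityˡ _))))))
      , ∀₆ ( ι1* (trans 1#-homo (trans (sym (E.*-identityˡ _)) (*-congˡ (sym conj-1))))
           , ι1* (trans 0#-homo (sym (trans (+-cong (trans (E.*-identityˡ _) conj-0) (E.zeroˡ _)) (E.+-identityˡ 0#))))
           , ι1* (trans (ι-trace z) (trans (E.+-comm _ _) (+-cong (sym (E.*-identityˡ _)) (trans (sym (E.*-identityʳ z)) (*-congˡ (sym conj-1))))))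
           , ι1* (trans 0#-homo (sym (E.zeroˡ _)))
           , ι1* (trans 0#-homo (sym (trans (+-cong (E.zeroˡ _) (trans (*-congˡ conj-0) (E.zeroʳ z))) (E.+-identityˡ 0#))))
           , ι1* (ι-norm z) ))
    , F.refl , F.refl
    where
    u : Vector E.Carrier 3
    u = 1# ∷ 0# ∷ z ∷ []

  conj-δι : ∀ x → conj (δ * ι x) ≈ - (δ * ι x)
  conj-δι x = begin
    conj (δ * ι x)        ≈⟨ conj-* δ (ι x) ⟩
    conj δ * conj (ι x)   ≈⟨ *-cong conj-δ (conj-ι x) ⟩
    - δ * ι x             ≈⟨ solve 2 (λ d x → ⊝ d ⊗ x ⊜ ⊝ (d ⊗ x)) δ (ι x) ⟩
    - (δ * ι x)           ∎

  δι-torsion : ∀ x → δ * ι x + δ * ι x ≈ 0# → x F.+ x F.≈ F.0#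
  δι-torsion x e = ι-zero (Eₚ.*-cancel-0 δ≉0 (begin
    δ * ι (x F.+ x)         ≈⟨ *-congˡ (+-homo x x) ⟩
    δ * (ι x + ι x)         ≈⟨ E.distribˡ δ (ι x) (ι x) ⟩
    δ * ι x + δ * ι x       ≈⟨ e ⟩
    0#                      ∎))

  ι-square : ∀ x → ι (F.- (D F.* (x F.* x))) ≈ δ * ι x * - (δ * ι x)
  ι-square x = begin
    ι (F.- (D F.* (x F.* x)))   ≈⟨ -‿homo _ ⟩
    - ι (D F.* (x F.* x))       ≈⟨ -‿cong (trans (*-homo _ _) (*-cong ι-D (*-homo x x))) ⟩
    - (δ * δ * (ι x * ι x))     ≈⟨ solve 2 (λ d x → ⊝ (d ⊗ d ⊗ (x ⊗ x)) ⊜ d ⊗ x ⊗ ⊝ (d ⊗ x)) δ (ι x) ⟩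
    δ * ι x * - (δ * ι x)       ∎

  ι-cross : ∀ x y → ι (F.- (D F.* (x F.* y F.+ x F.* y))) ≈ δ * ι x * - (δ * ι y) + δ * ι y * - (δ * ι x)
  ι-cross x y = begin
    ι (F.- (D F.* (x F.* y F.+ x F.* y)))     ≈⟨ -‿homo _ ⟩
    - ι (D F.* (x F.* y F.+ x F.* y))
      ≈⟨ -‿cong (trans (*-homo _ _) (*-cong ι-D (trans (+-homo _ _) (+-cong (*-homo x y) (*-homo x y))))) ⟩
    - (δ * δ * (ι x * ι y + ι x * ι y))
      ≈⟨ solve 3 (λ d x y → ⊝ (d ⊗ d ⊗ (x ⊗ y ⊕ x ⊗ y))
          ⊜ d ⊗ x ⊗ ⊝ (d ⊗ y) ⊕ d ⊗ y ⊗ ⊝ (d ⊗ x)) δ (ι x) (ι y) ⟩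
    δ * ι x * - (δ * ι y) + δ * ι y * - (δ * ι x) ∎

  affine-member : ∀ {x y} → NotTwoTorsion (x , y) → Member (affine-form D x y)
  affine-member {x} {y} 2≉0 =
      (λ f≈0 → F.1≉0 (f≈0 3F))
    , (λ _ → conjugation , F.1# , u , F.1≉0
      , (λ (b , _ , u≈bū) →
          let b≈1 = trans (sym (E.*-identityʳ b)) (trans (*-congˡ (sym conj-1)) (sym (u≈bū 1F)))
              torsion : ∀ x → δ * ι x ≈ b * conj (δ * ι x) → x F.+ x F.≈ F.0#
              torsion x e = δι-torsion x (trans (+-congʳ (trans e (trans (*-cong b≈1 (conj-δι x)) (E.*-identityˡ _)))) (E.-‿inverseˡ _))
          in 2≉0 (torsion x (u≈bū 0F) , torsion y (u≈bū 2F)))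
      , ∀₆ ( ι1* (trans (ι-square x) (*-congˡ (sym (conj-δι x))))
           , ι1* (trans 0#-homo (sym (trans (+-cong (*-congˡ conj-1) (*-congˡ (conj-δι x))) (solve 1 (λ x → x ⊗ Κ (+ 1) ⊕ Κ (+ 1) ⊗ ⊝ x
               ⊜ Κ (+ 0)) (δ * ι x)))))
           , ι1* (trans (ι-cross x y) (+-cong (*-congˡ (sym (conj-δι y))) (*-congˡ (sym (conj-δι x)))))
           , ι1* (trans 1#-homo (trans (sym (E.*-identityˡ _)) (*-congˡ (sym conj-1))))
           , ι1* (trans 0#-homo (sym (trans (+-cong (*-congˡ (conj-δι y)) (*-congˡ conj-1)) (solve 1 (λ x → Κ (+ 1) ⊗ ⊝ x ⊕ x ⊗ Κ (+ 1)
               ⊜ Κ (+ 0)) (δ * ι y)))))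
           , ι1* (trans (ι-square y) (*-congˡ (sym (conj-δι y)))) ))
    , F.refl , F.refl
    where
    u : Vector E.Carrier 3
    -- The conjugate of X₁ + δl is X₁ - δl, and their product X₁² - δ²l² has coefficients in F.
    u = δ * ι x ∷ 1# ∷ δ * ι y ∷ []

  member : ∀ e → Member (form e)
  member (inj₁ (_ , z∉))  = split-member z∉
  member (inj₂ (_ , 2≉0)) = affine-member 2≉0

  hyperplane : C.Carrier → T.Carrier
  hyperplane e = let f≉0 , f∈ , n = member e in (form e , f≉0) , f∈ f≉0 , n

  conjᵛ : Vector E.Carrier 3 → Vector E.Carrier 3
  conjᵛ u i = conj (u i)

  module _ {f : Vector F.Carrier 6} (f≉0 : ¬ (∀ i → f i F.≈ F.0#)) (f₁≈0 : f 1F F.≈ F.0#) (f₄≈0 : f 4F F.≈ F.0#)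
           {a : F.Carrier} (a≉0 : ¬ a F.≈ F.0#) {u : Vector E.Carrier 3}
           (u≁ū : ¬ Proportional E.extension u (conjᵛ u)) (ιf≈ : ∀ i → ι (f i) ≈ ι a * Q.linearProduct u (conjᵛ u) i) where
    private
      Found : Set _
      Found = ∃ λ e → Proportional F (form e) f

      ιa≉0 : ¬ ι a ≈ 0#
      ιa≉0 ιa≈0 = a≉0 (ι-zero ιa≈0)

      conj≉0 : ∀ {z} → ¬ z ≈ 0# → ¬ conj z ≈ 0#
      conj≉0 {z} z≉0 z̄≈0 = z≉0 (trans (sym (conj-involutive z)) (trans (conj-cong z̄≈0) conj-0))

      -- If u = uᵢw with w fixed by conjugation, the conjugate of u is also a multiple of w, so u
      -- would be proportional to its conjugate. Each exclusion of a real line below exhibits such a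
      -- w.
      not-real : ∀ i (w : Vector E.Carrier 3) → ¬ u i ≈ 0# → (∀ j → u j ≈ u i * w j) → ¬ (∀ j → conj (w j) ≈ w j)
      not-real i w uᵢ≉0 u≈ w-fixed = u≁ū (Eₙ.sameDirection i w uᵢ≉0 (conj≉0 uᵢ≉0) u≈
        λ j → trans (conj-cong (u≈ j)) (trans (conj-* _ _) (*-congˡ (w-fixed j))))

      -- The ratio of a coefficient of f to the normalizing one is computed in the extension;
      -- injectivity of `ι` brings the equation back to F.
      scale : ∀ {k l m x} → ι k ≈ m → ι l ≈ m * x → ∀ {y} → ι y ≈ x → l F.≈ k F.* y
      scale ιk≈m ιl≈mx ιy≈x = ι-injective (trans ιl≈mx (trans (*-cong (sym ιk≈m) (sym ιy≈x)) (sym (*-homo _ _))))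

      zero-case : u 0F ≈ 0# → u 1F ≈ 0# → Found
      zero-case u₀≈0 u₁≈0 with u 2F Eₚ.≟ 0#
      ... | no  u₂≉0 = contradiction
        (λ { 0F → conj-0 ; 1F → conj-0 ; 2F → conj-1 })
        (not-real 2F (0# ∷ 0# ∷ 1# ∷ []) u₂≉0
          (λ { 0F → trans u₀≈0 (sym (E.zeroʳ _)) ; 1F → trans u₁≈0 (sym (E.zeroʳ _)) ; 2F → sym (E.*-identityʳ _) }))
      ... | yes u₂≈0 = contradiction (1# , E.1≉0 , λ
        { 0F → zero u₀≈0 ; 1F → zero u₁≈0 ; 2F → zero u₂≈0 }) u≁ū
        where
        zero : ∀ {z} → z ≈ 0# → z ≈ 1# * conj z
        zero z≈0 = trans z≈0 (sym (trans (E.*-identityˡ _) (trans (conj-cong z≈0) conj-0)))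

      -- Division by u₀ leaves X₀ + zX₂, where z is outside F because the line is not real. The
      -- scalar is f₀, which is a times the norm of u₀.
      split-case : u 1F ≈ 0# → ¬ u 0F ≈ 0# → Found
      split-case u₁≈0 u₀≉0 = inj₁ (z , z∉) , ∼-sym (f 0F , f₀≉0 , ∀₆
          ( F.sym (F.*-identityʳ _)
          , F.trans f₁≈0 (F.sym (F.zeroʳ _))
          , scale (ιf≈ 0F) (trans (ιf≈ 2F) (begin
              ι a * (u 0F * conj (u 2F) + u 2F * conj (u 0F))
                ≈⟨ *-congˡ (+-cong (*-congˡ ū₂≈) (*-congʳ u₂≈)) ⟩
              ι a * (u 0F * (conj (u 0F) * conj z) + u 0F * z * conj (u 0F))
                ≈⟨ solve 5 (λ a u v z w → a ⊗ (u ⊗ (v ⊗ w) ⊕ u ⊗ z ⊗ v)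
                    ⊜ a ⊗ (u ⊗ v) ⊗ (z ⊕ w)) (ι a) (u 0F) (conj (u 0F)) z (conj z) ⟩
              ι a * (u 0F * conj (u 0F)) * (z + conj z) ∎)) (ι-trace z)
          , scale (ιf≈ 0F) (trans (ιf≈ 3F) (trans (*-congˡ (trans (*-congʳ u₁≈0) (E.zeroˡ _))) (trans (E.zeroʳ _) (sym (E.zeroʳ _))))) 0#-homo
          , F.trans f₄≈0 (F.sym (F.zeroʳ _))
          , scale (ιf≈ 0F) (trans (ιf≈ 5F) (begin
              ι a * (u 2F * conj (u 2F))
                ≈⟨ *-congˡ (*-cong u₂≈ ū₂≈) ⟩
              ι a * (u 0F * z * (conj (u 0F) * conj z))
                ≈⟨ solve 5 (λ a u v z w → a ⊗ (u ⊗ z ⊗ (v ⊗ w))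
                    ⊜ a ⊗ (u ⊗ v) ⊗ (z ⊗ w)) (ι a) (u 0F) (conj (u 0F)) z (conj z) ⟩
              ι a * (u 0F * conj (u 0F)) * (z * conj z) ∎)) (ι-norm z)
          ))
        where
        z = proj₁ (Eₚ.divide u₀≉0 (u 2F))
        u₂≈ = proj₂ (Eₚ.divide u₀≉0 (u 2F))
        ū₂≈ : conj (u 2F) ≈ conj (u 0F) * conj z
        ū₂≈ = trans (conj-cong u₂≈) (conj-* _ _)
        z∉ : ¬ Base z
        z∉ (b , ιb≈z) = not-real 0F (1# ∷ 0# ∷ z ∷ []) u₀≉0
          (λ { 0F → sym (E.*-identityʳ _) ; 1F → trans u₁≈0 (sym (E.zeroʳ _)) ; 2F → u₂≈ })
          (λ { 0F → conj-1 ; 1F → conj-0 ; 2F → trans (conj-cong (sym ιb≈z)) (trans (conj-ι b) ιb≈z) })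
        f₀≉0 : ¬ f 0F F.≈ F.0#
        f₀≉0 f₀≈0 = Eₚ.*-nonzero ιa≉0 (Eₚ.*-nonzero u₀≉0 (conj≉0 u₀≉0))
          (trans (sym (ιf≈ 0F)) (trans (⟦⟧-cong f₀≈0) 0#-homo))

      -- The missing terms X₀X₁ and X₁X₂ say that u₀/u₁ and u₂/u₁ are the negatives of their
      -- conjugates, hence multiples of δ by elements of F. Division by u₁ leaves X₁ + δl.
      affine-case : ¬ u 1F ≈ 0# → Found
      affine-case u₁≉0 = inj₂ ((x , y) , 2≉0) , ∼-sym (f 3F , f₃≉0 , ∀₆
          ( scale (ιf≈ 3F) (trans (ιf≈ 0F) (trans (*-congˡ (*-cong u₀≈ ū₀≈))
              (solve 4 (λ a u v x → a ⊗ (u ⊗ x ⊗ (v ⊗ ⊝ x))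
                  ⊜ a ⊗ (u ⊗ v) ⊗ (x ⊗ ⊝ x)) (ι a) (u 1F) (conj (u 1F)) (δ * ι x)))) (ι-square x)
          , F.trans f₁≈0 (F.sym (F.zeroʳ _))
          , scale (ιf≈ 3F) (trans (ιf≈ 2F) (trans (*-congˡ (+-cong (*-cong u₀≈ ū₂≈) (*-cong u₂≈ ū₀≈)))
              (solve 5 (λ a u v x y → a ⊗ (u ⊗ x ⊗ (v ⊗ ⊝ y) ⊕ u ⊗ y ⊗ (v ⊗ ⊝ x))
                  ⊜ a ⊗ (u ⊗ v) ⊗ (x ⊗ ⊝ y ⊕ y ⊗ ⊝ x)) (ι a) (u 1F) (conj (u 1F)) (δ * ι x) (δ * ι y)))) (ι-cross x y)
          , F.sym (F.*-identityʳ _)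
          , F.trans f₄≈0 (F.sym (F.zeroʳ _))
          , scale (ιf≈ 3F) (trans (ιf≈ 5F) (trans (*-congˡ (*-cong u₂≈ ū₂≈))
              (solve 4 (λ a u v x → a ⊗ (u ⊗ x ⊗ (v ⊗ ⊝ x))
                  ⊜ a ⊗ (u ⊗ v) ⊗ (x ⊗ ⊝ x)) (ι a) (u 1F) (conj (u 1F)) (δ * ι y)))) (ι-square y)
          ))
        where
        ū₁≉0 = conj≉0 u₁≉0
        f₃≉0 : ¬ f 3F F.≈ F.0#
        f₃≉0 f₃≈0 = Eₚ.*-nonzero ιa≉0 (Eₚ.*-nonzero u₁≉0 ū₁≉0)
          (trans (sym (ιf≈ 3F)) (trans (⟦⟧-cong f₃≈0) 0#-homo))
        skew : ∀ {v} (let z = proj₁ (Eₚ.divide u₁≉0 v)) → v * conj (u 1F) + u 1F * conj v ≈ 0# → conj z ≈ - z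
        skew {v} e = let z , v≈u₁z = Eₚ.divide u₁≉0 v in
          Eₚ.+≈0⇒≈- (Eₚ.*-cancel-0 (Eₚ.*-nonzero u₁≉0 ū₁≉0) (begin
            u 1F * conj (u 1F) * (z + conj z)
              ≈⟨ solve 4 (λ u v z w → u ⊗ v ⊗ (z ⊕ w)
                  ⊜ u ⊗ z ⊗ v ⊕ u ⊗ (v ⊗ w)) (u 1F) (conj (u 1F)) z (conj z) ⟩
            u 1F * z * conj (u 1F) + u 1F * (conj (u 1F) * conj z)
              ≈⟨ +-cong (*-congʳ v≈u₁z) (*-congˡ (trans (conj-cong v≈u₁z) (conj-* _ _))) ⟨
            v * conj (u 1F) + u 1F * conj v
              ≈⟨ e ⟩
            0# ∎))
        on-axis : ∀ i → f i F.≈ F.0# → Q.linearProduct u (conjᵛ u) i ≈ 0#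
        on-axis i fi≈0 = Eₚ.*-cancel-0 ιa≉0 (trans (sym (ιf≈ i)) (trans (⟦⟧-cong fi≈0) 0#-homo))
        component₀ = skew⇒multiple (skew (on-axis 1F f₁≈0))
        component₂ = skew⇒multiple (skew (trans (E.+-comm _ _) (on-axis 4F f₄≈0)))
        x = proj₁ component₀
        y = proj₁ component₂
        u₀≈ : u 0F ≈ u 1F * (δ * ι x)
        u₀≈ = trans (proj₂ (Eₚ.divide u₁≉0 (u 0F))) (*-congˡ (proj₂ component₀))
        u₂≈ : u 2F ≈ u 1F * (δ * ι y)
        u₂≈ = trans (proj₂ (Eₚ.divide u₁≉0 (u 2F))) (*-congˡ (proj₂ component₂))
        ū₀≈ : conj (u 0F) ≈ conj (u 1F) * - (δ * ι x)
        ū₀≈ = trans (conj-cong u₀≈) (trans (conj-* _ _) (*-congˡ (conj-δι x)))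
        ū₂≈ : conj (u 2F) ≈ conj (u 1F) * - (δ * ι y)
        ū₂≈ = trans (conj-cong u₂≈) (trans (conj-* _ _) (*-congˡ (conj-δι y)))
        2≉0 : NotTwoTorsion (x , y)
        2≉0 (2x≈0 , 2y≈0) = not-real 1F (δ * ι x ∷ 1# ∷ δ * ι y ∷ []) u₁≉0
          (λ { 0F → u₀≈ ; 1F → sym (E.*-identityʳ _) ; 2F → u₂≈ })
          (λ { 0F → fixed 2x≈0 ; 1F → conj-1 ; 2F → fixed 2y≈0 })
          where
          fixed : ∀ {x} → x F.+ x F.≈ F.0# → conj (δ * ι x) ≈ δ * ι x
          fixed {x} 2x≈0 = trans (conj-δι x) (Eₙ.x+x≈0⇒-x≈x (begin
            δ * ι x + δ * ι x    ≈⟨ E.distribˡ δ (ι x) (ι x) ⟨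
            δ * (ι x + ι x)      ≈⟨ *-congˡ (trans (sym (+-homo x x)) (trans (⟦⟧-cong 2x≈0) 0#-homo)) ⟩
            δ * 0#               ≈⟨ E.zeroʳ δ ⟩
            0#                   ∎))

    factor-conj : Found
    factor-conj with u 1F Eₚ.≟ 0# | u 0F Eₚ.≟ 0#
    ... | no  u₁≉0 | _        = affine-case u₁≉0
    ... | yes u₁≈0 | no u₀≉0  = split-case u₁≈0 u₀≉0
    ... | yes u₁≈0 | yes u₀≈0 = zero-case u₀≈0 u₁≈0

  -- The automorphism in the definition of the class cannot be the identity, which would make u
  -- equal to its conjugate; so it acts as `conj`.
  factor : ∀ (H : Hyperplane F) → H ∈ ℋ₂ᵢ F 𝔼 → H ∈ ContainsRepresentative F →
           ∃ λ e → Proportional F (form e) (proj₁ H)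
  factor (f , f≉0) (𝓈 , a , u , a≉0 , u≁ū , ιf≈) (f₁≈0 , f₄≈0) = Sum.[
    (λ σ≈id → contradiction (1# , E.1≉0 , λ i → sym (trans (E.*-identityˡ _) (σ≈id (u i)))) u≁ū)
    , (λ σ≈conj → factor-conj {f} f≉0 f₁≈0 f₄≈0 a≉0 {u}
        (λ (b , b≉0 , e) → u≁ū (b , b≉0 , λ i → trans (e i) (*-congˡ (sym (σ≈conj (u i))))))
        (λ i → trans (ιf≈ i) (*-congˡ (FormIdentities.product-cong E.commutativeRing {u} (λ _ → refl) (λ j → σ≈conj (u j)) i))))
    ] (identity-or-conjugation 𝓈)

  -- `k` counts the elements outside the base field, each occurring along with its conjugate, and
  -- `b` the linear forms l, each along with -l.
  ℋ₂ᵢ-size : ∀ {b} → HasSize (plane ∣ₛ NotTwoTorsion) b →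
    ∃₂ λ m k → HasSize Target m × q ℕ.+ k ≡ q ℕ.^ 2 × m ℕ.+ m ≡ k ℕ.+ b
  ℋ₂ᵢ-size b-size =
    let k , k-size , q+k≡q² = nonBase-size
        m , m-size , m+m≡ = FreeInvolution.sizeByFolding exchange {X = Target}
          (size-⊎ k-size b-size)
          hyperplane
          (λ {e} {e′} e≈e′ → GL₃Action.∼-of-≈ F (form-cong e≈e′))
          (λ e → GL₃Action.∼-of-≈ F (form-τ e))
          (λ {e} {e′} → form-injective e e′)
          (λ (H , H∈ℋ , H∈N) → factor H H∈ℋ H∈N)
    in m , k , m-size , q+k≡q² , m+m≡

-- Double lines and non-singular conics

module Counts {q ℓ₁ ℓ₂} (F : FiniteField q ℓ₁ ℓ₂) where
  open import Data.Vec.Functional using ([]; _∷_)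
  open FiniteField F
  open FieldProperties F
  open NormalForms F
  open Solver commutativeRing using (solve)
  open QuadraticForms rawRing
  open FormIdentities commutativeRing
  open import Relation.Binary.Reasoning.Setoid setoid

  double-zero : ¬ 1# + 1# ≈ 0# → ∀ {x} → x + x ≈ 0# → x ≈ 0#
  double-zero 2≉0 {x} x+x≈0 = *-cancel-0 2≉0 (trans (sym (double x)) x+x≈0)

  notTwoTorsion-odd : ¬ 1# + 1# ≈ 0# → ∃ λ k → HasSize (plane ∣ₛ NotTwoTorsion) k × ℕ.suc k ≡ q ℕ.* q
  notTwoTorsion-odd 2≉0 =
    let k , size , 1+k≡q² = punctured-size (size-× order order) (0# , 0#)
    in k , sizeByBijection size
         (λ (p , p≉0) → p , λ (2x≈0 , 2y≈0) → p≉0 (double-zero 2≉0 2x≈0 , double-zero 2≉0 2y≈0))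
         (λ e → e) (λ e → e)
         (λ (p , 2p≉0) → (p , λ (x≈0 , y≈0) → 2p≉0 (twice x≈0 , twice y≈0)) , refl , refl)
     , 1+k≡q²
    where
    twice : ∀ {x} → x ≈ 0# → x + x ≈ 0#
    twice x≈0 = trans (+-cong x≈0 x≈0) (+-identityˡ 0#)

  notTwoTorsion-even : 1# + 1# ≈ 0# → HasSize (plane ∣ₛ NotTwoTorsion) 0
  notTwoTorsion-even 2≈0 = sizeByBijection {A = ≡.setoid (Fin 0)} (Identity.inverse _)
    (λ ()) (λ { {()} }) (λ { {()} }) (λ (_ , 2p≉0) → contradiction (x+x≈0 _ , x+x≈0 _) 2p≉0)
    where
    open Characteristic2 2≈0 using (x+x≈0)

  module _ where
    private
      space : Setoid _ _
      space = ×-setoid setoid plane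

      4* : Carrier → Carrier
      4* x = (x + x) + (x + x)

    -- The triple stands for the binary form aX₀² + bX₀X₂ + cX₂²; the condition says that the conic
    -- obtained by adding X₁² is singular.
    Degenerate : Pred (Setoid.Carrier space) _
    Degenerate (a , b , c) = b * b ≈ 4* (a * c)

    private
      Degenerate-resp : Degenerate Respects (Setoid._≈_ space)
      Degenerate-resp (a , b , c) e =
        trans (*-cong (sym b) (sym b)) (trans e (+-cong (+-cong (*-cong a c) (*-cong a c)) (+-cong (*-cong a c) (*-cong a c))))

      discriminant-quad : ∀ a b d c → discriminant (quad a b d c) ≈ d * (4* (a * c) - b * b)
      discriminant-quad = solve 4 (λ a b d c → let z = Κ (+ 0) ; t = a ⊗ d ⊗ c in
        (t ⊕ (t ⊕ (t ⊕ (t ⊕ z)))) ⊕ z ⊗ b ⊗ z ⊕ ⊝ (a ⊗ (z ⊗ z)) ⊕ ⊝ (d ⊗ (b ⊗ b)) ⊕ ⊝ (c ⊗ (z ⊗ z))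
        ⊜ d ⊗ (((a ⊗ c ⊕ a ⊗ c) ⊕ (a ⊗ c ⊕ a ⊗ c)) ⊕ ⊝ (b ⊗ b)))

      nonsingular : ∀ {f : Vector Carrier 6} (f≉0 : ¬ (∀ i → f i ≈ 0#)) → (f , f≉0) ∈ ℋ₃ F →
        f 1F ≈ 0# → f 4F ≈ 0# → ∃ λ (x : ∃ (∁ Degenerate)) →
        let (a , b , c) , _ = x in Proportional F (quad a b 1# c) f
      nonsingular {f} f≉0 disc≉0 f₁≈0 f₄≈0 =
        ((a , b , c) , nd) , ∼-sym (d , d≉0 , ∀₆
          (a≈ , trans f₁≈0 (sym (zeroʳ d)) , b≈ , sym (*-identityʳ d) , trans f₄≈0 (sym (zeroʳ d)) , c≈))
        where
        d = f 3F
        disc≈ : discriminant f ≈ d * (4* (f 0F * f 5F) - f 2F * f 2F)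
        disc≈ = trans (discriminant-cong {f} {quad (f 0F) (f 2F) d (f 5F)} (∀₆ (refl , f₁≈0 , refl , refl , f₄≈0 , refl)))
          (discriminant-quad (f 0F) (f 2F) d (f 5F))
        d≉0 : ¬ d ≈ 0#
        d≉0 d≈0 = disc≉0 (trans disc≈ (trans (*-congʳ d≈0) (zeroˡ _)))
        a = proj₁ (divide d≉0 (f 0F))
        b = proj₁ (divide d≉0 (f 2F))
        c = proj₁ (divide d≉0 (f 5F))
        a≈ = proj₂ (divide d≉0 (f 0F))
        b≈ = proj₂ (divide d≉0 (f 2F))
        c≈ = proj₂ (divide d≉0 (f 5F))
        nd : ¬ Degenerate (a , b , c)
        nd b²≈4ac = disc≉0 (begin
          discriminant f                                 ≈⟨ disc≈ ⟩
          d * (4* (f 0F * f 5F) - f 2F * f 2F)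
            ≈⟨ *-congˡ (+-cong (+-cong (+-cong (*-cong a≈ c≈) (*-cong a≈ c≈)) (+-cong (*-cong a≈ c≈) (*-cong a≈ c≈))) (-‿cong (*-cong b≈ b≈))) ⟩
          d * (4* (d * a * (d * c)) - d * b * (d * b))
            ≈⟨ solve 4 (λ a b d c → let x = d ⊗ a ⊗ (d ⊗ c) in d ⊗ (((x ⊕ x) ⊕ (x ⊕ x)) ⊕ ⊝ (d ⊗ b ⊗ (d ⊗ b)))
                 ⊜ d ⊗ (d ⊗ d) ⊗ (((a ⊗ c ⊕ a ⊗ c) ⊕ (a ⊗ c ⊕ a ⊗ c)) ⊕ ⊝ (b ⊗ b))) a b d c ⟩
          d * (d * d) * (4* (a * c) - b * b)             ≈⟨ *-congˡ (+-congˡ (-‿cong b²≈4ac)) ⟩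
          d * (d * d) * (4* (a * c) - 4* (a * c))        ≈⟨ *-congˡ (-‿inverseʳ _) ⟩
          d * (d * d) * 0#                               ≈⟨ zeroʳ _ ⟩
          0#                                             ∎)

    -- The discriminant has the factor d, so a non-singular form scales uniquely to d = 1. What
    -- remains is the complement of the degenerate triples among all q³, and the zero triple is
    -- degenerate.
    ℋ₃-size : ∀ {m} → HasSize (space ∣ₛ Degenerate) m →
              ∃ λ n → HasSize (Normal F (ℋ₃ F)) n × m ℕ.+ n ≡ q ℕ.* (q ℕ.* q)
    ℋ₃-size degenerate =
      let n , size , m+n≡ = complement-size (size-× order (size-× order order)) Degenerate-resp
                              (λ (a , b , c) → b * b ≟ 4* (a * c)) degenerate
      in n , sizeByBijection {X = Normal F (ℋ₃ F)} size
           (λ ((a , b , c) , nd) → (quad a b 1# c , λ f≈0 → 1≉0 (f≈0 3F))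
             , (λ disc≈0 → nd (sym (x-y≈0⇒x≈y _ _ (trans (sym (*-identityˡ _)) (trans (sym (discriminant-quad a b 1# c)) disc≈0)))))
             , refl , refl)
           (λ (a , b , c) → GL₃Action.∼-of-≈ F (quad-cong a b refl c))
           (λ f∼g → let e = ∼⇒≈ f∼g 3F refl refl in e 0F , e 2F , e 5F)
           (λ ((f , f≉0) , f∈ , f₁≈0 , f₄≈0) → nonsingular f≉0 f∈ f₁≈0 f₄≈0)
       , m+n≡

    -- Here 4ac = 0, so the condition is b = 0, with a and c free.
    degenerate-even : 1# + 1# ≈ 0# → HasSize (space ∣ₛ Degenerate) (q ℕ.* q)
    degenerate-even 2≈0 = sizeByBijection (size-× order order)
      (λ (a , c) → (a , 0# , c) , trans (zeroˡ 0#) (sym (4*≈0 _)))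
      (λ (a , c) → a , refl , c) (λ (a , _ , c) → a , c)
      (λ ((a , b , c) , b²≈4ac) → (a , c) , refl , sym (square-zero (trans b²≈4ac (4*≈0 _))) , refl)
      where
      4*≈0 : ∀ x → 4* x ≈ 0#
      4*≈0 x = Characteristic2.x+x≈0 2≈0 (x + x)

    -- The degenerate forms with a ≠ 0 are a (X₀ + t X₂)², those with a = 0 are t X₂².
    degenerate-odd : ¬ 1# + 1# ≈ 0# → HasSize (space ∣ₛ Degenerate) (q ℕ.* q)
    degenerate-odd 2≉0 = sizeByBijection (size-× order order)
      (λ (a , t) → (a , a * t + a * t , last a t (a ≟ 0#)) , on a t (a ≟ 0#))
      (λ {(a , t)} {(a′ , t′)} (p , r) → p , +-cong (*-cong p r) (*-cong p r) , last-cong p r (a ≟ 0#) (a′ ≟ 0#))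
      (λ {(a , t)} {(a′ , t′)} (p , r , s) → p , injective p r (a ≟ 0#) (a′ ≟ 0#) s)
      (λ ((a , b , c) , e) → let t , b≈ , c≈ = preimage a b c e (a ≟ 0#) in (a , t) , refl , b≈ , c≈)
      where
      last : ∀ a → Carrier → Dec (a ≈ 0#) → Carrier
      last a t (yes _) = t
      last a t (no _)  = a * (t * t)

      on : ∀ a t d → Degenerate (a , a * t + a * t , last a t d)
      on a t (no _) = solve 2 (λ a t → let x = a ⊗ (a ⊗ (t ⊗ t)) in
        (a ⊗ t ⊕ a ⊗ t) ⊗ (a ⊗ t ⊕ a ⊗ t) ⊜ (x ⊕ x) ⊕ (x ⊕ x)) a t
      on a t (yes a≈0) = begin
        (a * t + a * t) * (a * t + a * t)    ≈⟨ solve 2 (λ a t → let x = a ⊗ (a ⊗ (t ⊗ t)) in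
                                                  (a ⊗ t ⊕ a ⊗ t) ⊗ (a ⊗ t ⊕ a ⊗ t) ⊜ (x ⊕ x) ⊕ (x ⊕ x)) a t ⟩
        4* (a * (a * (t * t)))               ≈⟨ +-cong (+-cong z z) (+-cong z z) ⟩
        4* (a * t)                           ∎
        where
        z : a * (a * (t * t)) ≈ a * t
        z = trans (trans (*-congʳ a≈0) (zeroˡ _)) (sym (trans (*-congʳ a≈0) (zeroˡ t)))

      last-cong : ∀ {a a′ t t′} → a ≈ a′ → t ≈ t′ → ∀ d d′ → last a t d ≈ last a′ t′ d′
      last-cong a≈ t≈ (yes _)   (yes _)    = t≈
      last-cong a≈ t≈ (yes a≈0) (no a′≉0)  = contradiction (trans (sym a≈) a≈0) a′≉0
      last-cong a≈ t≈ (no a≉0)  (yes a′≈0) = contradiction (trans a≈ a′≈0) a≉0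
      last-cong a≈ t≈ (no _)    (no _)     = *-cong a≈ (*-cong t≈ t≈)

      2a≉0 : ∀ {a} → ¬ a ≈ 0# → ¬ a + a ≈ 0#
      2a≉0 a≉0 2a≈0 = a≉0 (double-zero 2≉0 2a≈0)

      injective : ∀ {a a′ t t′} → a ≈ a′ → a * t + a * t ≈ a′ * t′ + a′ * t′ → ∀ d d′ →
                  last a t d ≈ last a′ t′ d′ → t ≈ t′
      injective a≈ e (yes _)   (yes _)    t≈ = t≈
      injective a≈ e (yes a≈0) (no a′≉0)  _  = contradiction (trans (sym a≈) a≈0) a′≉0
      injective {a} {a′} {t} {t′} a≈ e (no a≉0) _ _ = *-cancelˡ (2a≉0 a≉0) (begin
        (a + a) * t       ≈⟨ distribʳ t a a ⟩
        a * t + a * t     ≈⟨ e ⟩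
        a′ * t′ + a′ * t′ ≈⟨ +-cong (*-congʳ a≈) (*-congʳ a≈) ⟨
        a * t′ + a * t′   ≈⟨ distribʳ t′ a a ⟨
        (a + a) * t′      ∎)

      preimage : ∀ a b c → Degenerate (a , b , c) → ∀ d → ∃ λ t → a * t + a * t ≈ b × last a t d ≈ c
      preimage a b c e (yes a≈0) = c , trans (+-cong z z) (trans (+-identityˡ 0#) (sym b≈0)) , refl
        where
        z : a * c ≈ 0#
        z = trans (*-congʳ a≈0) (zeroˡ c)
        b≈0 : b ≈ 0#
        b≈0 = square-zero (begin
          b * b                ≈⟨ e ⟩
          4* (a * c)           ≈⟨ +-cong (+-cong z z) (+-cong z z) ⟩
          (0# + 0#) + (0# + 0#) ≈⟨ solve 0 ((Κ (+ 0) ⊕ Κ (+ 0)) ⊕ (Κ (+ 0) ⊕ Κ (+ 0)) ⊜ Κ (+ 0)) ⟩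
          0#                   ∎)
      preimage a b c e (no a≉0) =
        let t , b≈2at = divide (2a≉0 a≉0) b
            at+at≈b = trans (sym (distribʳ t a a)) (sym b≈2at)
        in t , at+at≈b , *-cancelˡ (2a≉0 (2a≉0 a≉0)) (begin
          ((a + a) + (a + a)) * (a * (t * t))  ≈⟨ solve 2 (λ a t → ((a ⊕ a) ⊕ (a ⊕ a)) ⊗ (a ⊗ (t ⊗ t))
              ⊜ (a ⊗ t ⊕ a ⊗ t) ⊗ (a ⊗ t ⊕ a ⊗ t)) a t ⟩
          (a * t + a * t) * (a * t + a * t)    ≈⟨ *-cong at+at≈b at+at≈b ⟩
          b * b                                ≈⟨ e ⟩
          4* (a * c)
            ≈⟨ solve 2 (λ a c → (a ⊗ c ⊕ a ⊗ c) ⊕ (a ⊗ c ⊕ a ⊗ c) ⊜ ((a ⊕ a) ⊕ (a ⊕ a)) ⊗ c) a c ⟩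
          ((a + a) + (a + a)) * c              ∎)

  private
    one : Setoid _ _
    one = ≡.setoid (Fin 1)

    one-size : HasSize one 1
    one-size = Identity.inverse _

    Target₁ = Normal F (ℋ₁ F)

    unique : ∀ (i j : Fin 1) → i ≡ j
    unique 0F 0F = ≡.refl

  -- The coefficients 2au₀u₁ and 2au₁u₂ of a square must vanish. With 2 invertible, a linear form
  -- that involves X₁ is thus a multiple of X₁, which gives one hyperplane; the others are the
  -- squares of the q + 1 linear forms in X₀ and X₂ up to scalars.
  ℋ₁-size-odd : ¬ 1# + 1# ≈ 0# → HasSize Target₁ (1 ℕ.+ (1 ℕ.+ q))
  ℋ₁-size-odd 2≉0 = sizeByBijection {X = Target₁} (size-⊎ one-size (size-⊎ one-size order))
    (λ x → let f≉0 , f∈ , n = member x in (form x , f≉0) , f∈ , n)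
    (λ e → GL₃Action.∼-of-≈ F (form-cong e))
    (λ {x} {y} → form-injective x y)
    (λ ((f , f≉0) , (a , u , a≉0 , f≈auu) , f₁≈0 , f₄≈0) → root f≉0 a≉0 u f≈auu f₁≈0 f₄≈0 (u 1F ≟ 0#) (u 0F ≟ 0#) (u 2F ≟ 0#))
    where
    domain : Setoid _ _
    domain = ⊎-setoid one (⊎-setoid one setoid)
    module A = Setoid domain

    form : A.Carrier → Vector Carrier 6
    form (inj₁ _)        = quad 0# 0# 1# 0#
    form (inj₂ (inj₁ _)) = quad 0# 0# 0# 1#
    form (inj₂ (inj₂ t)) = split-form (t + t) (t * t)

    member : ∀ x → ¬ (∀ i → form x i ≈ 0#) × (∃₂ λ a u → ¬ a ≈ 0# × (∀ i → form x i ≈ a * product F u u i)) × form x 1F ≈ 0# × form x 4F ≈ 0#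
    member (inj₁ _) = (λ f≈0 → 1≉0 (f≈0 3F)) , (1# , 0# ∷ 1# ∷ 0# ∷ [] , 1≉0 , ∀₆
      ( solve 0 (Κ (+ 0) ⊜ Κ (+ 1) ⊗ (Κ (+ 0) ⊗ Κ (+ 0)))
      , solve 0 (Κ (+ 0) ⊜ Κ (+ 1) ⊗ (Κ (+ 0) ⊗ Κ (+ 1) ⊕ Κ (+ 1) ⊗ Κ (+ 0)))
      , solve 0 (Κ (+ 0) ⊜ Κ (+ 1) ⊗ (Κ (+ 0) ⊗ Κ (+ 0) ⊕ Κ (+ 0) ⊗ Κ (+ 0)))
      , solve 0 (Κ (+ 1) ⊜ Κ (+ 1) ⊗ (Κ (+ 1) ⊗ Κ (+ 1)))
      , solve 0 (Κ (+ 0) ⊜ Κ (+ 1) ⊗ (Κ (+ 1) ⊗ Κ (+ 0) ⊕ Κ (+ 0) ⊗ Κ (+ 1)))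
      , solve 0 (Κ (+ 0) ⊜ Κ (+ 1) ⊗ (Κ (+ 0) ⊗ Κ (+ 0))))) , refl , refl
    member (inj₂ (inj₁ _)) = (λ f≈0 → 1≉0 (f≈0 5F)) , (1# , 0# ∷ 0# ∷ 1# ∷ [] , 1≉0 , ∀₆
      ( solve 0 (Κ (+ 0) ⊜ Κ (+ 1) ⊗ (Κ (+ 0) ⊗ Κ (+ 0)))
      , solve 0 (Κ (+ 0) ⊜ Κ (+ 1) ⊗ (Κ (+ 0) ⊗ Κ (+ 0) ⊕ Κ (+ 0) ⊗ Κ (+ 0)))
      , solve 0 (Κ (+ 0) ⊜ Κ (+ 1) ⊗ (Κ (+ 0) ⊗ Κ (+ 1) ⊕ Κ (+ 1) ⊗ Κ (+ 0)))
      , solve 0 (Κ (+ 0) ⊜ Κ (+ 1) ⊗ (Κ (+ 0) ⊗ Κ (+ 0)))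
      , solve 0 (Κ (+ 0) ⊜ Κ (+ 1) ⊗ (Κ (+ 0) ⊗ Κ (+ 1) ⊕ Κ (+ 1) ⊗ Κ (+ 0)))
      , solve 0 (Κ (+ 1) ⊜ Κ (+ 1) ⊗ (Κ (+ 1) ⊗ Κ (+ 1))))) , refl , refl
    member (inj₂ (inj₂ t)) = (λ f≈0 → 1≉0 (f≈0 0F)) , (1# , 1# ∷ 0# ∷ t ∷ [] , 1≉0 , ∀₆
      ( solve 0 (Κ (+ 1) ⊜ Κ (+ 1) ⊗ (Κ (+ 1) ⊗ Κ (+ 1)))
      , solve 0 (Κ (+ 0) ⊜ Κ (+ 1) ⊗ (Κ (+ 1) ⊗ Κ (+ 0) ⊕ Κ (+ 0) ⊗ Κ (+ 1)))
      , solve 1 (λ t → t ⊕ t ⊜ Κ (+ 1) ⊗ (Κ (+ 1) ⊗ t ⊕ t ⊗ Κ (+ 1))) t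
      , solve 0 (Κ (+ 0) ⊜ Κ (+ 1) ⊗ (Κ (+ 0) ⊗ Κ (+ 0)))
      , solve 1 (λ t → Κ (+ 0) ⊜ Κ (+ 1) ⊗ (Κ (+ 0) ⊗ t ⊕ t ⊗ Κ (+ 0))) t
      , sym (*-identityˡ _))) , refl , refl

    form-cong : ∀ {x y} → x A.≈ y → ∀ i → form x i ≈ form y i
    form-cong (inj₁ _)        i = refl
    form-cong (inj₂ (inj₁ _)) i = refl
    form-cong (inj₂ (inj₂ e))   = quad-cong refl (+-cong e e) refl (*-cong e e)

    form-injective : ∀ x y → Proportional F (form x) (form y) → x A.≈ y
    form-injective (inj₁ i)        (inj₁ j)        _ = inj₁ (unique i j)
    form-injective (inj₂ (inj₁ i)) (inj₂ (inj₁ j)) _ = inj₂ (inj₁ (unique i j))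
    form-injective (inj₂ (inj₂ t)) (inj₂ (inj₂ t′)) f∼g = inj₂ (inj₂ (*-cancelˡ 2≉0 (begin
      (1# + 1#) * t   ≈⟨ double t ⟨
      t + t           ≈⟨ ∼⇒≈ f∼g 0F refl refl 2F ⟩
      t′ + t′         ≈⟨ double t′ ⟩
      (1# + 1#) * t′  ∎)))
    form-injective (inj₁ _)        (inj₂ (inj₁ _)) f∼g = contradiction (∼-zeroʳ f∼g 3F refl) 1≉0
    form-injective (inj₁ _)        (inj₂ (inj₂ _)) f∼g = contradiction (∼-zeroʳ f∼g 3F refl) 1≉0
    form-injective (inj₂ (inj₁ _)) (inj₁ _)        f∼g = contradiction (∼-zeroˡ f∼g 3F refl) 1≉0
    form-injective (inj₂ (inj₂ _)) (inj₁ _)        f∼g = contradiction (∼-zeroˡ f∼g 3F refl) 1≉0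
    form-injective (inj₂ (inj₁ _)) (inj₂ (inj₂ _)) f∼g = contradiction (∼-zeroˡ f∼g 0F refl) 1≉0
    form-injective (inj₂ (inj₂ _)) (inj₂ (inj₁ _)) f∼g = contradiction (∼-zeroʳ f∼g 0F refl) 1≉0

    module _ {f : Vector Carrier 6} (f≉0 : ¬ (∀ i → f i ≈ 0#)) {a : Carrier} (a≉0 : ¬ a ≈ 0#) (u : Vector Carrier 3)
             (f≈auu : ∀ i → f i ≈ a * product F u u i) (f₁≈0 : f 1F ≈ 0#) (f₄≈0 : f 4F ≈ 0#) where
      private
        zero₂ : ∀ i j → u i ≈ 0# → a * (u i * u j) ≈ 0#
        zero₂ i j uᵢ≈0 = trans (*-congˡ (trans (*-congʳ uᵢ≈0) (zeroˡ _))) (zeroʳ a)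

        cross : ∀ i j → u i ≈ 0# → a * (u i * u j + u j * u i) ≈ 0#
        cross i j uᵢ≈0 = trans (*-congˡ (trans (+-cong (trans (*-congʳ uᵢ≈0) (zeroˡ _)) (trans (*-congˡ uᵢ≈0) (zeroʳ _))) (+-identityˡ 0#))) (zeroʳ a)

        zero∙ : ∀ {x k} → x ≈ 0# → x ≈ k * 0#
        zero∙ {k = k} x≈0 = trans x≈0 (sym (zeroʳ k))

      root : Dec (u 1F ≈ 0#) → Dec (u 0F ≈ 0#) → Dec (u 2F ≈ 0#) → ∃ λ x → Proportional F (form x) f
      root (no u₁≉0) _ _ = inj₁ 0F , ∼-sym (a * (u 1F * u 1F) , *-nonzero a≉0 (*-nonzero u₁≉0 u₁≉0) , ∀₆
          ( zero∙ (trans (f≈auu 0F) (zero₂ 0F 0F u₀≈0))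
          , zero∙ f₁≈0
          , zero∙ (trans (f≈auu 2F) (cross 0F 2F u₀≈0))
          , trans (f≈auu 3F) (sym (*-identityʳ _))
          , zero∙ f₄≈0
          , zero∙ (trans (f≈auu 5F) (zero₂ 2F 2F u₂≈0))
          ))
        where
        u₀≈0 : u 0F ≈ 0#
        u₀≈0 = *-cancel-0 u₁≉0 (double-zero 2≉0 (trans (+-congʳ (*-comm _ _)) (*-cancel-0 a≉0 (trans (sym (f≈auu 1F)) f₁≈0))))
        u₂≈0 : u 2F ≈ 0#
        u₂≈0 = *-cancel-0 u₁≉0 (double-zero 2≉0 (trans (+-congˡ (*-comm _ _)) (*-cancel-0 a≉0 (trans (sym (f≈auu 4F)) f₄≈0))))
      root (yes u₁≈0) (no u₀≉0) _ = let t , u₂≈u₀t = divide u₀≉0 (u 2F) in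
        inj₂ (inj₂ t) , ∼-sym (a * (u 0F * u 0F) , *-nonzero a≉0 (*-nonzero u₀≉0 u₀≉0) , ∀₆
          ( trans (f≈auu 0F) (sym (*-identityʳ _))
          , zero∙ f₁≈0
          , trans (f≈auu 2F) (trans (*-congˡ (+-cong (*-congˡ u₂≈u₀t) (*-congʳ u₂≈u₀t)))
              (solve 3 (λ a u t → a ⊗ (u ⊗ (u ⊗ t) ⊕ u ⊗ t ⊗ u) ⊜ a ⊗ (u ⊗ u) ⊗ (t ⊕ t)) a (u 0F) t))
          , zero∙ (trans (f≈auu 3F) (zero₂ 1F 1F u₁≈0))
          , zero∙ f₄≈0
          , trans (f≈auu 5F) (trans (*-congˡ (*-cong u₂≈u₀t u₂≈u₀t))
              (solve 3 (λ a u t → a ⊗ (u ⊗ t ⊗ (u ⊗ t)) ⊜ a ⊗ (u ⊗ u) ⊗ (t ⊗ t)) a (u 0F) t))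
          ))
      root (yes u₁≈0) (yes u₀≈0) (no u₂≉0) =
        inj₂ (inj₁ 0F) , ∼-sym (a * (u 2F * u 2F) , *-nonzero a≉0 (*-nonzero u₂≉0 u₂≉0) , ∀₆
          ( zero∙ (trans (f≈auu 0F) (zero₂ 0F 0F u₀≈0))
          , zero∙ f₁≈0
          , zero∙ (trans (f≈auu 2F) (cross 0F 2F u₀≈0))
          , zero∙ (trans (f≈auu 3F) (zero₂ 1F 1F u₁≈0))
          , zero∙ f₄≈0
          , trans (f≈auu 5F) (sym (*-identityʳ _))
          ))
      root (yes u₁≈0) (yes u₀≈0) (yes u₂≈0) = contradiction (λ i → trans (f≈auu i) (auu≈0 i)) f≉0
        where
        auu≈0 : ∀ i → a * product F u u i ≈ 0#
        auu≈0 = ∀₆ (zero₂ 0F 0F u₀≈0 , cross 0F 1F u₀≈0 , cross 0F 2F u₀≈0 , zero₂ 1F 1F u₁≈0 , cross 1F 2F u₁≈0 , zero₂ 2F 2F u₂≈0)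

  module _ (2≈0 : 1# + 1# ≈ 0#) where
    open Characteristic2 2≈0

    private
      domain : Setoid _ _
      domain = ⊎-setoid one (⊎-setoid setoid plane)
      module A = Setoid domain

      -- In characteristic 2 the squares of linear forms are the diagonal quadratic forms.
      form : A.Carrier → Vector Carrier 6
      form (inj₁ _)              = quad 0# 0# 1# 0#
      form (inj₂ (inj₁ d))       = quad 0# 0# d 1#
      form (inj₂ (inj₂ (d , c))) = quad 1# 0# d c

      -- The square of √a X₀ + √d X₁ + √c X₂: the cross terms are doubled and vanish.
      diagonal-square : ∀ a d c → ∃₂ λ k u → ¬ k ≈ 0# × (∀ i → quad a 0# d c i ≈ k * product F u u i)
      diagonal-square a d c = 1# , u , 1≉0 , ∀₆
        ( entry (proj₂ (sqrt a)) , crossing 0F 1F , crossing 0F 2F , entry (proj₂ (sqrt d)) , crossing 1F 2F , entry (proj₂ (sqrt c)) )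
        where
        u : Vector Carrier 3
        u = proj₁ (sqrt a) ∷ proj₁ (sqrt d) ∷ proj₁ (sqrt c) ∷ []
        entry : ∀ {x y} → y ≈ x → x ≈ 1# * y
        entry y≈x = trans (sym y≈x) (sym (*-identityˡ _))
        crossing : ∀ i j → 0# ≈ 1# * (u i * u j + u j * u i)
        crossing i j = sym (trans (*-identityˡ _) (trans (+-congˡ (*-comm _ _)) (x+x≈0 _)))

      form-cong : ∀ {x y} → x A.≈ y → ∀ i → form x i ≈ form y i
      form-cong (inj₁ _)              i = refl
      form-cong (inj₂ (inj₁ d))         = quad-cong refl refl d refl
      form-cong (inj₂ (inj₂ (d , c)))   = quad-cong refl refl d c

      form-injective : ∀ x y → Proportional F (form x) (form y) → x A.≈ y
      form-injective (inj₁ i)        (inj₁ j)        _   = inj₁ (unique i j)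
      form-injective (inj₂ (inj₁ _)) (inj₂ (inj₁ _)) f∼g = inj₂ (inj₁ (∼⇒≈ f∼g 5F refl refl 3F))
      form-injective (inj₂ (inj₂ _)) (inj₂ (inj₂ _)) f∼g = inj₂ (inj₂ (∼⇒≈ f∼g 0F refl refl 3F , ∼⇒≈ f∼g 0F refl refl 5F))
      form-injective (inj₁ _)        (inj₂ (inj₁ _)) f∼g = contradiction (∼-zeroˡ f∼g 5F refl) 1≉0
      form-injective (inj₁ _)        (inj₂ (inj₂ _)) f∼g = contradiction (∼-zeroˡ f∼g 0F refl) 1≉0
      form-injective (inj₂ (inj₁ _)) (inj₁ _)        f∼g = contradiction (∼-zeroʳ f∼g 5F refl) 1≉0
      form-injective (inj₂ (inj₂ _)) (inj₁ _)        f∼g = contradiction (∼-zeroʳ f∼g 0F refl) 1≉0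
      form-injective (inj₂ (inj₁ _)) (inj₂ (inj₂ _)) f∼g = contradiction (∼-zeroˡ f∼g 0F refl) 1≉0
      form-injective (inj₂ (inj₂ _)) (inj₂ (inj₁ _)) f∼g = contradiction (∼-zeroʳ f∼g 0F refl) 1≉0

      member : ∀ x → ¬ (∀ i → form x i ≈ 0#) × (∃₂ λ a u → ¬ a ≈ 0# × (∀ i → form x i ≈ a * product F u u i)) × form x 1F ≈ 0# × form x 4F ≈ 0#
      member (inj₁ _)              = (λ f≈0 → 1≉0 (f≈0 3F)) , diagonal-square _ _ _ , refl , refl
      member (inj₂ (inj₁ d))       = (λ f≈0 → 1≉0 (f≈0 5F)) , diagonal-square _ _ _ , refl , refl
      member (inj₂ (inj₂ (d , c))) = (λ f≈0 → 1≉0 (f≈0 0F)) , diagonal-square _ _ _ , refl , refl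

      normalise : ∀ {f : Vector Carrier 6} → ¬ (∀ i → f i ≈ 0#) → f 1F ≈ 0# → f 2F ≈ 0# → f 4F ≈ 0# →
        Dec (f 0F ≈ 0#) → Dec (f 5F ≈ 0#) → ∃ λ x → Proportional F (form x) f
      normalise {f} f≉0 f₁≈0 f₂≈0 f₄≈0 (no f₀≉0) _ =
        let d , d≈ = divide f₀≉0 (f 3F)
            c , c≈ = divide f₀≉0 (f 5F)
        in inj₂ (inj₂ (d , c)) , ∼-sym (f 0F , f₀≉0 , ∀₆
          (sym (*-identityʳ _) , trans f₁≈0 (sym (zeroʳ _)) , trans f₂≈0 (sym (zeroʳ _)) , d≈ , trans f₄≈0 (sym (zeroʳ _)) , c≈))
      normalise {f} f≉0 f₁≈0 f₂≈0 f₄≈0 (yes f₀≈0) (no f₅≉0) =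
        let d , d≈ = divide f₅≉0 (f 3F)
        in inj₂ (inj₁ d) , ∼-sym (f 5F , f₅≉0 , ∀₆
          (trans f₀≈0 (sym (zeroʳ _)) , trans f₁≈0 (sym (zeroʳ _)) , trans f₂≈0 (sym (zeroʳ _)) , d≈ , trans f₄≈0 (sym (zeroʳ _)) , sym (*-identityʳ _)))
      normalise {f} f≉0 f₁≈0 f₂≈0 f₄≈0 (yes f₀≈0) (yes f₅≈0) = inj₁ 0F , ∼-sym (f 3F
        , (λ f₃≈0 → f≉0 (∀₆ (f₀≈0 , f₁≈0 , f₂≈0 , f₃≈0 , f₄≈0 , f₅≈0))) , ∀₆
          (trans f₀≈0 (sym (zeroʳ _)) , trans f₁≈0 (sym (zeroʳ _)) , trans f₂≈0 (sym (zeroʳ _)) , sym (*-identityʳ _) , trans f₄≈0 (sym (zeroʳ _)) , trans f₅≈0 (sym (zeroʳ _))))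

    -- The diagonal forms make up a projective plane. Its points are sorted by whether the
    -- coefficient at X₀², else at X₂², else at X₁² is the one scaled to 1.
    ℋ₁-size-even : HasSize Target₁ (1 ℕ.+ (q ℕ.+ q ℕ.* q))
    ℋ₁-size-even = sizeByBijection {X = Target₁} (size-⊎ one-size (size-⊎ order (size-× order order)))
      (λ x → let f≉0 , f∈ , n = member x in (form x , f≉0) , f∈ , n)
      (λ e → GL₃Action.∼-of-≈ F (form-cong e))
      (λ {x} {y} → form-injective x y)
      (λ ((f , f≉0) , (a , u , _ , f≈auu) , f₁≈0 , f₄≈0) →
        normalise f≉0 f₁≈0 (trans (f≈auu 2F) (trans (*-congˡ (trans (+-congˡ (*-comm _ _)) (x+x≈0 _))) (zeroʳ a))) f₄≈0
          (f 0F ≟ 0#) (f 5F ≟ 0#))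

-- Arithmetic of the counts

module Arithmetic where
  open import Data.Nat using (suc; _+_; _*_; _∸_; _^_; _/_)

  half : ∀ {m n} → m + m ≡ n → n / 2 ≡ m
  half {m} ≡.refl = ≡.trans (≡.cong (_/ 2) (double≡*2 m)) (ℕ.m*n/n≡m m 2)

  double-injective : ∀ {m n} → m + m ≡ n + n → m ≡ n
  double-injective {m} {n} e = ≡.trans (≡.sym (half {m} ≡.refl)) (half (≡.sym e))

  odd⇒suc-double : ∀ {n} → ¬ 2 ∣ n → ∃ λ j → n ≡ suc (j + j)
  odd⇒suc-double {0}           2∤n = contradiction (2 ∣0) 2∤n
  odd⇒suc-double {1}           2∤n = 0 , ≡.refl
  odd⇒suc-double {suc (suc n)} 2∤n =
    let j , n≡ = odd⇒suc-double (λ 2∣n → 2∤n (∣m∣n⇒∣m+n ∣-refl 2∣n))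
    in suc j , ≡.cong suc (≡.trans (≡.cong suc n≡) (≡.cong suc (≡.sym (ℕ.+-suc j j))))

  module _ (q : ℕ) where
    open ≡.≡-Reasoning
    open +-*-Solver

    square : q ^ 2 ≡ q * q
    square = ≡.cong (q *_) (ℕ.*-identityʳ q)

    -- From 2m = (q² - q) + 2q + (q² - 1). Adding 1 on both sides makes `q + k` and `suc b` appear,
    -- each equal to q², so that no truncated subtraction is involved.
    ℋ₂ᵣ-odd : ∀ {j m k b} → q ≡ suc (j + j) → q + k ≡ q * q → suc b ≡ q * q →
              m + m ≡ (k + (q + q)) + b → m ≡ q ^ 2 + (q ∸ 1) / 2
    ℋ₂ᵣ-odd {j} {m} {k} {b} q≡ q+k≡ 1+b≡ m+m≡ = double-injective (ℕ.suc-injective (begin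
      suc (m + m)                        ≡⟨ ≡.cong suc m+m≡ ⟩
      suc ((k + (q + q)) + b)            ≡⟨ solve 3 (λ q k b → con 1 :+ ((k :+ (q :+ q)) :+ b) := (q :+ k) :+ (con 1 :+ b) :+ q) ≡.refl q k b ⟩
      (q + k) + suc b + q                ≡⟨ ≡.cong₂ _+_ (≡.cong₂ _+_ (≡.trans q+k≡ (≡.sym square)) (≡.trans 1+b≡ (≡.sym square))) q≡ ⟩
      q ^ 2 + q ^ 2 + suc (j + j)        ≡⟨ solve 2 (λ Q j → Q :+ Q :+ (con 1 :+ (j :+ j)) := con 1 :+ ((Q :+ j) :+ (Q :+ j))) ≡.refl (q ^ 2) j ⟩
      suc ((q ^ 2 + j) + (q ^ 2 + j))    ≡⟨ ≡.cong (λ i → suc ((q ^ 2 + i) + (q ^ 2 + i))) (half (≡.sym (≡.cong (_∸ 1) q≡))) ⟨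
      suc ((q ^ 2 + (q ∸ 1) / 2) + (q ^ 2 + (q ∸ 1) / 2)) ∎))

    ℋ₂ᵣ-even : ∀ {m k} → q + k ≡ q * q → m + m ≡ (k + (q + q)) + 0 → m ≡ (q ^ 2 + q) / 2
    ℋ₂ᵣ-even {m} {k} q+k≡ m+m≡ = ≡.sym (half (begin
      m + m               ≡⟨ m+m≡ ⟩
      (k + (q + q)) + 0   ≡⟨ solve 2 (λ q k → (k :+ (q :+ q)) :+ con 0 := (q :+ k) :+ q) ≡.refl q k ⟩
      (q + k) + q         ≡⟨ ≡.cong (_+ q) (≡.trans q+k≡ (≡.sym square)) ⟩
      q ^ 2 + q           ∎))

    -- The equation 2m = (q² - q) + (q² - 1) is brought to the form 2(m + (q + 1)/2) = 2q², where (q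
    -- + 1)/2 is `suc j`. This shows that the truncated subtraction in the result is exact.
    ℋ₂ᵢ-odd : ∀ {j m k b} → q ≡ suc (j + j) → q + k ≡ q ^ 2 → suc b ≡ q * q →
              m + m ≡ k + b → m ≡ q ^ 2 ∸ (q + 1) / 2
    ℋ₂ᵢ-odd {j} {m} {k} {b} q≡ q+k≡ 1+b≡ m+m≡ = begin
      m                              ≡⟨ ℕ.m+n∸n≡m m (suc j) ⟨
      (m + suc j) ∸ suc j            ≡⟨ ≡.cong₂ _∸_ (double-injective {m + suc j} total) (≡.sym (half {suc j} (≡.trans (≡.cong suc (ℕ.+-suc j j)) (≡.trans (≡.cong suc (≡.sym q≡)) (ℕ.+-comm 1 q))))) ⟩
      q ^ 2 ∸ (q + 1) / 2            ∎
      where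
      total : (m + suc j) + (m + suc j) ≡ q ^ 2 + q ^ 2
      total = begin
        (m + suc j) + (m + suc j)    ≡⟨ solve 2 (λ m j → (m :+ (con 1 :+ j)) :+ (m :+ (con 1 :+ j)) := (con 1 :+ (j :+ j)) :+ (con 1 :+ (m :+ m))) ≡.refl m j ⟩
        suc (j + j) + suc (m + m)    ≡⟨ ≡.cong₂ (λ x y → x + suc y) (≡.sym q≡) m+m≡ ⟩
        q + suc (k + b)              ≡⟨ solve 3 (λ q k b → q :+ (con 1 :+ (k :+ b)) := (q :+ k) :+ (con 1 :+ b)) ≡.refl q k b ⟩
        (q + k) + suc b              ≡⟨ ≡.cong₂ _+_ q+k≡ (≡.trans 1+b≡ (≡.sym square)) ⟩
        q ^ 2 + q ^ 2                ∎

    ℋ₂ᵢ-even : ∀ {m k} → q + k ≡ q ^ 2 → m + m ≡ k + 0 → m ≡ (q ^ 2 ∸ q) / 2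
    ℋ₂ᵢ-even {m} {k} q+k≡ m+m≡ = ≡.sym (half (begin
      m + m          ≡⟨ m+m≡ ⟩
      k + 0          ≡⟨ ℕ.+-identityʳ k ⟩
      k              ≡⟨ ℕ.m+n∸m≡n q k ⟨
      q + k ∸ q      ≡⟨ ≡.cong (_∸ q) q+k≡ ⟩
      q ^ 2 ∸ q      ∎))

    ℋ₃-count : ∀ {n} → q * q + n ≡ q * (q * q) → n ≡ q ^ 3 ∸ q ^ 2
    ℋ₃-count {n} e = begin
      n                        ≡⟨ ℕ.m+n∸m≡n (q * q) n ⟨
      q * q + n ∸ q * q        ≡⟨ ≡.cong (_∸ q * q) e ⟩
      q * (q * q) ∸ q * q      ≡⟨ ≡.cong (λ Q → q * Q ∸ Q) square ⟨
      q ^ 3 ∸ q ^ 2            ∎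

    ℋ₁-even : 1 + (q + q * q) ≡ q ^ 2 + q + 1
    ℋ₁-even = solve 1 (λ q → con 1 :+ (q :+ q :* q) := q :* (q :* con 1) :+ q :+ con 1) ≡.refl q

-- The distribution for odd and for even q

open import Data.Nat using (_+_; _∸_; _^_; _/_)
open import Data.Vec using ([]; _∷_)

lemma4p9 : ∀ {c ℓ c′ ℓ′ : Level} (q : ℕ) → IsPrimePower q →
    (F : FiniteField q c ℓ) (E : QuadraticExtension F c′ ℓ′)
    (L : Line F) → L ∈ o₁₂,₁ F →
    (¬ 2 ∣ q →
    OD₄≡ F L E
    ( q + 2
    ∷ q ^ 2 + (q ∸ 1) / 2
    ∷ q ^ 2 ∸ (q + 1) / 2
    ∷ q ^ 3 ∸ q ^ 2
    ∷ [] ))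
    × (2 ∣ q →
    OD₄≡ F L E
    ( q ^ 2 + q + 1
    ∷ (q ^ 2 + q) / 2
    ∷ (q ^ 2 ∸ q) / 2
    ∷ q ^ 3 ∸ q ^ 2
    ∷ [] ))
lemma4p9 q _ F E L (g , L≐image) = odd , even
  where
  open Arithmetic
  open FieldProperties F using (odd⇒2≉0; even⇒2≈0)
  open Counts F
  open RealPairsCount F using (ℋ₂ᵣ-size)
  open ImaginaryPairsCount F E using (ℋ₂ᵢ-size)

  count : ∀ {r m n} (𝒮 : Pred (Hyperplane F) r) → Invariant F 𝒮 → HasSize (Normal F 𝒮) m → m ≡ n →
          CountContaining F L 𝒮 n
  count 𝒮 invariant size m≡n =
    transport F L g L≐image {𝒮 = 𝒮} invariant (≡.subst (HasSize (Normal F 𝒮)) m≡n size)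

  odd : ¬ 2 ∣ q → OD₄≡ F L E (q + 2 ∷ q ^ 2 + (q ∸ 1) / 2 ∷ q ^ 2 ∸ (q + 1) / 2 ∷ q ^ 3 ∸ q ^ 2 ∷ [])
  odd 2∤q =
    let j , q≡ = odd⇒suc-double 2∤q
        2≉0 = odd⇒2≉0 2∤q
        b , b-size , 1+b≡ = notTwoTorsion-odd 2≉0
        _ , _ , size₂ᵣ , q+k≡ , m+m≡ = ℋ₂ᵣ-size b-size
        _ , _ , size₂ᵢ , q+k≡′ , m+m≡′ = ℋ₂ᵢ-size b-size
        _ , size₃ , n≡ = ℋ₃-size (degenerate-odd 2≉0)
    in count (ℋ₁ F) (ℋ₁-invariant F) (ℋ₁-size-odd 2≉0) (ℕ.+-comm 2 q)
     , count (ℋ₂ᵣ F) (ℋ₂ᵣ-invariant F) size₂ᵣ (ℋ₂ᵣ-odd q {j} q≡ q+k≡ 1+b≡ m+m≡)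
     , count (ℋ₂ᵢ F E) (ℋ₂ᵢ-invariant F E) size₂ᵢ (ℋ₂ᵢ-odd q {j} q≡ q+k≡′ 1+b≡ m+m≡′)
     , count (ℋ₃ F) (ℋ₃-invariant F) size₃ (ℋ₃-count q n≡)

  even : 2 ∣ q → OD₄≡ F L E (q ^ 2 + q + 1 ∷ (q ^ 2 + q) / 2 ∷ (q ^ 2 ∸ q) / 2 ∷ q ^ 3 ∸ q ^ 2 ∷ [])
  even 2∣q =
    let 2≈0 = even⇒2≈0 2∣q
        b-size = notTwoTorsion-even 2≈0
        _ , _ , size₂ᵣ , q+k≡ , m+m≡ = ℋ₂ᵣ-size b-size
        _ , _ , size₂ᵢ , q+k≡′ , m+m≡′ = ℋ₂ᵢ-size b-size
        _ , size₃ , n≡ = ℋ₃-size (degenerate-even 2≈0)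
    in count (ℋ₁ F) (ℋ₁-invariant F) (ℋ₁-size-even 2≈0) (ℋ₁-even q)
     , count (ℋ₂ᵣ F) (ℋ₂ᵣ-invariant F) size₂ᵣ (ℋ₂ᵣ-even q q+k≡ m+m≡)
     , count (ℋ₂ᵢ F E) (ℋ₂ᵢ-invariant F E) size₂ᵢ (ℋ₂ᵢ-even q q+k≡′ m+m≡′)
     , count (ℋ₃ F) (ℋ₃-invariant F) size₃ (ℋ₃-count q n≡)
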